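{- Let $d$ be a positive integer, let $H$ be a $d$-bounded bipartite graph and let $c>0$. Then there are constants $C$ and $\alpha>0$ (depending only on $H$, $d$ and $c$) such that the following holds. If $\Gamma$ is a $(c,t)$-sparse graph with $n$ vertices, for some $t$, then any subgraph $G\subseteq \Gamma$ with at least $C t^{1/d} n^{2-1/d}$ edges contains at least $\alpha q^{e(H)} n^{v(H)}$ copies of $H$ which are induced copies in $\Gamma$, where $q=2e(G)/n^2$.
   Context: A graph $\Gamma$ is $(c,t)$-sparse if for every pair of (not necessarily disjoint) vertex subsets $A,B\subseteq V(\Gamma)$ with $|A|,|B|\ge t$ we have $e(A,B)\le (1-c)|A||B|$, where $e(A,B)$ is the number of ordered pairs $(a,b)\in A\times B$ such that $\{a,b\}$ is an edge of $\Gamma$ (so an edge inside $A\cap B$ is counted twice). A bipartite graph $H=(A\cup B,E)$ is $d$-bounded if there are between $1$ and $d$ vertices in $A$ which are adjacent to all vertices of $B$, and every other vertex of $A$ has degree at most $d$. A copy of $H$ in $G$ is induced in $\Gamma$ if the subgraph of $\Gamma$ induced on its vertex set is exactly that copy (i.e. nonadjacent pairs of $H$ are nonedges of $\Gamma$). $e(H)$ and $v(H)$ denote the numbers of edges and vertices of $H$. -}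

module Defs where

import Algebra.Definitions.RawSemiring as RawSemiringDefs
open import Data.Fin using (Fin; _<?_)
open import Data.Fin.Properties using (all?)
open import Data.Fin.Subset using (Subset; _∈_; _∉_; ∁; ∣_∣)
open import Data.Fin.Subset.Properties using (_∈?_)
open import Data.Integer using (+_)
open import Data.List using (List; length; filter; allFin; cartesianProduct)
open import Data.List.Relation.Unary.All using (All)
open import Data.List.Relation.Unary.AllPairs using (AllPairs)
open import Data.Nat as ℕ using (ℕ; NonZero)
open import Data.Nat.Properties using (m*n≢0)
open import Data.Product using (∃; ∃₂; _×_; _,_)
open import Data.Rational as ℚ using (ℚ; 1ℚ; _/_; _≤_)
open import Function using (_⇔_)
open import Function.Definitions using (Injective)
open import Level using (0ℓ)
open import Relation.Binary.Core using (Rel)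
open import Relation.Binary.Definitions using (Decidable; Symmetric; Irreflexive)
open import Relation.Binary.PropositionalEquality using (_≡_)
open import Relation.Nullary using (¬_; _×-dec_; _→-dec_)

infix 9 _/1

_/1 : ℕ → ℚ
m /1 = + m / 1

open RawSemiringDefs ℚ.+-*-rawSemiring public using () renaming (_^_ to _^ℚ_)

record Graph (n : ℕ) : Set₁ where
  infix 4 _~_ _~?_
  field
    _~_    : Rel (Fin n) 0ℓ
    _~?_   : Decidable _~_
    sym    : Symmetric _~_
    irrefl : Irreflexive _≡_ _~_

  degree : Fin n → ℕ
  degree u = length (filter (u ~?_) (allFin n))

  -- Each unordered edge is counted once, through its increasing orientation.
  size : ℕ
  size = length (filter (λ (u , v) → (u <? v) ×-dec (u ~? v))
                        (cartesianProduct (allFin n) (allFin n)))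

  e : Subset n → Subset n → ℕ
  e A B = length (filter (λ (a , b) → (a ∈? A) ×-dec (b ∈? B) ×-dec (a ~? b))
                         (cartesianProduct (allFin n) (allFin n)))

-- Subgraphs here have the same vertex set as the ambient graph.
infix 4 _⊆ᴳ_
_⊆ᴳ_ : ∀ {n} → Graph n → Graph n → Set
G ⊆ᴳ Γ = ∀ u v → Graph._~_ G u v → Graph._~_ Γ u v

-- The threshold t is rational, so it need not be an integer.
Sparse : ∀ {n} → ℚ → ℚ → Graph n → Set
Sparse {n} c t Γ = (A B : Subset n) → t ≤ ∣ A ∣ /1 → t ≤ ∣ B ∣ /1 →
  Graph.e Γ A B /1 ≤ (1ℚ ℚ.- c) ℚ.* (∣ A ∣ /1 ℚ.* ∣ B ∣ /1)

-- A bipartite graph on h vertices, with its ordered bipartition A ∪ B.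
record BipartiteGraph (h : ℕ) : Set₁ where
  field
    graph : Graph h
    A     : Subset h

  open Graph graph public

  B : Subset h
  B = ∁ A

  field
    A-independent : ∀ {u v} → u ∈ A → v ∈ A → ¬ (u ~ v)
    B-independent : ∀ {u v} → u ∈ B → v ∈ B → ¬ (u ~ v)

  CompleteToB : Fin h → Set
  CompleteToB u = ∀ v → v ∈ B → u ~ v

  numCompleteToB : ℕ
  numCompleteToB = length (filter
    (λ u → (u ∈? A) ×-dec all? (λ v → (v ∈? B) →-dec (u ~? v))) (allFin h))

record Bounded {h : ℕ} (d : ℕ) (H : BipartiteGraph h) : Set where
  open BipartiteGraph H
  field
    1≤numCompleteToB : 1 ℕ.≤ numCompleteToB
    numCompleteToB≤d : numCompleteToB ℕ.≤ d
    degree≤d         : ∀ u → u ∈ A → ¬ CompleteToB u → degree u ℕ.≤ d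

-- A copy of H in G is a subgraph of G isomorphic to H.  It is presented by an
-- isomorphism from H onto it; presentations differing by an automorphism of H
-- give the same copy and are identified by _≈ᶜ_.
record Copy {h n : ℕ} (H : Graph h) (G : Graph n) : Set where
  private
    module H = Graph H
    module G = Graph G
  field
    embed     : Fin h → Fin n
    injective : Injective _≡_ _≡_ embed
    edges     : ∀ {u v} → u H.~ v → embed u G.~ embed v

  Vertex : Fin n → Set
  Vertex x = ∃ λ u → embed u ≡ x

  Edge : Fin n → Fin n → Set
  Edge x y = ∃₂ λ u v → (u H.~ v) × (embed u ≡ x) × (embed v ≡ y)

infix 4 _≈ᶜ_
_≈ᶜ_ : ∀ {h n} {H : Graph h} {G : Graph n} → Copy H G → Copy H G → Set
K ≈ᶜ L = (∀ x → Copy.Vertex K x ⇔ Copy.Vertex L x)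
       × (∀ x y → Copy.Edge K x y ⇔ Copy.Edge L x y)

InducedIn : ∀ {h n} {H : Graph h} {G : Graph n} → Graph n → Copy H G → Set
InducedIn Γ K = ∀ x y → Copy.Vertex K x → Copy.Vertex K y →
  Copy.Edge K x y ⇔ Graph._~_ Γ x y

-- The number of distinct copies of H in G that are induced in Γ is at least x.
AtLeastInducedCopies : ∀ {h n} → ℚ → Graph h → Graph n → Graph n → Set
AtLeastInducedCopies x H G Γ = ∃ λ (Ks : List (Copy H G)) →
    AllPairs (λ K L → ¬ (K ≈ᶜ L)) Ks
  × All (InducedIn Γ) Ks
  × x ≤ length Ks /1

-- q = 2 e(G) / n²
density : ∀ {n} → .{{NonZero n}} → Graph n → ℚ
density {n} G = _/_ (+ (2 ℕ.* Graph.size G)) (n ℕ.* n) {{m*n≢0 n n}}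

-- e(G) ≥ C t^{1/d} n^{2 - 1/d}, with both sides raised to the power d; for
-- d ≥ 1 and C, t ≥ 0 both sides are nonnegative, so this is equivalent.
ManyEdges : ∀ {n} → ℕ → ℚ → ℚ → Graph n → Set
ManyEdges {n} d C t G =
  (C ^ℚ d) ℚ.* t ℚ.* (n /1 ^ℚ (2 ℕ.* d ℕ.∸ 1)) ≤ Graph.size G /1 ^ℚ d

{-# OPTIONS --safe #-}
module Submission where

-- Let q = 2e(G)/n², let N(X) be the common neighbourhood of a k-tuple X among the vertices of
-- degree at least qn/2, and f(X) = ∣N(X)∣.  The k vertices complete to B are embedded as X with
-- weight f(X), then B as a tuple Y in N(X), then every other vertex of A in the common
-- neighbourhood of the vertices of Y it is adjacent to.
--
-- Sparseness enters only as follows: if W is not too small, all but at most τ vertices (τ a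
-- constant times t) have a positive fraction of non-neighbours in W.  Choosing vertices one at a
-- time, this gives a positive proportion of independent transversals of large sets.  The
-- hypothesis on e(G) says qʲn ≥ Mτ for all j ≤ d, with M as large as we please.
--
-- The delicate point is that, for most ℓ-tuples S in N(X) with ℓ ≤ d, a set of order qˡn inside
-- the common neighbourhood of S should avoid the Γ-neighbourhood of X.  Fix S and X without xᵢ:
-- S fails because of xᵢ for at most τ choices of xᵢ, or for fewer than ε qˡn choices when the
-- common neighbourhood of S is smaller than that.  Since those X with f(X) much smaller than
-- q f(X − xᵢ) are negligible, the tuples X with many failing S carry little of the total weight.

-- Copies are to be induced in Γ, so the danger is a candidate set lying almost wholly in the
-- Γ-neighbourhood of vertices already embedded. For the vertices of Y outside S a plain union bound
-- helps: they range freely over N(X), of order qᵏn, far above τ as k ≤ d. For X it does not: S lies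
-- in N(X), which confines X to the common neighbourhood of S. Only about qˡn choices of xᵢ fit a
-- given S, and τ is negligible against these as ℓ ≤ d. So both halves of d-boundedness enter here.
-- The averaging, for ℓ ≥ 1: given X - xᵢ, at most f(X - xᵢ)ˡ qˡn / c₄ pairs (xᵢ, S) fail. An
-- `overloaded` X has more than f(X)ˡ / c₃ failing S; ℓ - 1 of these factors f(X) are traded for q
-- f(X - xᵢ) / c₁ and the last is kept as the weight. The `overloaded` X thus weigh O(q n f(X - xᵢ)
-- / c₄), against a total of at least q n f(X - xᵢ) / 2. The weight also replaces convexity: of the
-- ∣B∣ factors in f(X)^∣B∣ one is the weight, and the others are bounded below once the X with f(X)
-- far below qᵏn are discarded.

module Combinatorics where

  open import Data.Bool as Bool using (Bool; true; false; _∧_; _∨_; not)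
  open import Data.Fin using (Fin; zero; suc)
  open import Data.List using (List; []; _∷_; _++_; length; map; concatMap; allFin; cartesianProduct)
  open import Data.List.Membership.Propositional using (_∈_)
  open import Data.List.Membership.Propositional.Properties using (∈-allFin; ∈-cartesianProduct⁺)
  open import Data.List.Properties using (length-tabulate; length-++; length-map)
  open import Data.List.Relation.Unary.Any using (here; there)
  open import Data.Nat
    using (ℕ; zero; suc; pred; _+_; _*_; _^_; _∸_; _≤_; _<_; z≤n; s≤s; _<ᵇ_; _≤ᵇ_; NonZero; ≢-nonZero; >-nonZero; >-nonZero⁻¹)
  open import Data.Nat.Properties
  open import Data.Nat.Tactic.RingSolver using (solve-∀)
  open import Data.Product using (∃₂; _×_; _,_; proj₁; proj₂)
  open import Data.Unit using (tt)
  open import Data.Vec as Vec using (Vec; []; _∷_; lookup; insertAt; removeAt)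
  open import Data.Vec.Properties using (lookup-map; lookup-replicate; removeAt-insertAt)
  open import Relation.Binary.PropositionalEquality using (_≡_; _≢_; refl; sym; trans; cong; cong₂; subst)
  open import Relation.Nullary using (contradiction; yes; no)

  -- Finite sums over lists.

  ∑ : {A : Set} → List A → (A → ℕ) → ℕ
  ∑ []       f = 0
  ∑ (x ∷ xs) f = f x + ∑ xs f

  syntax ∑ xs (λ x → e) = ∑[ x ∈ xs ] e

  module _ {A : Set} where

    ∑-cong : ∀ (xs : List A) {f g} → (∀ x → f x ≡ g x) → ∑ xs f ≡ ∑ xs g
    ∑-cong []       f≡g = refl
    ∑-cong (x ∷ xs) f≡g = cong₂ _+_ (f≡g x) (∑-cong xs f≡g)

    ∑-mono : ∀ (xs : List A) {f g} → (∀ x → f x ≤ g x) → ∑ xs f ≤ ∑ xs g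
    ∑-mono []       f≤g = z≤n
    ∑-mono (x ∷ xs) f≤g = +-mono-≤ (f≤g x) (∑-mono xs f≤g)

    ∑-0 : ∀ (xs : List A) → ∑[ x ∈ xs ] 0 ≡ 0
    ∑-0 []       = refl
    ∑-0 (x ∷ xs) = ∑-0 xs

    ∑-+ : ∀ (xs : List A) f g → ∑[ x ∈ xs ] (f x + g x) ≡ ∑ xs f + ∑ xs g
    ∑-+ []       f g = refl
    ∑-+ (x ∷ xs) f g rewrite ∑-+ xs f g = lemma (f x) (g x) (∑ xs f) (∑ xs g)
      where
      lemma : ∀ a b c d → a + b + (c + d) ≡ a + c + (b + d)
      lemma = solve-∀

    ∑-*ˡ : ∀ c (xs : List A) f → ∑[ x ∈ xs ] (c * f x) ≡ c * ∑ xs f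
    ∑-*ˡ c []       f = sym (*-zeroʳ c)
    ∑-*ˡ c (x ∷ xs) f = trans (cong (c * f x +_) (∑-*ˡ c xs f)) (sym (*-distribˡ-+ c (f x) _))

    ∑-*ʳ : ∀ c (xs : List A) f → ∑[ x ∈ xs ] (f x * c) ≡ ∑ xs f * c
    ∑-*ʳ c []       f = refl
    ∑-*ʳ c (x ∷ xs) f = trans (cong (f x * c +_) (∑-*ʳ c xs f)) (sym (*-distribʳ-+ c (f x) _))

    ∑-const : ∀ (xs : List A) c → ∑[ x ∈ xs ] c ≡ length xs * c
    ∑-const []       c = refl
    ∑-const (x ∷ xs) c = cong (c +_) (∑-const xs c)

    ∑-≤-const : ∀ (xs : List A) {f c} → (∀ x → f x ≤ c) → ∑ xs f ≤ length xs * c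
    ∑-≤-const xs {c = c} f≤c = ≤-trans (∑-mono xs f≤c) (≤-reflexive (∑-const xs c))

    ∑-++ : ∀ (xs ys : List A) f → ∑ (xs ++ ys) f ≡ ∑ xs f + ∑ ys f
    ∑-++ []       ys f = refl
    ∑-++ (x ∷ xs) ys f = trans (cong (f x +_) (∑-++ xs ys f)) (sym (+-assoc (f x) _ _))

    ∑-map : ∀ {B : Set} (h : B → A) (xs : List B) f → ∑ (map h xs) f ≡ ∑[ x ∈ xs ] f (h x)
    ∑-map h []       f = refl
    ∑-map h (x ∷ xs) f = cong (f (h x) +_) (∑-map h xs f)

    ∑-concatMap : ∀ {B : Set} (h : B → List A) (xs : List B) f →
      ∑ (concatMap h xs) f ≡ ∑[ x ∈ xs ] ∑ (h x) f
    ∑-concatMap h []       f = refl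
    ∑-concatMap h (x ∷ xs) f =
      trans (∑-++ (h x) _ f) (cong (∑ (h x) f +_) (∑-concatMap h xs f))

  ∑-swap : ∀ {A B : Set} (xs : List A) (ys : List B) (f : A → B → ℕ) →
    ∑[ x ∈ xs ] ∑[ y ∈ ys ] f x y ≡ ∑[ y ∈ ys ] ∑[ x ∈ xs ] f x y
  ∑-swap []       ys f = sym (∑-0 ys)
  ∑-swap (x ∷ xs) ys f =
    trans (cong (∑ ys (f x) +_) (∑-swap xs ys f)) (sym (∑-+ ys (f x) _))

  ^-distribʳ-* : ∀ o m n → (m * n) ^ o ≡ m ^ o * n ^ o
  ^-distribʳ-* zero    m n = refl
  ^-distribʳ-* (suc o) m n rewrite ^-distribʳ-* o m n = lemma m n (m ^ o) (n ^ o)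
    where
    lemma : ∀ a b c d → a * b * (c * d) ≡ a * c * (b * d)
    lemma = solve-∀

  ∑ᵛ : ∀ {B : Set} {h} → (B → ℕ) → Vec B h → ℕ
  ∑ᵛ F []       = 0
  ∑ᵛ F (x ∷ xs) = F x + ∑ᵛ F xs

  -- Indicators and the weighted union bound.

  [_] : Bool → ℕ
  [ false ] = 0
  [ true  ] = 1

  []≤1 : ∀ p → [ p ] ≤ 1
  []≤1 false = z≤n
  []≤1 true  = ≤-refl

  [∧] : ∀ p q → [ p ∧ q ] ≡ [ p ] * [ q ]
  [∧] false q = refl
  [∧] true  q = sym (+-identityʳ [ q ])

  [∨]≤ : ∀ p q → [ p ∨ q ] ≤ [ p ] + [ q ]
  [∨]≤ false q = ≤-refl
  [∨]≤ true  q = s≤s z≤n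

  []-mono : ∀ p q → (p ≡ true → q ≡ true) → [ p ] ≤ [ q ]
  []-mono false q p⇒q = z≤n
  []-mono true  q p⇒q rewrite p⇒q refl = ≤-refl

  []*-mono : ∀ p {m n} → (p ≡ true → m ≤ n) → [ p ] * m ≤ [ p ] * n
  []*-mono false h = z≤n
  []*-mono true  h = *-monoʳ-≤ 1 (h refl)

  []*≤ : ∀ p {m n} → (p ≡ true → m ≤ n) → [ p ] * m ≤ n
  []*≤ false h = z≤n
  []*≤ true  h = ≤-trans (≤-reflexive (+-identityʳ _)) (h refl)

  ≤ᵇ-true : ∀ m n → (m ≤ᵇ n) ≡ true → m ≤ n
  ≤ᵇ-true m n eq = ≤ᵇ⇒≤ m n (subst Bool.T (sym eq) _)

  ≤ᵇ-false : ∀ m n → (m ≤ᵇ n) ≡ false → n < m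
  ≤ᵇ-false m n eq = ≰⇒> λ m≤n → subst Bool.T eq (≤⇒≤ᵇ m≤n)

  <ᵇ-true : ∀ m n → (m <ᵇ n) ≡ true → m < n
  <ᵇ-true m n eq = <ᵇ⇒< m n (subst Bool.T (sym eq) _)

  <ᵇ-false : ∀ m n → (m <ᵇ n) ≡ false → n ≤ m
  <ᵇ-false m n eq = ≮⇒≥ λ m<n → subst Bool.T eq (<⇒<ᵇ m<n)

  ∧-true : ∀ {p q} → p ∧ q ≡ true → p ≡ true × q ≡ true
  ∧-true {true} {true} refl = refl , refl

  ∨-false : ∀ {p q} → p ∨ q ≡ false → p ≡ false × q ≡ false
  ∨-false {false} {false} refl = refl , refl

  not-true : ∀ {p} → not p ≡ true → p ≡ false
  not-true {false} refl = refl

  module _ {A I : Set} where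

    none : List I → (I → A → Bool) → A → Bool
    none []       bad x = true
    none (i ∷ is) bad x = not (bad i x) ∧ none is bad x

    split-none : ∀ is (bad : I → A → Bool) p x →
      [ p ] ≤ [ p ∧ none is bad x ] + ∑[ i ∈ is ] [ bad i x ]
    split-none []       bad false x = z≤n
    split-none []       bad true  x = ≤-refl
    split-none (i ∷ is) bad p x with bad i x
    ... | false = split-none is bad p x
    ... | true  = ≤-trans ([]≤1 p) (≤-trans (s≤s z≤n) (m≤n+m _ [ p ∧ false ]))

    -- The bad weights add up to at most `T / 2K`, half of what `good` is known to carry, so the
    -- survivors still carry `T / 2K`. Each use doubles the constant.
    union-bound : ∀ (xs : List A) (w : A → ℕ) (good : A → Bool) (is : List I)
      (bad : I → A → Bool) T K →
      T ≤ K * ∑[ x ∈ xs ] ([ good x ] * w x) →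
      (∀ i → 2 * K * length is * ∑[ x ∈ xs ] ([ bad i x ] * w x) ≤ T) →
      T ≤ 2 * K * ∑[ x ∈ xs ] ([ good x ∧ none is bad x ] * w x)
    union-bound xs w good is bad T K T≤ few = +-cancelʳ-≤ T T _ (begin
      T + T
        ≡⟨ cong (T +_) (+-identityʳ T) ⟨
      2 * T
        ≤⟨ *-monoʳ-≤ 2 T≤ ⟩
      2 * (K * ∑[ x ∈ xs ] ([ good x ] * w x))
        ≤⟨ *-monoʳ-≤ 2 (*-monoʳ-≤ K (∑-mono xs pointwise)) ⟩
      2 * (K * ∑[ x ∈ xs ] (G x + ∑[ i ∈ is ] ([ bad i x ] * w x)))
        ≡⟨ cong (λ s → 2 * (K * s)) (trans (∑-+ xs G _) (cong (∑ xs G +_) (∑-swap xs is _))) ⟩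
      2 * (K * (∑ xs G + ∑[ i ∈ is ] s i))
        ≡⟨ distrib K (∑ xs G) (∑ is s) ⟩
      2 * K * ∑ xs G + 2 * K * ∑ is s
        ≤⟨ +-monoʳ-≤ (2 * K * ∑ xs G) (total is few) ⟩
      2 * K * ∑ xs G + T ∎)
      where
      open ≤-Reasoning
      G : A → ℕ
      G x = [ good x ∧ none is bad x ] * w x
      s : I → ℕ
      s i = ∑[ x ∈ xs ] ([ bad i x ] * w x)
      pointwise : ∀ x → [ good x ] * w x ≤ G x + ∑[ i ∈ is ] ([ bad i x ] * w x)
      pointwise x = ≤-trans (*-monoˡ-≤ (w x) (split-none is bad (good x) x))
        (≤-reflexive (trans (*-distribʳ-+ (w x) [ good x ∧ none is bad x ] _)
          (cong (G x +_) (sym (∑-*ʳ (w x) is _)))))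
      distrib : ∀ k a b → 2 * (k * (a + b)) ≡ 2 * k * a + 2 * k * b
      distrib = solve-∀
      total : ∀ js → (∀ i → 2 * K * length js * s i ≤ T) → 2 * K * ∑ js s ≤ T
      total [] _ = ≤-trans (≤-reflexive (*-zeroʳ (2 * K))) z≤n
      total js@(_ ∷ _) few′ = *-cancelˡ-≤ (length js) (begin
        length js * (2 * K * ∑ js s)       ≡⟨ swap (length js) (2 * K) (∑ js s) ⟩
        2 * K * length js * ∑ js s         ≡⟨ ∑-*ˡ (2 * K * length js) js s ⟨
        ∑[ i ∈ js ] (2 * K * length js * s i) ≤⟨ ∑-≤-const js few′ ⟩
        length js * T ∎)
        where
        swap : ∀ a b c → a * (b * c) ≡ b * a * c
        swap = solve-∀

  module _ {A : Set} where

    every : ∀ {k} → (A → Bool) → Vec A k → Bool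
    every p []      = true
    every p (x ∷ X) = p x ∧ every p X

    every-lookup : ∀ {k} {p : A → Bool} (X : Vec A k) → every p X ≡ true → ∀ i → p (lookup X i) ≡ true
    every-lookup (x ∷ X) e zero    = proj₁ (∧-true e)
    every-lookup (x ∷ X) e (suc i) = every-lookup X (proj₂ (∧-true e)) i

    every-true : ∀ {k} {p : A → Bool} (X : Vec A k) → (∀ i → p (lookup X i) ≡ true) → every p X ≡ true
    every-true []      h = refl
    every-true (x ∷ X) h rewrite h zero = every-true X (λ i → h (suc i))

    every-mono : ∀ {k} {p q : A → Bool} → (∀ x → p x ≡ true → q x ≡ true) →
      (X : Vec A k) → every p X ≡ true → every q X ≡ true
    every-mono p⊆q X e = every-true X (λ i → p⊆q _ (every-lookup X e i))

    [every]-∷ : ∀ {k} p x (X : Vec A k) → [ every p (x ∷ X) ] ≡ [ p x ] * [ every p X ]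
    [every]-∷ p x X = [∧] (p x) (every p X)

    [every]-insertAt : ∀ {k} p (X : Vec A k) i x →
      [ every p (insertAt X i x) ] ≡ [ every p X ] * [ p x ]
    [every]-insertAt p X zero x = trans ([∧] (p x) _) (*-comm [ p x ] _)
    [every]-insertAt p (y ∷ X) (suc i) x
      rewrite [∧] (p y) (every p (insertAt X i x)) | [∧] (p y) (every p X)
            | [every]-insertAt p X i x = sym (*-assoc [ p y ] _ _)

    every-∧ : ∀ {k} p q (X : Vec A k) → every (λ x → p x ∧ q x) X ≡ every p X ∧ every q X
    every-∧ p q []      = refl
    every-∧ p q (x ∷ X) rewrite every-∧ p q X with p x | q x | every p X
    ... | false | _     | _     = refl
    ... | true  | false | false = refl
    ... | true  | false | true  = refl
    ... | true  | true  | _     = refl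

  -- Splitting tuples along Boolean masks.

  ones zeros : ∀ {b} → Vec Bool b → ℕ
  ones []           = 0
  ones (true ∷ s)   = suc (ones s)
  ones (false ∷ s)  = ones s
  zeros []          = 0
  zeros (true ∷ s)  = zeros s
  zeros (false ∷ s) = suc (zeros s)

  module _ {A : Set} where

    -- Masks encode every partition in the proof: the vertices of the pattern into A and B, A into
    -- the vertices complete to B and the others, and Y into neighbours and non-neighbours of a
    -- given vertex of A.
    on : ∀ {b} (s : Vec Bool b) → Vec A b → Vec A (ones s)
    on []          []      = []
    on (true ∷ s)  (y ∷ Y) = y ∷ on s Y
    on (false ∷ s) (y ∷ Y) = on s Y

    off : ∀ {b} (s : Vec Bool b) → Vec A b → Vec A (zeros s)
    off []          []      = []
    off (true ∷ s)  (y ∷ Y) = off s Y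
    off (false ∷ s) (y ∷ Y) = y ∷ off s Y

    every-on-off : ∀ {b} (s : Vec Bool b) p (Y : Vec A b) →
      [ every p Y ] ≡ [ every p (on s Y) ] * [ every p (off s Y) ]
    every-on-off []          p []      = refl
    every-on-off (true ∷ s)  p (y ∷ Y)
      rewrite [∧] (p y) (every p Y) | [∧] (p y) (every p (on s Y)) | every-on-off s p Y
      = sym (*-assoc [ p y ] _ _)
    every-on-off (false ∷ s) p (y ∷ Y)
      rewrite [∧] (p y) (every p Y) | [∧] (p y) (every p (off s Y)) | every-on-off s p Y
      = lemma [ p y ] [ every p (on s Y) ] [ every p (off s Y) ]
      where
      lemma : ∀ a b c → a * (b * c) ≡ b * (a * c)
      lemma = solve-∀

  ones+zeros : ∀ {b} (s : Vec Bool b) → ones s + zeros s ≡ b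
  ones+zeros []          = refl
  ones+zeros (true ∷ s)  = cong suc (ones+zeros s)
  ones+zeros (false ∷ s) = trans (+-suc _ _) (cong suc (ones+zeros s))

  -- Sums over all tuples of vertices.

  module Tuples {A : Set} (V : List A) where

    card : (A → Bool) → ℕ
    card W = ∑[ x ∈ V ] [ W x ]

    tuples : ∀ k → List (Vec A k)
    tuples zero    = [] ∷ []
    tuples (suc k) = concatMap (λ x → map (x ∷_) (tuples k)) V

    ∑-tuples : ∀ {k} (f : Vec A (suc k) → ℕ) →
      ∑ (tuples (suc k)) f ≡ ∑[ x ∈ V ] ∑[ X ∈ tuples k ] f (x ∷ X)
    ∑-tuples {k} f = trans (∑-concatMap _ V f) (∑-cong V λ x → ∑-map (x ∷_) (tuples k) f)

    -- Any one coordinate may be summed innermost with the others held fixed; this is how "fix X -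
    -- xᵢ" is carried out.
    ∑-insertAt : ∀ {k} i (f : Vec A (suc k) → ℕ) →
      ∑ (tuples (suc k)) f ≡ ∑[ X ∈ tuples k ] ∑[ x ∈ V ] f (insertAt X i x)
    ∑-insertAt {k} zero f = trans (∑-tuples f) (∑-swap V (tuples k) _)
    ∑-insertAt {suc k} (suc i) f = trans (∑-tuples f)
      (trans (∑-cong V λ y → ∑-insertAt i (λ X → f (y ∷ X)))
             (sym (∑-tuples (λ X → ∑[ x ∈ V ] f (insertAt X (suc i) x)))))

    -- A tuple and its two parts determine each other, so marked and unmarked coordinates can be
    -- summed independently.
    ∑-on-off : ∀ {b} (s : Vec Bool b) (f : Vec A (ones s) → Vec A (zeros s) → ℕ) →
      ∑[ Y ∈ tuples b ] f (on s Y) (off s Y) ≡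
      ∑[ S ∈ tuples (ones s) ] ∑[ R ∈ tuples (zeros s) ] f S R
    ∑-on-off []         f = sym (+-identityʳ _)
    ∑-on-off (true ∷ s) f = trans (∑-tuples _)
      (trans (∑-cong V λ y → ∑-on-off s (λ S → f (y ∷ S))) (sym (∑-tuples _)))
    ∑-on-off (false ∷ s) f = trans (∑-tuples _)
      (trans (∑-cong V λ y → ∑-on-off s (λ S R → f S (y ∷ R)))
      (trans (∑-swap V (tuples (ones s)) _)
             (∑-cong (tuples (ones s)) λ S → sym (∑-tuples (f S)))))

    ∑-every : ∀ p k → ∑[ X ∈ tuples k ] [ every p X ] ≡ card p ^ k
    ∑-every p zero    = refl
    ∑-every p (suc k) = trans (∑-tuples _) (trans (∑-cong V λ x →
        trans (∑-cong (tuples k) ([every]-∷ p x))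
              (trans (∑-*ˡ [ p x ] (tuples k) _) (cong ([ p x ] *_) (∑-every p k))))
      (∑-*ʳ (card p ^ k) V _))

    ∑-tuples-const : ∀ k c → ∑[ X ∈ tuples k ] c ≡ length V ^ k * c
    ∑-tuples-const zero    c = refl
    ∑-tuples-const (suc k) c = trans (∑-tuples _)
      (trans (∑-cong V λ x → ∑-tuples-const k c)
      (trans (∑-const V _) (sym (*-assoc (length V) _ c))))

  -- Removing the neighbourhoods of chosen vertices from a set.

  -- r stands for adjacency or equality in Γ, so that tuples avoiding r are injective.
  module Cutting {A : Set} (V : List A) (r : A → A → Bool) (L τ : ℕ) where
    open Tuples V public

    cut : A → (A → Bool) → A → Bool
    cut x W a = W a ∧ not (r x a)

    cuts : ∀ {k} → Vec A k → (A → Bool) → A → Bool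
    cuts []      W = W
    cuts (x ∷ X) W = cuts X (cut x W)

    cuts-⊆ : ∀ {k} (X : Vec A k) W a → cuts X W a ≡ true → W a ≡ true
    cuts-⊆ []      W a e = e
    cuts-⊆ (x ∷ X) W a e = proj₁ (∧-true (cuts-⊆ X (cut x W) a e))

    cuts-lookup : ∀ {k} (X : Vec A k) W a → cuts X W a ≡ true → ∀ i → r (lookup X i) a ≡ false
    cuts-lookup (x ∷ X) W a e zero    = not-true (proj₂ (∧-true {W a} (cuts-⊆ X (cut x W) a e)))
    cuts-lookup (x ∷ X) W a e (suc i) = cuts-lookup X (cut x W) a e i

    -- The first conjunct makes the bound card (bad W) ≤ τ hold for every W, however small.
    bad : (A → Bool) → A → Bool
    bad W x = (τ ≤ᵇ card W) ∧ (L * card (cut x W) <ᵇ card W)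

    good⇒large-cut : ∀ W x → τ ≤ card W → bad W x ≡ false → card W ≤ L * card (cut x W)
    good⇒large-cut W x τ≤ ¬bad with τ ≤ᵇ card W in eq
    ... | true  = <ᵇ-false (L * card (cut x W)) (card W) ¬bad
    ... | false = contradiction τ≤ (<⇒≱ (≤ᵇ-false τ (card W) eq))

    -- Coordinate `i` is tested against `W` as cut by the earlier coordinates only. With the others
    -- fixed, the condition on it is therefore `bad` for a single fixed set, which is what
    -- `few-badAt` exploits.
    badAt : ∀ {k} → Fin k → Vec A k → (A → Bool) → Bool
    badAt zero    (x ∷ X) W = bad W x
    badAt (suc i) (x ∷ X) W = badAt i X (cut x W)

    badSomewhere : ∀ {k} → Vec A k → (A → Bool) → Bool
    badSomewhere []      W = false
    badSomewhere (x ∷ X) W = bad W x ∨ badSomewhere X (cut x W)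

    ¬badAt⇒¬badSomewhere : ∀ {k} (X : Vec A k) W →
      (∀ i → badAt i X W ≡ false) → badSomewhere X W ≡ false
    ¬badAt⇒¬badSomewhere []      W h = refl
    ¬badAt⇒¬badSomewhere (x ∷ X) W h rewrite h zero =
      ¬badAt⇒¬badSomewhere X (cut x W) (λ i → h (suc i))

    module _ .{{_ : NonZero L}} where

      -- The factor `L ^ k` in the size hypothesis leaves at least `τ` vertices before every cut.
      -- The size conjunct of `bad` thus always holds, and not being `bad` really means that at most
      -- a factor `L` is lost.
      ¬bad⇒large-cuts : ∀ {k} (X : Vec A k) W → L ^ k * τ ≤ card W →
        badSomewhere X W ≡ false → card W ≤ L ^ k * card (cuts X W)
      ¬bad⇒large-cuts [] W _ _ = ≤-reflexive (sym (+-identityʳ _))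
      ¬bad⇒large-cuts {suc k} (x ∷ X) W big ¬bad with ∨-false {bad W x} ¬bad
      ... | ¬b , ¬bs = begin
        card W                         ≤⟨ step ⟩
        L * card (cut x W)             ≤⟨ *-monoʳ-≤ L (¬bad⇒large-cuts X (cut x W) big′ ¬bs) ⟩
        L * (L ^ k * card (cuts X (cut x W))) ≡⟨ *-assoc L (L ^ k) _ ⟨
        L * L ^ k * card (cuts X (cut x W)) ∎
        where
        open ≤-Reasoning
        step : card W ≤ L * card (cut x W)
        step = good⇒large-cut W x (≤-trans (m≤n*m τ (L ^ suc k) {{m^n≢0 L (suc k)}}) big) ¬b
        big′ : L ^ k * τ ≤ card (cut x W)
        big′ = *-cancelˡ-≤ L (≤-trans (≤-reflexive (sym (*-assoc L (L ^ k) τ))) (≤-trans big step))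

    module Sparse (few-bad : ∀ W → card (bad W) ≤ τ) where

      few-badAt : ∀ {k} i (X : Vec A k) W → ∑[ x ∈ V ] [ badAt i (insertAt X i x) W ] ≤ τ
      few-badAt zero    X       W = few-bad W
      few-badAt (suc i) (y ∷ X) W = few-badAt i X (cut y W)

      -- Union bound over the position of a bad vertex: given the earlier ones it has at most `τ`
      -- candidates, and the other positions range over `P`. The factor `card P` on the left avoids
      -- the exponent `k - 1`.
      few-badSomewhere : ∀ (P : A → Bool) k W →
        card P * ∑[ Z ∈ tuples k ] ([ every P Z ] * [ badSomewhere Z W ]) ≤ k * τ * card P ^ k
      few-badSomewhere P zero W = ≤-trans (≤-reflexive (*-zeroʳ (card P))) z≤n
      few-badSomewhere P (suc k) W = begin
        f * ∑[ Z ∈ tuples (suc k) ] ([ every P Z ] * [ badSomewhere Z W ])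
          ≡⟨ cong (f *_) (∑-tuples _) ⟩
        f * ∑[ z ∈ V ] ∑[ Z ∈ tuples k ] ([ every P (z ∷ Z) ] * [ bad W z ∨ badSomewhere Z (cut z W) ])
          ≤⟨ *-monoʳ-≤ f (∑-mono V λ z → ≤-trans (∑-mono (tuples k) (pointwise z))
               (≤-reflexive (trans (∑-+ (tuples k) _ _)
                 (cong₂ _+_ (trans (∑-*ˡ [ bad W z ] (tuples k) _) (cong ([ bad W z ] *_) (∑-every P k)))
                            (∑-*ˡ [ P z ] (tuples k) _))))) ⟩
        f * ∑[ z ∈ V ] ([ bad W z ] * f ^ k + [ P z ] * rest z)
          ≡⟨ cong (f *_) (trans (∑-+ V _ _) (cong (_+ ∑[ z ∈ V ] ([ P z ] * rest z)) (∑-*ʳ (f ^ k) V _))) ⟩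
        f * (card (bad W) * f ^ k + ∑[ z ∈ V ] ([ P z ] * rest z))
          ≡⟨ *-distribˡ-+ f (card (bad W) * f ^ k) _ ⟩
        f * (card (bad W) * f ^ k) + f * ∑[ z ∈ V ] ([ P z ] * rest z)
          ≤⟨ +-mono-≤ (*-monoʳ-≤ f (*-monoˡ-≤ (f ^ k) (few-bad W))) tail ⟩
        f * (τ * f ^ k) + f * (k * τ * f ^ k)
          ≡⟨ assemble f τ (f ^ k) k ⟩
        suc k * τ * f ^ suc k ∎
        where
        open ≤-Reasoning
        f = card P
        rest : A → ℕ
        rest z = ∑[ Z ∈ tuples k ] ([ every P Z ] * [ badSomewhere Z (cut z W) ])
        assemble : ∀ f t p k → f * (t * p) + f * (k * t * p) ≡ (1 + k) * t * (f * p)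
        assemble = solve-∀
        tail : f * ∑[ z ∈ V ] ([ P z ] * rest z) ≤ f * (k * τ * f ^ k)
        tail = begin
          f * ∑[ z ∈ V ] ([ P z ] * rest z)     ≡⟨ ∑-*ˡ f V _ ⟨
          ∑[ z ∈ V ] (f * ([ P z ] * rest z))   ≤⟨ ∑-mono V (λ z → begin
              f * ([ P z ] * rest z)   ≡⟨ perm f [ P z ] (rest z) ⟩
              [ P z ] * (f * rest z)   ≤⟨ *-monoʳ-≤ [ P z ] (few-badSomewhere P k (cut z W)) ⟩
              [ P z ] * (k * τ * f ^ k) ∎) ⟩
          ∑[ z ∈ V ] ([ P z ] * (k * τ * f ^ k)) ≡⟨ ∑-*ʳ _ V _ ⟩
          f * (k * τ * f ^ k) ∎
          where
          perm : ∀ a b c → a * (b * c) ≡ b * (a * c)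
          perm = solve-∀
        pointwise : ∀ z Z → [ every P (z ∷ Z) ] * [ bad W z ∨ badSomewhere Z (cut z W) ] ≤
          [ bad W z ] * [ every P Z ] + [ P z ] * ([ every P Z ] * [ badSomewhere Z (cut z W) ])
        pointwise z Z with P z | bad W z
        ... | false | _     = z≤n
        ... | true  | true  = ≤-trans (≤-reflexive (*-comm [ every P Z ] 1)) (m≤m+n _ _)
        ... | true  | false = ≤-reflexive (sym (+-identityʳ _))

  -- Independent transversals of large sets.

  -- Placing the first of `suc m` vertices costs a factor 2 for the bad choices and a factor `L` for
  -- each of the `m` sets still to be met.
  transK : ℕ → ℕ → ℕ
  transK L zero    = 1
  transK L (suc m) = 2 * (L ^ m * transK L m)

  -- Here `2 * m` makes up to `m * τ` bad choices at most half of the first set, `L * transM L m`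
  -- keeps the later sets large after one cut, and `1` provides the size `τ` at which `bad` becomes
  -- effective.
  transM : ℕ → ℕ → ℕ
  transM L zero    = 0
  transM L (suc m) = 1 + 2 * m + L * transM L m

  module Transversals {A : Set} (V : List A) (r : A → A → Bool) (L τ : ℕ) .{{_ : NonZero L}} where
    open Cutting V r L τ public

    -- Each chosen vertex cuts the sets still to come, so independence is part of membership.
    transversal : ∀ {m} → Vec (A → Bool) m → Vec A m → Bool
    transversal []       []      = true
    transversal (W ∷ Ws) (x ∷ X) = W x ∧ transversal (Vec.map (cut x) Ws) X

    transversal-∈ : ∀ {m} (Ws : Vec (A → Bool) m) X → transversal Ws X ≡ true →
      ∀ i → lookup Ws i (lookup X i) ≡ true
    transversal-∈ (W ∷ Ws) (x ∷ X) e zero = proj₁ (∧-true e)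
    transversal-∈ (W ∷ Ws) (x ∷ X) e (suc i)
      with h ← transversal-∈ (Vec.map (cut x) Ws) X (proj₂ (∧-true {W x} e)) i
      rewrite lookup-map i (cut x) Ws = proj₁ (∧-true h)

    independent : ∀ {k} → Vec A k → Bool
    independent []      = true
    independent (x ∷ X) = every (λ y → not (r x y)) X ∧ independent X

    transversal⇒independent : ∀ {m} (Ws : Vec (A → Bool) m) X →
      transversal Ws X ≡ true → independent X ≡ true
    transversal⇒independent []       []      e = refl
    transversal⇒independent (W ∷ Ws) (x ∷ X) e with t ← proj₂ (∧-true {W x} e) =
      cong₂ _∧_ (every-true X avoids) (transversal⇒independent (Vec.map (cut x) Ws) X t)
      where
      avoids : ∀ i → not (r x (lookup X i)) ≡ true
      avoids i with h ← transversal-∈ (Vec.map (cut x) Ws) X (proj₂ (∧-true {W x} e)) i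
        rewrite lookup-map i (cut x) Ws = proj₂ (∧-true {lookup Ws i (lookup X i)} h)

    independent-lookup : (∀ x y → r x y ≡ r y x) → ∀ {k} (X : Vec A k) → independent X ≡ true →
      ∀ i j → i ≢ j → r (lookup X i) (lookup X j) ≡ false
    independent-lookup r-sym (x ∷ X) e zero zero i≢j = contradiction refl i≢j
    independent-lookup r-sym (x ∷ X) e zero (suc j) i≢j =
      not-true (every-lookup X (proj₁ (∧-true e)) j)
    independent-lookup r-sym (x ∷ X) e (suc i) zero i≢j =
      trans (r-sym _ _) (not-true (every-lookup X (proj₁ (∧-true e)) i))
    independent-lookup r-sym (x ∷ X) e (suc i) (suc j) i≢j =
      independent-lookup r-sym X (proj₂ (∧-true {every (λ y → not (r x y)) X} e)) i j
        (λ { refl → i≢j refl })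

    ∏card : ∀ {m} → Vec (A → Bool) m → ℕ
    ∏card []       = 1
    ∏card (W ∷ Ws) = card W * ∏card Ws

    #transversals : ∀ {m} → Vec (A → Bool) m → ℕ
    #transversals {m} Ws = ∑[ X ∈ tuples m ] [ transversal Ws X ]

    someBad : ∀ {m} → Vec (A → Bool) m → A → Bool
    someBad []       x = false
    someBad (W ∷ Ws) x = bad W x ∨ someBad Ws x

    ¬someBad : ∀ {m} (Ws : Vec (A → Bool) m) x → someBad Ws x ≡ false →
      ∀ i → bad (lookup Ws i) x ≡ false
    ¬someBad (W ∷ Ws) x e zero    = proj₁ (∨-false e)
    ¬someBad (W ∷ Ws) x e (suc i) = ¬someBad Ws x (proj₂ (∨-false {bad W x} e)) i

    ∏card-cut : ∀ {m} (Ws : Vec (A → Bool) m) x →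
      (∀ i → card (lookup Ws i) ≤ L * card (cut x (lookup Ws i))) →
      ∏card Ws ≤ L ^ m * ∏card (Vec.map (cut x) Ws)
    ∏card-cut []       x h = ≤-refl
    ∏card-cut {suc m} (W ∷ Ws) x h = ≤-trans (*-mono-≤ (h zero) (∏card-cut Ws x λ i → h (suc i)))
      (≤-reflexive (perm L (card (cut x W)) (L ^ m) _))
      where
      perm : ∀ a b c d → a * b * (c * d) ≡ a * c * (b * d)
      perm = solve-∀

    ∏card-power : ∀ m W → ∏card (Vec.replicate m W) ≡ card W ^ m
    ∏card-power zero    W = refl
    ∏card-power (suc m) W = cong (card W *_) (∏card-power m W)

    module Many (few-bad : ∀ W → card (bad W) ≤ τ) where
      open Sparse few-bad public

      few-someBad : ∀ {m} (Ws : Vec (A → Bool) m) → card (someBad Ws) ≤ m * τ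
      few-someBad []       = ≤-reflexive (∑-0 V)
      few-someBad (W ∷ Ws) =
        ≤-trans (∑-mono V λ x → [∨]≤ (bad W x) (someBad Ws x))
          (≤-trans (≤-reflexive (∑-+ V _ _)) (+-mono-≤ (few-bad W) (few-someBad Ws)))

      -- The first vertex is chosen so as to be bad for none of the later sets. This excludes at
      -- most half of the first set, and each later set keeps a fraction `1 / L`, enough for the
      -- induction.
      many-transversals : ∀ {m} (Ws : Vec (A → Bool) m) →
        (∀ i → transM L m * τ ≤ card (lookup Ws i)) → ∏card Ws ≤ transK L m * #transversals Ws
      many-transversals []       large = ≤-refl
      -- Twice the contribution of the bad choices is at most `w * Π`, so it cancels against the
      -- second copy of `w * Π`.
      many-transversals {suc m} (W ∷ Ws) large = +-cancelˡ-≤ (w * Π) _ _ (begin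
        w * Π + w * Π
          ≡⟨ double (w * Π) ⟩
        2 * (w * Π)
          ≤⟨ *-monoʳ-≤ 2 count ⟩
        2 * (m * τ * Π + K * #transversals (W ∷ Ws))
          ≡⟨ expand m τ Π (L ^ m) (transK L m) (#transversals (W ∷ Ws)) ⟩
        2 * m * τ * Π + 2 * K * #transversals (W ∷ Ws)
          ≤⟨ +-monoˡ-≤ _ (*-monoˡ-≤ Π (≤-trans (*-monoˡ-≤ τ 2m≤M) (large zero))) ⟩
        w * Π + transK L (suc m) * #transversals (W ∷ Ws) ∎)
        where
        open ≤-Reasoning
        w = card W
        Π = ∏card Ws
        K = L ^ m * transK L m
        double : ∀ a → a + a ≡ 2 * a
        double = solve-∀
        expand : ∀ m t p l k s → 2 * (m * t * p + l * k * s) ≡ 2 * m * t * p + 2 * (l * k) * s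
        expand = solve-∀
        2m≤M : 2 * m ≤ transM L (suc m)
        2m≤M = ≤-trans (m≤n+m (2 * m) 1) (m≤m+n (1 + 2 * m) _)
        good-choice : ∀ x → someBad Ws x ≡ false → Π ≤ K * #transversals (Vec.map (cut x) Ws)
        good-choice x good = begin
          Π ≤⟨ ∏card-cut Ws x cut-large ⟩
          L ^ m * ∏card (Vec.map (cut x) Ws)
            ≤⟨ *-monoʳ-≤ (L ^ m) (many-transversals (Vec.map (cut x) Ws) large′) ⟩
          L ^ m * (transK L m * #transversals (Vec.map (cut x) Ws)) ≡⟨ *-assoc (L ^ m) _ _ ⟨
          K * #transversals (Vec.map (cut x) Ws) ∎
          where
          cut-large : ∀ i → card (lookup Ws i) ≤ L * card (cut x (lookup Ws i))
          cut-large i = good⇒large-cut (lookup Ws i) x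
            (≤-trans (m≤n*m τ (transM L (suc m))) (large (suc i))) (¬someBad Ws x good i)
          large′ : ∀ i → transM L m * τ ≤ card (lookup (Vec.map (cut x) Ws) i)
          large′ i rewrite lookup-map i (cut x) Ws = *-cancelˡ-≤ L (begin
            L * (transM L m * τ)                        ≡⟨ *-assoc L (transM L m) τ ⟨
            L * transM L m * τ                          ≤⟨ *-monoˡ-≤ τ (m≤n+m (L * transM L m) (1 + 2 * m)) ⟩
            transM L (suc m) * τ                        ≤⟨ large (suc i) ⟩
            card (lookup Ws i)                          ≤⟨ cut-large i ⟩
            L * card (cut x (lookup Ws i)) ∎)
        pointwise : ∀ x → [ W x ] * Π ≤
          [ someBad Ws x ] * Π + K * ([ W x ] * #transversals (Vec.map (cut x) Ws))
        pointwise x with W x | someBad Ws x in good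
        ... | false | _     = z≤n
        ... | true  | true  = m≤m+n (1 * Π) _
        ... | true  | false = ≤-trans (≤-reflexive (+-identityʳ Π)) (≤-trans (good-choice x good)
                (≤-reflexive (cong (K *_) (sym (+-identityʳ _)))))
        #-step : #transversals (W ∷ Ws) ≡ ∑[ x ∈ V ] ([ W x ] * #transversals (Vec.map (cut x) Ws))
        #-step = trans (∑-tuples _) (∑-cong V λ x →
          trans (∑-cong (tuples m) λ X → [∧] (W x) _) (∑-*ˡ [ W x ] (tuples m) _))
        count : w * Π ≤ m * τ * Π + K * #transversals (W ∷ Ws)
        count = begin
          w * Π ≡⟨ ∑-*ʳ Π V _ ⟨
          ∑[ x ∈ V ] ([ W x ] * Π) ≤⟨ ∑-mono V pointwise ⟩
          ∑[ x ∈ V ] ([ someBad Ws x ] * Π + K * ([ W x ] * #transversals (Vec.map (cut x) Ws)))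
            ≡⟨ trans (∑-+ V _ _) (cong₂ _+_ (∑-*ʳ Π V _) (trans (∑-*ˡ K V _) (cong (K *_) (sym #-step)))) ⟩
          card (someBad Ws) * Π + K * #transversals (W ∷ Ws)
            ≤⟨ +-monoˡ-≤ _ (*-monoˡ-≤ Π (few-someBad Ws)) ⟩
          m * τ * Π + K * #transversals (W ∷ Ws) ∎

      -- These are the transversals of `j` copies of `W`.
      independent-tuples : ∀ j W → transM L j * τ ≤ card W →
        card W ^ j ≤ transK L j * ∑[ X ∈ tuples j ] ([ independent X ] * [ every W X ])
      independent-tuples j W large = begin
        card W ^ j                    ≡⟨ ∏card-power j W ⟨
        ∏card (Vec.replicate j W)     ≤⟨ many-transversals (Vec.replicate j W) (λ i →
          subst (λ U → transM L j * τ ≤ card U) (sym (lookup-replicate i W)) large) ⟩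
        transK L j * #transversals (Vec.replicate j W)
          ≤⟨ *-monoʳ-≤ (transK L j) (∑-mono (tuples j) λ X →
               ≤-trans ([]-mono _ _ (both X)) (≤-reflexive ([∧] (independent X) (every W X)))) ⟩
        transK L j * ∑[ X ∈ tuples j ] ([ independent X ] * [ every W X ]) ∎
        where
        open ≤-Reasoning
        both : ∀ X → transversal (Vec.replicate j W) X ≡ true → independent X ∧ every W X ≡ true
        both X e = cong₂ _∧_ (transversal⇒independent (Vec.replicate j W) X e)
          (every-true X λ i → subst (λ U → U (lookup X i) ≡ true) (lookup-replicate i W)
            (transversal-∈ (Vec.replicate j W) X e i))

  -- Tuples weighted by their common neighbourhoods.

  -- g x v is an edge with x in place of a vertex of A and v in place of a vertex of B.  The density
  -- is q = D / N, and inequalities in q are stated with denominators cleared.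
  module Weights {A : Set} (V : List A) (g : A → A → Bool) where
    open Tuples V

    n N D : ℕ
    n = length V
    N = n * n
    D = ∑[ v ∈ V ] ∑[ x ∈ V ] [ g x v ]

    deg : A → ℕ
    deg v = ∑[ x ∈ V ] [ g x v ]

    highDegree : A → Bool
    highDegree v = D ≤ᵇ 2 * n * deg v

    joined : ∀ {k} → Vec A k → A → Bool
    joined X v = every (λ x → g x v) X

    nbhd : ∀ {k} → Vec A k → A → Bool
    nbhd X v = highDegree v ∧ joined X v

    f : ∀ {k} → Vec A k → ℕ
    f X = card (nbhd X)

    T : ℕ → ℕ
    T k = ∑[ X ∈ tuples k ] f X

    [nbhd]-insertAt : ∀ {k} (X : Vec A k) i x v →
      [ nbhd (insertAt X i x) v ] ≡ [ nbhd X v ] * [ g x v ]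
    [nbhd]-insertAt X i x v rewrite [∧] (highDegree v) (joined (insertAt X i x) v)
      | [∧] (highDegree v) (joined X v) | [every]-insertAt (λ x → g x v) X i x
      = sym (*-assoc [ highDegree v ] _ _)

    f-insertAt-≤ : ∀ {k} (X : Vec A k) i x → f (insertAt X i x) ≤ f X
    f-insertAt-≤ X i x = ∑-mono V λ v → ≤-trans (≤-reflexive ([nbhd]-insertAt X i x v))
      (≤-trans (*-monoʳ-≤ [ nbhd X v ] ([]≤1 (g x v))) (≤-reflexive (*-identityʳ _)))

    every-nbhd-insertAt : ∀ {k ℓ} (X : Vec A k) i x (S : Vec A ℓ) →
      [ every (nbhd (insertAt X i x)) S ] ≤ [ every (nbhd X) S ] * [ every (g x) S ]
    every-nbhd-insertAt X i x S =
      ≤-trans ([]-mono _ _ (every-mono both S))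
        (≤-reflexive (trans (cong [_] (every-∧ (nbhd X) (g x) S)) ([∧] (every (nbhd X) S) _)))
      where
      both : ∀ v → nbhd (insertAt X i x) v ≡ true → nbhd X v ∧ g x v ≡ true
      both v e with nbhd X v | g x v | [nbhd]-insertAt X i x v
      ... | true  | true  | _  = refl
      ... | true  | false | eq rewrite e = contradiction eq λ ()
      ... | false | _     | eq rewrite e = contradiction eq λ ()

    ∑-f-insertAt : ∀ {k} (X : Vec A k) i → ∑[ x ∈ V ] f (insertAt X i x) ≡ ∑[ v ∈ V ] ([ nbhd X v ] * deg v)
    ∑-f-insertAt X i = trans (∑-swap V V _) (∑-cong V λ v →
      trans (∑-cong V λ x → [nbhd]-insertAt X i x v) (∑-*ˡ [ nbhd X v ] V _))

    -- Double counting of pairs of a vertex `v` in `nbhd X` and a neighbour `x` of it: every such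
    -- `v` has degree at least qn/2. This is why low degrees are excluded from `nbhd`.
    extend : ∀ {k} (X : Vec A k) i → D * f X ≤ 2 * n * ∑[ x ∈ V ] f (insertAt X i x)
    extend X i = begin
      D * f X                                         ≡⟨ ∑-*ˡ D V _ ⟨
      ∑[ v ∈ V ] (D * [ nbhd X v ])                   ≤⟨ ∑-mono V pointwise ⟩
      ∑[ v ∈ V ] (2 * n * ([ nbhd X v ] * deg v))     ≡⟨ ∑-*ˡ (2 * n) V _ ⟩
      2 * n * ∑[ v ∈ V ] ([ nbhd X v ] * deg v)       ≡⟨ cong (2 * n *_) (∑-f-insertAt X i) ⟨
      2 * n * ∑[ x ∈ V ] f (insertAt X i x) ∎
      where
      open ≤-Reasoning
      pointwise : ∀ v → D * [ nbhd X v ] ≤ 2 * n * ([ nbhd X v ] * deg v)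
      pointwise v with highDegree v in high | joined X v
      ... | false | _     = ≤-trans (≤-reflexive (*-zeroʳ D)) z≤n
      ... | true  | false = ≤-trans (≤-reflexive (*-zeroʳ D)) z≤n
      ... | true  | true  = ≤-trans (≤-reflexive (*-identityʳ D))
        (≤-trans (≤ᵇ-true D _ high) (≤-reflexive (cong (2 * n *_) (sym (+-identityʳ _)))))

    T-insertAt : ∀ {k} i → T (suc k) ≡ ∑[ X ∈ tuples k ] ∑[ x ∈ V ] f (insertAt X i x)
    T-insertAt i = ∑-insertAt i f

    T-step : ∀ k → D * T k ≤ 2 * n * T (suc k)
    T-step k = begin
      D * T k                          ≡⟨ ∑-*ˡ D (tuples k) f ⟨
      ∑[ X ∈ tuples k ] (D * f X)      ≤⟨ ∑-mono (tuples k) (λ X → extend X zero) ⟩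
      ∑[ X ∈ tuples k ] (2 * n * ∑[ x ∈ V ] f (insertAt X zero x)) ≡⟨ ∑-*ˡ (2 * n) (tuples k) _ ⟩
      2 * n * ∑[ X ∈ tuples k ] ∑[ x ∈ V ] f (insertAt X zero x) ≡⟨ cong (2 * n *_) (T-insertAt zero) ⟨
      2 * n * T (suc k) ∎
      where open ≤-Reasoning

    module _ .{{_ : NonZero (length V)}} where

      -- The `n` or fewer vertices outside `highDegree` have degree below `D / 2n` each, so they
      -- account for at most half of `D`.
      T-one : D ≤ 2 * T 1
      T-one = *-cancelˡ-≤ n (+-cancelʳ-≤ (n * D) _ _ (begin
        n * D + n * D                                       ≡⟨ double n D ⟩
        2 * n * D                                           ≡⟨ ∑-*ˡ (2 * n) V _ ⟨
        ∑[ v ∈ V ] (2 * n * deg v)                          ≤⟨ ∑-mono V pointwise ⟩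
        ∑[ v ∈ V ] (2 * n * ([ nbhd [] v ] * deg v) + D)    ≡⟨ ∑-+ V _ _ ⟩
        ∑[ v ∈ V ] (2 * n * ([ nbhd [] v ] * deg v)) + ∑[ v ∈ V ] D
          ≡⟨ cong₂ _+_ (∑-*ˡ (2 * n) V _) (∑-const V D) ⟩
        2 * n * ∑[ v ∈ V ] ([ nbhd [] v ] * deg v) + n * D  ≡⟨ cong (λ s → 2 * n * s + n * D) T1≡ ⟨
        2 * n * T 1 + n * D                                 ≡⟨ cong (_+ n * D) (assoc n (T 1)) ⟩
        n * (2 * T 1) + n * D ∎))
        where
        open ≤-Reasoning
        double : ∀ a b → a * b + a * b ≡ 2 * a * b
        double = solve-∀
        assoc : ∀ a b → 2 * a * b ≡ a * (2 * b)
        assoc = solve-∀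
        T1≡ : T 1 ≡ ∑[ v ∈ V ] ([ nbhd [] v ] * deg v)
        T1≡ = trans (T-insertAt zero) (trans (+-identityʳ _) (∑-f-insertAt [] zero))
        pointwise : ∀ v → 2 * n * deg v ≤ 2 * n * ([ nbhd [] v ] * deg v) + D
        pointwise v with highDegree v in high
        ... | true  = ≤-trans (≤-reflexive (cong (2 * n *_) (sym (+-identityʳ _)))) (m≤m+n _ D)
        ... | false = ≤-trans (<⇒≤ (≤ᵇ-false D _ high)) (m≤n+m D _)

      -- Read with q: a tuple of length `suc k` has average weight at least (q/2)ᵏ⁺¹n. The induction
      -- starts at length one, because `T 0` is the number of vertices of high degree, which may be
      -- far below `n`.
      T-lower : ∀ k → D ^ suc k ≤ 2 ^ suc k * (n ^ k * T (suc k))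
      T-lower zero = begin
        D * 1                ≡⟨ *-identityʳ D ⟩
        D                    ≤⟨ T-one ⟩
        2 * T 1              ≡⟨ cong (2 *_) (+-identityʳ (T 1)) ⟨
        2 * (1 * T 1) ∎
        where open ≤-Reasoning
      T-lower (suc k) = begin
        D * D ^ suc k                              ≤⟨ *-monoʳ-≤ D (T-lower k) ⟩
        D * (2 ^ suc k * (n ^ k * T (suc k)))      ≡⟨ perm₁ D (2 ^ suc k) (n ^ k) (T (suc k)) ⟩
        2 ^ suc k * (n ^ k * (D * T (suc k)))      ≤⟨ *-monoʳ-≤ (2 ^ suc k) (*-monoʳ-≤ (n ^ k) (T-step (suc k))) ⟩
        2 ^ suc k * (n ^ k * (2 * n * T (suc (suc k)))) ≡⟨ perm₂ (2 ^ suc k) (n ^ k) n (T (suc (suc k))) ⟩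
        2 ^ suc (suc k) * (n ^ suc k * T (suc (suc k))) ∎
        where
        open ≤-Reasoning
        perm₁ : ∀ a b c d → a * (b * (c * d)) ≡ b * (c * (a * d))
        perm₁ = solve-∀
        perm₂ : ∀ b c n t → b * (c * (2 * n * t)) ≡ 2 * b * (n * c * t)
        perm₂ = solve-∀

      -- That is, f(X) < q f(X - xᵢ) / c.
      smallStep : ∀ {k} → ℕ → Fin (suc k) → Vec A (suc k) → Bool
      smallStep c i X = c * (N * f X) <ᵇ D * f (removeAt X i)

      private instance
        N≢0 : NonZero N
        N≢0 = m*n≢0 n n

      -- Charge each such X the amount q f(X - xᵢ) / c. In all this is q n `T k` / c, whereas
      -- `T (suc k)` is at least q n `T k` / 2.
      few-smallStep : ∀ {k} c (i : Fin (suc k)) →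
        c * ∑[ X ∈ tuples (suc k) ] ([ smallStep c i X ] * f X) ≤ 2 * T (suc k)
      few-smallStep {k} c i = *-cancelˡ-≤ N (begin
        N * (c * ∑[ X ∈ tuples (suc k) ] ([ smallStep c i X ] * f X))
          ≡⟨ *-assoc N c _ ⟨
        N * c * ∑[ X ∈ tuples (suc k) ] ([ smallStep c i X ] * f X)
          ≡⟨ ∑-*ˡ (N * c) (tuples (suc k)) _ ⟨
        ∑[ X ∈ tuples (suc k) ] (N * c * ([ smallStep c i X ] * f X))
          ≤⟨ ∑-mono (tuples (suc k)) pointwise ⟩
        ∑[ X ∈ tuples (suc k) ] (D * f (removeAt X i))
          ≡⟨ ∑-insertAt i _ ⟩
        ∑[ X ∈ tuples k ] ∑[ x ∈ V ] (D * f (removeAt (insertAt X i x) i))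
          ≡⟨ ∑-cong (tuples k) (λ X → trans (∑-cong V λ x → cong (λ Y → D * f Y) (removeAt-insertAt X i x))
               (∑-const V (D * f X))) ⟩
        ∑[ X ∈ tuples k ] (n * (D * f X))
          ≡⟨ trans (∑-*ˡ n (tuples k) _) (cong (n *_) (∑-*ˡ D (tuples k) f)) ⟩
        n * (D * T k)
          ≤⟨ *-monoʳ-≤ n (T-step k) ⟩
        n * (2 * n * T (suc k))
          ≡⟨ perm n (T (suc k)) ⟩
        N * (2 * T (suc k)) ∎)
        where
        open ≤-Reasoning
        perm : ∀ n t → n * (2 * n * t) ≡ n * n * (2 * t)
        perm = solve-∀
        pointwise : ∀ X → N * c * ([ smallStep c i X ] * f X) ≤ D * f (removeAt X i)
        pointwise X with smallStep c i X in small
        ... | false = ≤-trans (≤-reflexive (*-zeroʳ (N * c))) z≤n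
        ... | true  = ≤-trans (≤-reflexive (perm′ N c (f X))) (<⇒≤ (<ᵇ-true (c * (N * f X)) _ small))
          where
          perm′ : ∀ a b d → a * b * (d + 0) ≡ b * (a * d)
          perm′ = solve-∀

      -- That is, f(X) < qᵏn / c.
      small : ∀ {k} → ℕ → Vec A k → Bool
      small {k} c X = c * (N ^ k * f X) <ᵇ D ^ k * n

      -- Even if all tuples were small, their weight would be only a fraction 2ᵏ⁺¹ / c of the lower
      -- bound `T-lower`.
      few-small : ∀ k c → c * ∑[ X ∈ tuples (suc k) ] ([ small c X ] * f X) ≤ 2 ^ suc k * T (suc k)
      few-small k c = *-cancelˡ-≤ (N ^ suc k) {{m^n≢0 N (suc k)}} (begin
        N ^ suc k * (c * ∑[ X ∈ tuples (suc k) ] ([ small c X ] * f X))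
          ≡⟨ *-assoc (N ^ suc k) c _ ⟨
        N ^ suc k * c * ∑[ X ∈ tuples (suc k) ] ([ small c X ] * f X)
          ≡⟨ ∑-*ˡ (N ^ suc k * c) (tuples (suc k)) _ ⟨
        ∑[ X ∈ tuples (suc k) ] (N ^ suc k * c * ([ small c X ] * f X))
          ≤⟨ ∑-mono (tuples (suc k)) pointwise ⟩
        ∑[ X ∈ tuples (suc k) ] (D ^ suc k * n)
          ≡⟨ ∑-tuples-const (suc k) _ ⟩
        n ^ suc k * (D ^ suc k * n)
          ≤⟨ *-monoʳ-≤ (n ^ suc k) (*-monoˡ-≤ n (T-lower k)) ⟩
        n ^ suc k * (2 ^ suc k * (n ^ k * T (suc k)) * n)
          ≡⟨ perm n (n ^ k) (2 ^ suc k) (T (suc k)) ⟩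
        n ^ suc k * n ^ suc k * (2 ^ suc k * T (suc k))
          ≡⟨ cong (_* (2 ^ suc k * T (suc k))) (^-distribʳ-* (suc k) n n) ⟨
        N ^ suc k * (2 ^ suc k * T (suc k)) ∎)
        where
        open ≤-Reasoning
        perm : ∀ n m a t → n * m * (a * (m * t) * n) ≡ n * m * (n * m) * (a * t)
        perm = solve-∀
        pointwise : ∀ X → N ^ suc k * c * ([ small c X ] * f X) ≤ D ^ suc k * n
        pointwise X with small c X in sm
        ... | false = ≤-trans (≤-reflexive (*-zeroʳ (N ^ suc k * c))) z≤n
        ... | true  = ≤-trans (≤-reflexive (perm′ (N ^ suc k) c (f X))) (<⇒≤ (<ᵇ-true (c * (N ^ suc k * f X)) _ sm))
          where
          perm′ : ∀ a b d → a * b * (d + 0) ≡ b * (a * d)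
          perm′ = solve-∀

      -- Fixing X − xᵢ and S first, only few choices of xᵢ make S bad.  Hence overloaded tuples carry
      -- little weight; f(X) ≥ q f(X − xᵢ) / c₁ serves to compare f(X)^ℓ with f(X − xᵢ)^ℓ.
      module _ {k ℓ : ℕ} (i : Fin (suc k)) (Bad : Vec A (suc k) → Vec A ℓ → Bool) (c₁ c₃ : ℕ) where

        #bad : Vec A (suc k) → ℕ
        #bad X = ∑[ S ∈ tuples ℓ ] ([ every (nbhd X) S ] * [ Bad X S ])

        -- More than a fraction `1 / c₃` of the tuples in `nbhd X` are bad. Tuples with a small step
        -- are left out, being negligible already.
        overloaded : Vec A (suc k) → Bool
        overloaded X = not (smallStep c₁ i X) ∧ (f X ^ ℓ <ᵇ c₃ * #bad X)

        overloaded-true : ∀ X x → overloaded (insertAt X i x) ≡ true →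
          D * f X ≤ c₁ * (N * f (insertAt X i x)) ×
          f (insertAt X i x) ^ ℓ < c₃ * #bad (insertAt X i x)
        overloaded-true X x e with small , many ← ∧-true {not (smallStep c₁ i (insertAt X i x))} e =
          subst (λ Y → D * f Y ≤ c₁ * (N * f (insertAt X i x))) (removeAt-insertAt X i x)
            (<ᵇ-false (c₁ * (N * f (insertAt X i x))) _ (not-true small)) ,
          <ᵇ-true (f (insertAt X i x) ^ ℓ) _ many

        module _ (c₄ : ℕ) .{{D≢0 : NonZero D}}
          -- suc (pred ℓ) is max 1 ℓ: isolated vertices of the pattern give ℓ = 0.
          (few : ∀ X (S : Vec A ℓ) →
            c₄ * (N ^ suc (pred ℓ) * ∑[ x ∈ V ] ([ every (g x) S ] * [ Bad (insertAt X i x) S ]))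
              ≤ D ^ suc (pred ℓ) * n) where

          private
            w total : Vec A k → ℕ
            w X = ∑[ x ∈ V ] ([ overloaded (insertAt X i x) ] * f (insertAt X i x))
            total X = ∑[ x ∈ V ] #bad (insertAt X i x)

          -- A tuple S in the neighbourhood of an extension lies in `nbhd X` and is joined to the
          -- new vertex. There are `f X ^ ℓ` tuples of the first kind, and `few` bounds the new
          -- vertices for each.
          few-bad-pairs : ∀ X → c₄ * (N ^ suc (pred ℓ) * total X) ≤ f X ^ ℓ * (D ^ suc (pred ℓ) * n)
          few-bad-pairs X = begin
            c₄ * (Q * total X)
              ≤⟨ *-monoʳ-≤ c₄ (*-monoʳ-≤ Q (∑-mono V λ x → ∑-mono (tuples ℓ) λ S →
                   ≤-trans (*-monoˡ-≤ [ Bad (insertAt X i x) S ] (every-nbhd-insertAt X i x S))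
                           (≤-reflexive (*-assoc [ every (nbhd X) S ] _ _)))) ⟩
            c₄ * (Q * ∑[ x ∈ V ] ∑[ S ∈ tuples ℓ ] ([ every (nbhd X) S ] * ([ every (g x) S ] * [ Bad (insertAt X i x) S ])))
              ≡⟨ cong (λ s → c₄ * (Q * s)) (trans (∑-swap V (tuples ℓ) _)
                   (∑-cong (tuples ℓ) λ S → ∑-*ˡ [ every (nbhd X) S ] V _)) ⟩
            c₄ * (Q * ∑[ S ∈ tuples ℓ ] ([ every (nbhd X) S ] * s S))
              ≡⟨ *-assoc c₄ Q _ ⟨
            c₄ * Q * ∑[ S ∈ tuples ℓ ] ([ every (nbhd X) S ] * s S)
              ≡⟨ ∑-*ˡ (c₄ * Q) (tuples ℓ) _ ⟨
            ∑[ S ∈ tuples ℓ ] (c₄ * Q * ([ every (nbhd X) S ] * s S))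
              ≡⟨ ∑-cong (tuples ℓ) (λ S → perm c₄ Q [ every (nbhd X) S ] (s S)) ⟩
            ∑[ S ∈ tuples ℓ ] ([ every (nbhd X) S ] * (c₄ * (Q * s S)))
              ≤⟨ ∑-mono (tuples ℓ) (λ S → *-monoʳ-≤ [ every (nbhd X) S ] (few X S)) ⟩
            ∑[ S ∈ tuples ℓ ] ([ every (nbhd X) S ] * (D ^ suc (pred ℓ) * n))
              ≡⟨ trans (∑-*ʳ _ (tuples ℓ) _) (cong (_* (D ^ suc (pred ℓ) * n)) (∑-every (nbhd X) ℓ)) ⟩
            f X ^ ℓ * (D ^ suc (pred ℓ) * n) ∎
            where
            open ≤-Reasoning
            Q = N ^ suc (pred ℓ)
            s : Vec A ℓ → ℕ
            s S = ∑[ x ∈ V ] ([ every (g x) S ] * [ Bad (insertAt X i x) S ])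
            perm : ∀ a b c d → a * b * (c * d) ≡ c * (a * (b * d))
            perm = solve-∀

          private
            -- Write F = f(X), and F′ for the value at an overloaded extension. With ℓ = m + 1,
            -- (qF)ᵐF′ ≤ c₁ᵐF′ˡ < c₁ᵐc₃ `#bad`; summing over the extensions and applying
            -- `few-bad-pairs` leaves w ≤ (c₁ᵐc₃/c₄) q n F. The equation `m ≡ ℓ` allows a case
            -- distinction on the parameter `ℓ`.
            w-bound : ∀ m → m ≡ ℓ → ∀ X → c₄ * (N * w X) ≤ c₁ ^ pred m * c₃ * (D * (n * f X))
            -- For ℓ = 0 there is no power to compare: an overloaded extension has `1 < c₃ * #bad`,
            -- and monotonicity of `f` supplies the factor `f X`.
            w-bound zero refl X = begin
              c₄ * (N * w X)
                ≤⟨ *-monoʳ-≤ c₄ (*-monoʳ-≤ N (≤-trans (∑-mono V pointwise)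
                     (≤-reflexive (∑-*ˡ (c₃ * f X) V _)))) ⟩
              c₄ * (N * (c₃ * f X * total X))
                ≡⟨ perm₁ c₄ N (c₃ * f X) (total X) ⟩
              c₃ * f X * (c₄ * (N * 1 * total X))
                ≤⟨ *-monoʳ-≤ (c₃ * f X) (few-bad-pairs X) ⟩
              c₃ * f X * (1 * (D * 1 * n))
                ≡⟨ perm₂ c₃ (f X) D n ⟩
              1 * c₃ * (D * (n * f X)) ∎
              where
              open ≤-Reasoning
              perm₁ : ∀ a b c d → a * (b * (c * d)) ≡ c * (a * (b * 1 * d))
              perm₁ = solve-∀
              perm₂ : ∀ a b c d → a * b * (1 * (c * 1 * d)) ≡ 1 * a * (c * (d * b))
              perm₂ = solve-∀
              pointwise : ∀ x → [ overloaded (insertAt X i x) ] * f (insertAt X i x)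
                ≤ c₃ * f X * #bad (insertAt X i x)
              pointwise x = []*≤ (overloaded (insertAt X i x)) λ over → begin
                f (insertAt X i x)                    ≤⟨ f-insertAt-≤ X i x ⟩
                f X                                   ≡⟨ *-identityʳ (f X) ⟨
                f X * 1                               ≤⟨ *-monoʳ-≤ (f X) (<⇒≤ (proj₂ (overloaded-true X x over))) ⟩
                f X * (c₃ * #bad (insertAt X i x))    ≡⟨ perm₃ (f X) c₃ _ ⟩
                c₃ * f X * #bad (insertAt X i x) ∎
                where
                perm₃ : ∀ a b c → a * (b * c) ≡ b * a * c
                perm₃ = solve-∀
            -- The factor `(D * F) ^ m` can be cancelled only for nonzero `f X`; if `f X` vanishes,
            -- all extensions have weight zero.
            w-bound (suc m) refl X with f X ≟ 0
            ... | yes f≡0 = ≤-trans (≤-reflexive (trans (cong (λ s → c₄ * (N * s)) w≡0)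
                    (trans (cong (c₄ *_) (*-zeroʳ N)) (*-zeroʳ c₄)))) z≤n
              where
              w≡0 : w X ≡ 0
              w≡0 = n≤0⇒n≡0 (≤-trans (∑-mono V λ x → []*≤ (overloaded (insertAt X i x))
                λ _ → ≤-trans (f-insertAt-≤ X i x) (≤-reflexive f≡0)) (≤-reflexive (∑-0 V)))
            ... | no f≢0 = *-cancelˡ-≤ (N ^ m * (D * F) ^ m) {{nonZero}} (begin
              N ^ m * (D * F) ^ m * (c₄ * (N * w X))
                ≡⟨ perm₁ (N ^ m) ((D * F) ^ m) c₄ N (w X) ⟩
              c₄ * (N * N ^ m) * ((D * F) ^ m * w X)
                ≤⟨ *-monoʳ-≤ (c₄ * (N * N ^ m)) weighted ⟩
              c₄ * (N * N ^ m) * ((c₁ * N) ^ m * (c₃ * total X))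
                ≡⟨ cong (λ s → c₄ * (N * N ^ m) * (s * (c₃ * total X))) (^-distribʳ-* m c₁ N) ⟩
              c₄ * (N * N ^ m) * (c₁ ^ m * N ^ m * (c₃ * total X))
                ≡⟨ perm₂ c₄ (N * N ^ m) (c₁ ^ m) (N ^ m) c₃ (total X) ⟩
              c₁ ^ m * N ^ m * c₃ * (c₄ * (N * N ^ m * total X))
                ≤⟨ *-monoʳ-≤ (c₁ ^ m * N ^ m * c₃) (few-bad-pairs X) ⟩
              c₁ ^ m * N ^ m * c₃ * (F * F ^ m * (D * D ^ m * n))
                ≡⟨ perm₃ (c₁ ^ m) (N ^ m) c₃ F (F ^ m) D (D ^ m) n ⟩
              N ^ m * (D ^ m * F ^ m) * (c₁ ^ m * c₃ * (D * (n * F)))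
                ≡⟨ cong (λ s → N ^ m * s * (c₁ ^ m * c₃ * (D * (n * F)))) (^-distribʳ-* m D F) ⟨
              N ^ m * (D * F) ^ m * (c₁ ^ m * c₃ * (D * (n * F))) ∎)
              where
              open ≤-Reasoning
              F = f X
              nonZero : NonZero (N ^ m * (D * F) ^ m)
              nonZero = m*n≢0 (N ^ m) _ {{m^n≢0 N m}}
                {{m^n≢0 (D * F) m {{m*n≢0 D F {{D≢0}} {{≢-nonZero f≢0}}}}}}
              perm₁ : ∀ a b c d e → a * b * (c * (d * e)) ≡ c * (d * a) * (b * e)
              perm₁ = solve-∀
              perm₂ : ∀ a b c d e h → a * b * (c * d * (e * h)) ≡ c * d * e * (a * (b * h))
              perm₂ = solve-∀
              perm₃ : ∀ a b c F Fm D Dm n →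
                a * b * c * (F * Fm * (D * Dm * n)) ≡ b * (Dm * Fm) * (a * c * (D * (n * F)))
              perm₃ = solve-∀
              pointwise : ∀ x → (D * F) ^ m * ([ overloaded (insertAt X i x) ] * f (insertAt X i x))
                ≤ (c₁ * N) ^ m * (c₃ * #bad (insertAt X i x))
              pointwise x = ≤-trans (≤-reflexive (swap ((D * F) ^ m) [ overloaded (insertAt X i x) ] _))
                ([]*≤ (overloaded (insertAt X i x)) λ over → let large , many = overloaded-true X x over in begin
                  (D * F) ^ m * F′           ≤⟨ *-monoˡ-≤ F′ (^-monoˡ-≤ m large) ⟩
                  (c₁ * (N * F′)) ^ m * F′   ≡⟨ cong (_* F′) (trans (cong (_^ m) (sym (*-assoc c₁ N F′))) (^-distribʳ-* m (c₁ * N) F′)) ⟩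
                  (c₁ * N) ^ m * F′ ^ m * F′ ≡⟨ trans (*-assoc ((c₁ * N) ^ m) _ _) (cong ((c₁ * N) ^ m *_) (*-comm (F′ ^ m) F′)) ⟩
                  (c₁ * N) ^ m * F′ ^ suc m  ≤⟨ *-monoʳ-≤ ((c₁ * N) ^ m) (<⇒≤ many) ⟩
                  (c₁ * N) ^ m * (c₃ * #bad (insertAt X i x)) ∎)
                where
                F′ = f (insertAt X i x)
                swap : ∀ a b c → a * (b * c) ≡ b * (a * c)
                swap = solve-∀
              weighted : (D * F) ^ m * w X ≤ (c₁ * N) ^ m * (c₃ * total X)
              weighted = begin
                (D * F) ^ m * w X  ≡⟨ ∑-*ˡ ((D * F) ^ m) V _ ⟨
                ∑[ x ∈ V ] ((D * F) ^ m * ([ overloaded (insertAt X i x) ] * f (insertAt X i x)))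
                                   ≤⟨ ∑-mono V pointwise ⟩
                ∑[ x ∈ V ] ((c₁ * N) ^ m * (c₃ * #bad (insertAt X i x)))
                                   ≡⟨ trans (∑-*ˡ ((c₁ * N) ^ m) V _) (cong ((c₁ * N) ^ m *_) (∑-*ˡ c₃ V _)) ⟩
                (c₁ * N) ^ m * (c₃ * total X) ∎

          -- Summing `w-bound` over X gives a multiple of q n `T k`, which `T-step` turns into
          -- `T (suc k)`.
          few-overloaded : c₄ * ∑[ X ∈ tuples (suc k) ] ([ overloaded X ] * f X)
            ≤ 2 * (c₁ ^ pred ℓ * c₃) * T (suc k)
          few-overloaded = *-cancelˡ-≤ N (begin
            N * (c₄ * ∑[ X ∈ tuples (suc k) ] ([ overloaded X ] * f X))
              ≡⟨ cong (λ s → N * (c₄ * s)) (∑-insertAt i _) ⟩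
            N * (c₄ * ∑[ X ∈ tuples k ] w X)
              ≡⟨ swap N c₄ _ ⟩
            c₄ * N * ∑[ X ∈ tuples k ] w X
              ≡⟨ ∑-*ˡ (c₄ * N) (tuples k) w ⟨
            ∑[ X ∈ tuples k ] (c₄ * N * w X)
              ≤⟨ ∑-mono (tuples k) (λ X → ≤-trans (≤-reflexive (*-assoc c₄ N (w X))) (w-bound ℓ refl X)) ⟩
            ∑[ X ∈ tuples k ] (E * (D * (n * f X)))
              ≡⟨ ∑-cong (tuples k) (λ X → perm₁ E D n (f X)) ⟩
            ∑[ X ∈ tuples k ] (E * n * D * f X)
              ≡⟨ ∑-*ˡ (E * n * D) (tuples k) f ⟩
            E * n * D * T k
              ≡⟨ *-assoc (E * n) D (T k) ⟩
            E * n * (D * T k)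
              ≤⟨ *-monoʳ-≤ (E * n) (T-step k) ⟩
            E * n * (2 * n * T (suc k))
              ≡⟨ perm₂ E n (T (suc k)) ⟩
            N * (2 * E * T (suc k)) ∎)
            where
            open ≤-Reasoning
            E = c₁ ^ pred ℓ * c₃
            swap : ∀ a b c → a * (b * c) ≡ b * a * c
            swap = solve-∀
            perm₁ : ∀ a b c d → a * (b * (c * d)) ≡ a * c * b * d
            perm₁ = solve-∀
            perm₂ : ∀ e n t → e * n * (2 * n * t) ≡ n * n * (2 * e * t)
            perm₂ = solve-∀

  none-true : ∀ {A I : Set} {is : List I} {bad : I → A → Bool} {x} →
    none is bad x ≡ true → ∀ {i} → i ∈ is → bad i x ≡ false
  none-true {is = i ∷ is} {bad} {x} e (here refl) = not-true (proj₁ (∧-true {not (bad i x)} e))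
  none-true {is = i ∷ is} {bad} {x} e (there i∈)  = none-true (proj₂ (∧-true {not (bad i x)} e)) i∈

  length-cartesianProduct : ∀ {A B : Set} (xs : List A) (ys : List B) →
    length (cartesianProduct xs ys) ≡ length xs * length ys
  length-cartesianProduct []       ys = refl
  length-cartesianProduct (x ∷ xs) ys = trans (length-++ (map (x ,_) ys))
    (cong₂ _+_ (length-map (x ,_) ys) (length-cartesianProduct xs ys))

  -- Constants, and configurations of centres, leaves and remaining vertices.

  -- Each inequality is what one later estimate demands. `c₁` limits the drop of f in one step, `c₂`
  -- the smallness of f(X), `c₃` the share of bad S and `c₄` the codegrees. They can be chosen in
  -- this order, since `c₄` refers to `c₁` and `c₃`, and `M` only to `c₂` and `c₄`.
  record Constants (L d k b m : ℕ) : Set where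
    field
      c₁ c₂ c₃ c₄ M : ℕ
      c₁≢0     : NonZero c₁
      c₂≢0     : NonZero c₂
      c₃≢0     : NonZero c₃
      c₄≢0     : NonZero c₄
      c₁-large : 2 * (2 * transK L k * k) ≤ c₁
      c₂-large : 2 ^ k * (2 * (2 * transK L k) * 1) ≤ c₂
      c₃-large : 2 * transK L b * (m * k) ≤ c₃
      c₄-large : 2 * (2 * (2 * transK L k)) * (m * k) * (2 * (c₁ ^ d * c₃)) ≤ c₄
      M-degree : 2 * transM L k ≤ M
      M-cut    : c₄ ≤ M
      M-nbhd   : c₂ * (transM L b + 2 * (2 * transK L b) * m * b) ≤ M
      M-common : c₄ * (L ^ k * L ^ b) ≤ M
      M-rest   : c₄ * (L ^ k * L ^ b) * transM L m ≤ M

  constants : ∀ L d k b m → Constants L d k b m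
  constants L d k b m = record
    { c₁ = c₁ ; c₂ = c₂ ; c₃ = c₃ ; c₄ = c₄ ; M = a + (c₄ + (x + (y + z)))
    ; c₁≢0 = _ ; c₂≢0 = _ ; c₃≢0 = _ ; c₄≢0 = _
    ; c₁-large = n≤1+n _ ; c₂-large = n≤1+n _ ; c₃-large = n≤1+n _ ; c₄-large = n≤1+n _
    ; M-degree = m≤m+n a _
    ; M-cut    = ≤-trans (m≤m+n c₄ _) (m≤n+m _ a)
    ; M-nbhd   = ≤-trans (m≤m+n x _) (≤-trans (m≤n+m _ c₄) (m≤n+m _ a))
    ; M-common = ≤-trans (m≤m+n y z) (≤-trans (m≤n+m _ x) (≤-trans (m≤n+m _ c₄) (m≤n+m _ a)))
    ; M-rest   = ≤-trans (m≤n+m z y) (≤-trans (m≤n+m _ x) (≤-trans (m≤n+m _ c₄) (m≤n+m _ a)))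
    }
    where
    c₁ = suc (2 * (2 * transK L k * k))
    c₂ = suc (2 ^ k * (2 * (2 * transK L k) * 1))
    c₃ = suc (2 * transK L b * (m * k))
    c₄ = suc (2 * (2 * (2 * transK L k)) * (m * k) * (2 * (c₁ ^ d * c₃)))
    a = 2 * transM L k
    x = c₂ * (transM L b + 2 * (2 * transK L b) * m * b)
    y = c₄ * (L ^ k * L ^ b)
    z = c₄ * (L ^ k * L ^ b) * transM L m

  module Configurations {A : Set} (V : List A) (g r : A → A → Bool)
    {k b m : ℕ} (masks : Vec (Vec Bool b) m) (L τ : ℕ) .{{_ : NonZero L}} where
    open Transversals V r L τ
    open Weights V g

    common : ∀ {ℓ} → Vec A ℓ → A → Bool
    common S a = every (g a) S

    -- The candidates for a vertex of A whose neighbourhood in B is `s`. X is cut first: its cuts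
    -- are controlled on the uncut common neighbourhood, those by `off s Y` on any fixed set, hence
    -- also on one already cut.
    rest : Vec A k → Vec A b → Vec Bool b → A → Bool
    rest X Y s = cuts (off s Y) (cuts X (common (on s Y)))

    rests : Vec A k → Vec A b → Vec (A → Bool) m
    rests X Y = Vec.map (rest X Y) masks

    core : Vec A k → Vec A b → Bool
    core X Y = independent X ∧ (independent Y ∧ every (joined X) Y)

    #configurations : ℕ
    #configurations = ∑[ X ∈ tuples k ] ∑[ Y ∈ tuples b ] ([ core X Y ] * #transversals (rests X Y))

  -- Counting configurations when B is nonempty.

  module Counting {A : Set} (V : List A) (g r : A → A → Bool) (k b m d : ℕ)
    (masks : Vec (Vec Bool (suc b)) m) (L τ : ℕ) .{{_ : NonZero L}} .{{_ : NonZero τ}}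
    .{{_ : NonZero (length V)}} .{{D≢0 : NonZero (Weights.D V g)}}
    (constants : Constants L d (suc k) (suc b) m)
    (few-bad : ∀ W → Tuples.card V (Cutting.bad V r L τ W) ≤ τ)
    (k<d : k < d) (ones≤d : ∀ u → ones (lookup masks u) ≤ d) where
    open Transversals V r L τ
    open Many few-bad
    open Weights V g
    open Configurations V g r {suc k} masks L τ
    open Constants constants

    private instance
      nz₁ : NonZero c₁
      nz₁ = c₁≢0
      nz₂ : NonZero c₂
      nz₂ = c₂≢0
      nz₃ : NonZero c₃
      nz₃ = c₃≢0
      nz₄ : NonZero c₄
      nz₄ = c₄≢0
      nzN : NonZero N
      nzN = m*n≢0 n n

    -- qʲn ≥ Mτ.
    module _ (rich : ∀ j → j ≤ d → M * τ * N ^ j ≤ D ^ j * n) where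

      highDegree⇒large : ∀ v → highDegree v ≡ true → transM L (suc k) * τ ≤ deg v
      highDegree⇒large v high = *-cancelˡ-≤ (2 * N) {{m*n≢0 2 N}} (begin
        2 * N * (transM L (suc k) * τ)        ≡⟨ perm₁ N (transM L (suc k)) τ ⟩
        2 * transM L (suc k) * τ * (N * 1)    ≤⟨ *-monoˡ-≤ (N * 1) (*-monoˡ-≤ τ M-degree) ⟩
        M * τ * (N * 1)                       ≤⟨ rich 1 (≤-trans (s≤s z≤n) k<d) ⟩
        D * 1 * n                             ≡⟨ perm₂ D n ⟩
        n * D                                 ≤⟨ *-monoʳ-≤ n (≤ᵇ-true D _ high) ⟩
        n * (2 * n * deg v)                   ≡⟨ perm₃ n (deg v) ⟩
        2 * N * deg v ∎)
        where
        open ≤-Reasoning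
        perm₁ : ∀ a b c → 2 * a * (b * c) ≡ 2 * b * c * (a * 1)
        perm₁ = solve-∀
        perm₂ : ∀ a b → a * 1 * b ≡ b * a
        perm₂ = solve-∀
        perm₃ : ∀ n e → n * (2 * n * e) ≡ 2 * (n * n) * e
        perm₃ = solve-∀

      -- Seen from `v`, the weight is the sum of `deg v ^ suc k` over vertices of high degree, and
      -- each neighbourhood is large enough for `independent-tuples`.
      independent-weight : T (suc k) ≤ transK L (suc k) * ∑[ X ∈ tuples (suc k) ] ([ independent X ] * f X)
      independent-weight = begin
        T (suc k)
          ≡⟨ trans (∑-swap (tuples (suc k)) V _) (∑-cong V λ v →
               trans (∑-cong (tuples (suc k)) λ X → [∧] (highDegree v) (joined X v))
               (trans (∑-*ˡ [ highDegree v ] (tuples (suc k)) _)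
                      (cong ([ highDegree v ] *_) (∑-every (λ x → g x v) (suc k))))) ⟩
        ∑[ v ∈ V ] ([ highDegree v ] * deg v ^ suc k)
          ≤⟨ ∑-mono V (λ v → []*-mono (highDegree v) λ high →
               independent-tuples (suc k) (λ x → g x v) (highDegree⇒large v high)) ⟩
        ∑[ v ∈ V ] ([ highDegree v ] * (K * ∑[ X ∈ tuples (suc k) ] ([ independent X ] * [ joined X v ])))
          ≡⟨ ∑-cong V (λ v → trans (swap [ highDegree v ] K _) (cong (K *_) (trans (sym (∑-*ˡ [ highDegree v ] (tuples (suc k)) _))
               (∑-cong (tuples (suc k)) λ X → trans (swap [ highDegree v ] [ independent X ] _)
                 (cong ([ independent X ] *_) (sym ([∧] (highDegree v) (joined X v)))))))) ⟩
        ∑[ v ∈ V ] (K * ∑[ X ∈ tuples (suc k) ] ([ independent X ] * [ nbhd X v ]))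
          ≡⟨ trans (∑-*ˡ K V _) (cong (K *_) (trans (∑-swap V (tuples (suc k)) _)
               (∑-cong (tuples (suc k)) λ X → ∑-*ˡ [ independent X ] V _))) ⟩
        K * ∑[ X ∈ tuples (suc k) ] ([ independent X ] * f X) ∎
        where
        open ≤-Reasoning
        K = transK L (suc k)
        swap : ∀ a b c → a * (b * c) ≡ b * (a * c)
        swap = solve-∀

      mask : Fin m → Vec Bool (suc b)
      mask u = lookup masks u

      lowCodegree : ∀ {ℓ} → Vec A ℓ → Bool
      lowCodegree {ℓ} S = c₄ * (N ^ ℓ * card (common S)) <ᵇ D ^ ℓ * n

      -- The failure of what `rest-large` asks of S: many common neighbours, of which the vertex `i`
      -- of X does not remove nearly all that the earlier ones left.
      Bad : ∀ {ℓ} → Fin (suc k) → Vec A (suc k) → Vec A ℓ → Bool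
      Bad i X S = lowCodegree S ∨ badAt i X (common S)

      few-Bad : ∀ {ℓ} i → ℓ ≤ d → ∀ X (S : Vec A ℓ) →
        c₄ * (N ^ suc (pred ℓ) * ∑[ x ∈ V ] ([ every (g x) S ] * [ Bad i (insertAt X i x) S ]))
          ≤ D ^ suc (pred ℓ) * n
      few-Bad {ℓ} i ℓ≤d X S with lowCodegree S in low
      -- The empty tuple has all `n` vertices as common neighbours, so its codegree is never low.
      few-Bad {zero} i ℓ≤d X [] | true = contradiction (begin-strict
        D ^ 0 * n                    ≡⟨ *-identityˡ n ⟩
        n                            ≤⟨ m≤n*m n c₄ ⟩
        c₄ * n                       ≡⟨ cong (c₄ *_) (trans (sym (*-identityʳ n)) (trans (sym (∑-const V 1)) (sym (+-identityʳ _)))) ⟩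
        c₄ * (N ^ 0 * card (common {0} []))  <⟨ <ᵇ-true (c₄ * (N ^ 0 * card (common {0} []))) _ low ⟩
        D ^ 0 * n ∎) (<-irrefl refl)
        where open ≤-Reasoning
      -- Only `x` joined to S are counted, and their number is the codegree itself.
      few-Bad {suc ℓ} i ℓ≤d X S | true = ≤-trans
        (*-monoʳ-≤ c₄ (*-monoʳ-≤ (N ^ suc ℓ) (≤-reflexive (∑-cong V λ x → *-identityʳ [ every (g x) S ]))))
        (<⇒≤ (<ᵇ-true (c₄ * (N ^ suc ℓ * card (common S))) _ low))
      few-Bad {ℓ} i ℓ≤d X S | false = begin
        c₄ * (Q * ∑[ x ∈ V ] ([ every (g x) S ] * [ badAt i (insertAt X i x) (common S) ]))
          ≤⟨ *-monoʳ-≤ c₄ (*-monoʳ-≤ Q (≤-trans (∑-mono V λ x → []*≤ (every (g x) S) λ _ → ≤-refl)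
               (few-badAt i X (common S)))) ⟩
        c₄ * (Q * τ)  ≡⟨ perm c₄ Q τ ⟩
        c₄ * τ * Q    ≤⟨ *-monoˡ-≤ Q (*-monoˡ-≤ τ M-cut) ⟩
        M * τ * Q     ≤⟨ rich (suc (pred ℓ)) (pred<d ℓ≤d) ⟩
        D ^ suc (pred ℓ) * n ∎
        where
        open ≤-Reasoning
        Q = N ^ suc (pred ℓ)
        perm : ∀ a b c → a * (b * c) ≡ a * c * b
        perm = solve-∀
        pred<d : ∀ {ℓ} → ℓ ≤ d → suc (pred ℓ) ≤ d
        pred<d {zero}  _ = ≤-trans (s≤s z≤n) k<d
        pred<d {suc ℓ} h = h

      pairs : List (Fin m × Fin (suc k))
      pairs = cartesianProduct (allFin m) (allFin (suc k))

      length-allFin : ∀ j → length (allFin j) ≡ j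
      length-allFin j = length-tabulate {n = j} (λ i → i)

      length-pairs : length pairs ≡ m * suc k
      length-pairs = trans (length-cartesianProduct (allFin m) (allFin (suc k)))
        (cong₂ _*_ (length-allFin m) (length-allFin (suc k)))

      overloadedAt : Fin m × Fin (suc k) → Vec A (suc k) → Bool
      overloadedAt (u , i) = overloaded i (Bad {ones (mask u)} i) c₁ c₃

      stepGood sizeGood goodX : Vec A (suc k) → Bool
      stepGood X = independent X ∧ none (allFin (suc k)) (smallStep c₁) X
      sizeGood X = stepGood X ∧ none (tt ∷ []) (λ _ → small c₂) X
      goodX X = sizeGood X ∧ none pairs overloadedAt X

      -- Three union bounds in succession, for small steps, small neighbourhoods and overloaded
      -- tuples, each doubling the constant of `independent-weight`.
      goodX-weight : T (suc k) ≤ 2 * (2 * (2 * transK L (suc k))) * ∑[ X ∈ tuples (suc k) ] ([ goodX X ] * f X)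
      goodX-weight =
        union-bound (tuples (suc k)) f sizeGood pairs overloadedAt (T (suc k)) (2 * (2 * K))
          (union-bound (tuples (suc k)) f stepGood (tt ∷ []) (λ _ → small c₂) (T (suc k)) (2 * K)
            (union-bound (tuples (suc k)) f independent (allFin (suc k)) (smallStep c₁) (T (suc k)) K
              independent-weight steps)
            (λ _ → sizes))
          loads
        where
        open ≤-Reasoning
        K = transK L (suc k)
        steps : ∀ i → 2 * K * length (allFin (suc k)) * ∑[ X ∈ tuples (suc k) ] ([ smallStep c₁ i X ] * f X) ≤ T (suc k)
        steps i rewrite length-allFin (suc k) = *-cancelˡ-≤ 2 (begin
          2 * (2 * K * suc k * s) ≡⟨ *-assoc 2 (2 * K * suc k) s ⟨
          2 * (2 * K * suc k) * s ≤⟨ *-monoˡ-≤ s c₁-large ⟩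
          c₁ * s                  ≤⟨ few-smallStep c₁ i ⟩
          2 * T (suc k) ∎)
          where s = ∑[ X ∈ tuples (suc k) ] ([ smallStep c₁ i X ] * f X)
        sizes : 2 * (2 * K) * 1 * ∑[ X ∈ tuples (suc k) ] ([ small c₂ X ] * f X) ≤ T (suc k)
        sizes = *-cancelˡ-≤ (2 ^ suc k) {{m^n≢0 2 (suc k)}} (begin
          2 ^ suc k * (2 * (2 * K) * 1 * s) ≡⟨ *-assoc (2 ^ suc k) (2 * (2 * K) * 1) s ⟨
          2 ^ suc k * (2 * (2 * K) * 1) * s ≤⟨ *-monoˡ-≤ s c₂-large ⟩
          c₂ * s                            ≤⟨ few-small k c₂ ⟩
          2 ^ suc k * T (suc k) ∎)
          where s = ∑[ X ∈ tuples (suc k) ] ([ small c₂ X ] * f X)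
        loads : ∀ p → 2 * (2 * (2 * K)) * length pairs * ∑[ X ∈ tuples (suc k) ] ([ overloadedAt p X ] * f X) ≤ T (suc k)
        loads (u , i) rewrite length-pairs = *-cancelˡ-≤ U {{m*n≢0 2 (c₁ ^ d * c₃) {{_}} {{m*n≢0 (c₁ ^ d) c₃ {{m^n≢0 c₁ d}}}}}} (begin
          U * (2 * (2 * (2 * K)) * (m * suc k) * s) ≡⟨ perm U (2 * (2 * (2 * K)) * (m * suc k)) s ⟩
          2 * (2 * (2 * K)) * (m * suc k) * U * s   ≤⟨ *-monoˡ-≤ s c₄-large ⟩
          c₄ * s
            ≤⟨ few-overloaded i (Bad i) c₁ c₃ c₄ (few-Bad i (ones≤d u)) ⟩
          2 * (c₁ ^ pred ℓ * c₃) * T (suc k)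
            -- The exponent `pred ℓ` varies with `u`; raising it to `d` lets one `c₄` serve all
            -- pairs.
            ≤⟨ *-monoˡ-≤ (T (suc k)) (*-monoʳ-≤ 2 (*-monoˡ-≤ c₃
                 (^-monoʳ-≤ c₁ (≤-trans (pred[n]≤n {ℓ}) (ones≤d u))))) ⟩
          U * T (suc k) ∎)
          where
          s = ∑[ X ∈ tuples (suc k) ] ([ overloadedAt (u , i) X ] * f X)
          U = 2 * (c₁ ^ d * c₃)
          ℓ = ones (mask u)
          perm : ∀ a b c → a * (b * c) ≡ b * a * c
          perm = solve-∀

      module GoodCentres (X : Vec A (suc k)) (good : goodX X ≡ true) where

        private
          P = nbhd X
          F = f X
          X-size   = proj₁ (∧-true {sizeGood X} good)
          X-step   = proj₁ (∧-true {stepGood X} X-size)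

        X-independent : independent X ≡ true
        X-independent = proj₁ (∧-true X-step)

        F-large : D ^ suc k * n ≤ c₂ * (N ^ suc k * F)
        F-large = <ᵇ-false (c₂ * (N ^ suc k * F)) _
          (none-true {is = tt ∷ []} {bad = λ _ → small c₂} {x = X} (proj₂ (∧-true {stepGood X} X-size)) (here refl))

        few-Bad-at : ∀ u i → c₃ * #bad {ℓ = ones (mask u)} i (Bad i) c₁ c₃ X ≤ F ^ ones (mask u)
        few-Bad-at u i with notOver ← none-true {is = pairs} {bad = overloadedAt} (proj₂ (∧-true {sizeGood X} good))
            (∈-cartesianProduct⁺ (∈-allFin u) (∈-allFin i))
          -- X has no small step at `i`, so not being overloaded can only mean that bad tuples are
          -- few.
          rewrite none-true {is = allFin (suc k)} {bad = smallStep c₁} (proj₂ (∧-true {independent X} X-step)) (∈-allFin i)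
          = <ᵇ-false (F ^ ones (mask u)) _ notOver

        -- F is at least qᵏ⁺¹n / c₂, and `rich` compares this with `τ` because `suc k` is at most
        -- `d`.
        F-≥ : ∀ a → c₂ * a ≤ M → a * τ ≤ F
        F-≥ a h = *-cancelˡ-≤ (c₂ * N ^ suc k) {{m*n≢0 c₂ _ {{nz₂}} {{m^n≢0 N (suc k)}}}} (begin
          c₂ * N ^ suc k * (a * τ)   ≡⟨ perm c₂ (N ^ suc k) a τ ⟩
          c₂ * a * τ * N ^ suc k     ≤⟨ *-monoˡ-≤ (N ^ suc k) (*-monoˡ-≤ τ h) ⟩
          M * τ * N ^ suc k          ≤⟨ rich (suc k) k<d ⟩
          D ^ suc k * n              ≤⟨ F-large ⟩
          c₂ * (N ^ suc k * F)       ≡⟨ *-assoc c₂ _ F ⟨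
          c₂ * N ^ suc k * F ∎)
          where
          open ≤-Reasoning
          perm : ∀ a b c d → a * b * (c * d) ≡ a * c * d * b
          perm = solve-∀

        F-trans : transM L (suc b) * τ ≤ F
        F-trans = F-≥ (transM L (suc b)) (≤-trans (*-monoʳ-≤ c₂ (m≤m+n _ _)) M-nbhd)

        F-rest : 2 * (2 * transK L (suc b)) * m * suc b * τ ≤ F
        F-rest = F-≥ (2 * (2 * transK L (suc b)) * m * suc b)
          (≤-trans (*-monoʳ-≤ c₂ (m≤n+m _ (transM L (suc b)))) M-nbhd)

        F≢0 : NonZero F
        F≢0 = >-nonZero (≤-trans (>-nonZero⁻¹ τ) (≤-trans (m≤n*m τ (transM L (suc b))) F-trans))

        badPair : Fin m × Fin (suc k) → Vec A (suc b) → Bool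
        badPair (u , i) Y = Bad i X (on (mask u) Y)

        badRest : Fin m → Vec A (suc b) → Bool
        badRest u Y = badSomewhere (off (mask u) Y) (cuts X (common (on (mask u) Y)))

        pairGood goodY : Vec A (suc b) → Bool
        pairGood Y = independent Y ∧ none pairs badPair Y
        goodY Y = pairGood Y ∧ none (allFin m) badRest Y

        power-split : ∀ (s : Vec Bool (suc b)) → F ^ ones s * F ^ zeros s ≡ F ^ suc b
        power-split s = trans (sym (^-distribˡ-+-* F (ones s) (zeros s)))
          (subst (λ e → F ^ (ones s + zeros s) ≡ F ^ e) (ones+zeros s) refl)

        -- Two union bounds over independent Y in `nbhd X`. A bad pair depends only on the
        -- coordinates on the mask, so the others contribute a factor `F ^ zeros s`. For `badRest`
        -- those on the mask are fixed, and the others range over `nbhd X` while cutting a set that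
        -- does not depend on them.
        many-goodY : F ^ suc b ≤ 2 * (2 * transK L (suc b)) * ∑[ Y ∈ tuples (suc b) ] ([ goodY Y ] * [ every P Y ])
        many-goodY =
          union-bound (tuples (suc b)) (λ Y → [ every P Y ]) pairGood (allFin m) badRest (F ^ suc b) (2 * K)
            (union-bound (tuples (suc b)) (λ Y → [ every P Y ]) independent pairs badPair (F ^ suc b) K
              (independent-tuples (suc b) P F-trans) few-pairs)
            few-rests
          where
          open ≤-Reasoning
          K = transK L (suc b)
          few-pairs : ∀ p → 2 * K * length pairs * ∑[ Y ∈ tuples (suc b) ] ([ badPair p Y ] * [ every P Y ]) ≤ F ^ suc b
          few-pairs (u , i) rewrite length-pairs = begin
            2 * K * (m * suc k) * ∑[ Y ∈ tuples (suc b) ] ([ badPair (u , i) Y ] * [ every P Y ])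
              ≤⟨ *-monoˡ-≤ _ c₃-large ⟩
            c₃ * ∑[ Y ∈ tuples (suc b) ] ([ badPair (u , i) Y ] * [ every P Y ])
              ≡⟨ cong (c₃ *_) (trans (∑-cong (tuples (suc b)) λ Y → trans (cong ([ badPair (u , i) Y ] *_) (every-on-off s P Y))
                   (perm [ badPair (u , i) Y ] [ every P (on s Y) ] [ every P (off s Y) ]))
                 (∑-on-off s (λ S R → [ every P S ] * [ Bad i X S ] * [ every P R ]))) ⟩
            c₃ * ∑[ S ∈ tuples (ones s) ] ∑[ R ∈ tuples (zeros s) ] ([ every P S ] * [ Bad i X S ] * [ every P R ])
              ≡⟨ cong (c₃ *_) (trans (∑-cong (tuples (ones s)) λ S → trans (∑-*ˡ ([ every P S ] * [ Bad i X S ]) (tuples (zeros s)) _)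
                   (cong ([ every P S ] * [ Bad i X S ] *_) (∑-every P (zeros s))))
                 (∑-*ʳ (F ^ zeros s) (tuples (ones s)) _)) ⟩
            c₃ * (#bad {ℓ = ones s} i (Bad i) c₁ c₃ X * F ^ zeros s)  ≡⟨ *-assoc c₃ _ _ ⟨
            c₃ * #bad {ℓ = ones s} i (Bad i) c₁ c₃ X * F ^ zeros s    ≤⟨ *-monoˡ-≤ (F ^ zeros s) (few-Bad-at u i) ⟩
            F ^ ones s * F ^ zeros s                     ≡⟨ power-split s ⟩
            F ^ suc b ∎
            where
            s = mask u
            perm : ∀ a b c → a * (b * c) ≡ b * a * c
            perm = solve-∀
          few-rests : ∀ u → 2 * (2 * K) * length (allFin m) * ∑[ Y ∈ tuples (suc b) ] ([ badRest u Y ] * [ every P Y ]) ≤ F ^ suc b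
          few-rests u rewrite length-allFin m = *-cancelˡ-≤ F {{F≢0}} (begin
            F * (E * ∑[ Y ∈ tuples (suc b) ] ([ badRest u Y ] * [ every P Y ]))
              ≡⟨ perm₁ F E _ ⟩
            E * (F * ∑[ Y ∈ tuples (suc b) ] ([ badRest u Y ] * [ every P Y ]))
              ≡⟨ cong (λ t → E * (F * t)) (trans (∑-cong (tuples (suc b)) λ Y → trans (cong ([ badRest u Y ] *_) (every-on-off s P Y))
                   (perm₂ [ badRest u Y ] [ every P (on s Y) ] [ every P (off s Y) ]))
                 (trans (∑-on-off s (λ S R → [ every P S ] * ([ every P R ] * [ badSomewhere R (W S) ])))
                   (∑-cong (tuples (ones s)) λ S → ∑-*ˡ [ every P S ] (tuples (zeros s)) _))) ⟩
            E * (F * ∑[ S ∈ tuples (ones s) ] ([ every P S ] * B S))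
              ≡⟨ cong (E *_) (trans (sym (∑-*ˡ F (tuples (ones s)) _)) (∑-cong (tuples (ones s)) λ S → perm₁ F [ every P S ] (B S))) ⟩
            E * ∑[ S ∈ tuples (ones s) ] ([ every P S ] * (F * B S))
              ≤⟨ *-monoʳ-≤ E (∑-mono (tuples (ones s)) λ S → *-monoʳ-≤ [ every P S ] (few-badSomewhere P (zeros s) (W S))) ⟩
            E * ∑[ S ∈ tuples (ones s) ] ([ every P S ] * (zeros s * τ * F ^ zeros s))
              ≡⟨ cong (E *_) (trans (∑-*ʳ _ (tuples (ones s)) _) (cong (_* (zeros s * τ * F ^ zeros s)) (∑-every P (ones s)))) ⟩
            E * (F ^ ones s * (zeros s * τ * F ^ zeros s))
              ≡⟨ perm₃ E (F ^ ones s) (zeros s) τ (F ^ zeros s) ⟩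
            E * zeros s * τ * (F ^ ones s * F ^ zeros s)
              ≡⟨ cong (E * zeros s * τ *_) (power-split s) ⟩
            E * zeros s * τ * F ^ suc b
              ≤⟨ *-monoˡ-≤ (F ^ suc b) (≤-trans (*-monoˡ-≤ τ (*-monoʳ-≤ E
                   (≤-trans (m≤n+m (zeros s) (ones s)) (≤-reflexive (ones+zeros s))))) F-rest) ⟩
            F * F ^ suc b ∎)
            where
            s = mask u
            E = 2 * (2 * K) * m
            W : Vec A (ones s) → A → Bool
            W S = cuts X (common S)
            B : Vec A (ones s) → ℕ
            B S = ∑[ R ∈ tuples (zeros s) ] ([ every P R ] * [ badSomewhere R (W S) ])
            perm₁ : ∀ a b c → a * (b * c) ≡ b * (a * c)
            perm₁ = solve-∀
            perm₂ : ∀ a b c → a * (b * c) ≡ b * (c * a)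
            perm₂ = solve-∀
            perm₃ : ∀ a b c d e → a * (b * (c * d * e)) ≡ a * c * d * (b * e)
            perm₃ = solve-∀

        module GoodLeaves (Y : Vec A (suc b)) (goodL : goodY Y ≡ true) where

          private
            κ = c₄ * (L ^ suc k * L ^ suc b)

          Y-independent : independent Y ≡ true
          Y-independent = proj₁ (∧-true (proj₁ (∧-true {pairGood Y} goodL)))

          -- The codegree bound loses `c₄`, and each vertex of X and each vertex of Y off the mask
          -- loses a factor `L`. The number of the latter is rounded up to `suc b`, which makes `κ`
          -- independent of `u`.
          rest-large : ∀ u → D ^ ones (mask u) * n ≤ κ * (N ^ ones (mask u) * card (rest X Y (mask u)))
          rest-large u = begin
            D ^ ℓ * n                               ≤⟨ codegree ⟩
            c₄ * (N ^ ℓ * card W)                   ≤⟨ *-monoʳ-≤ c₄ (*-monoʳ-≤ (N ^ ℓ) cut-X) ⟩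
            c₄ * (N ^ ℓ * (L ^ suc k * card W₁))
              ≤⟨ *-monoʳ-≤ c₄ (*-monoʳ-≤ (N ^ ℓ) (*-monoʳ-≤ (L ^ suc k)
                   (≤-trans cut-Y (*-monoˡ-≤ (card (rest X Y s)) (^-monoʳ-≤ L zeros≤))))) ⟩
            c₄ * (N ^ ℓ * (L ^ suc k * (L ^ suc b * card (rest X Y s))))
              ≡⟨ perm c₄ (N ^ ℓ) (L ^ suc k) (L ^ suc b) _ ⟩
            κ * (N ^ ℓ * card (rest X Y s)) ∎
            where
            open ≤-Reasoning
            s = mask u
            ℓ = ones s
            W W₁ : A → Bool
            W = common (on s Y)
            W₁ = cuts X W
            perm : ∀ a b c d e → a * (b * (c * (d * e))) ≡ a * (c * d) * (b * e)
            perm = solve-∀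
            zeros≤ : zeros s ≤ suc b
            zeros≤ = ≤-trans (m≤n+m (zeros s) ℓ) (≤-reflexive (ones+zeros s))
            ¬Bad : ∀ i → Bad i X (on s Y) ≡ false
            ¬Bad i = none-true {is = pairs} {bad = badPair} (proj₂ (∧-true {independent Y} (proj₁ (∧-true {pairGood Y} goodL))))
              (∈-cartesianProduct⁺ (∈-allFin u) (∈-allFin i))
            codegree : D ^ ℓ * n ≤ c₄ * (N ^ ℓ * card W)
            codegree = <ᵇ-false (c₄ * (N ^ ℓ * card W)) _ (proj₁ (∨-false {lowCodegree (on s Y)} (¬Bad zero)))
            -- The first power pays for the cuts by X, the second keeps the outcome large enough for
            -- the cuts by Y.
            W-large : L ^ suc k * (L ^ suc b * τ) ≤ card W
            W-large = *-cancelˡ-≤ (c₄ * N ^ ℓ) {{m*n≢0 c₄ _ {{nz₄}} {{m^n≢0 N ℓ}}}} (begin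
              c₄ * N ^ ℓ * (L ^ suc k * (L ^ suc b * τ)) ≡⟨ perm′ c₄ (N ^ ℓ) (L ^ suc k) (L ^ suc b) τ ⟩
              κ * τ * N ^ ℓ                              ≤⟨ *-monoˡ-≤ (N ^ ℓ) (*-monoˡ-≤ τ M-common) ⟩
              M * τ * N ^ ℓ                              ≤⟨ rich ℓ (ones≤d u) ⟩
              D ^ ℓ * n                                  ≤⟨ codegree ⟩
              c₄ * (N ^ ℓ * card W)                      ≡⟨ *-assoc c₄ _ _ ⟨
              c₄ * N ^ ℓ * card W ∎)
              where
              perm′ : ∀ a b c d e → a * b * (c * (d * e)) ≡ a * (c * d) * e * b
              perm′ = solve-∀
            cut-X : card W ≤ L ^ suc k * card W₁
            cut-X = ¬bad⇒large-cuts X W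
              (≤-trans (*-monoʳ-≤ (L ^ suc k) (m≤n*m τ (L ^ suc b) {{m^n≢0 L (suc b)}})) W-large)
              (¬badAt⇒¬badSomewhere X W λ i → proj₂ (∨-false {lowCodegree (on s Y)} (¬Bad i)))
            cut-Y : card W₁ ≤ L ^ zeros s * card (rest X Y s)
            cut-Y = ¬bad⇒large-cuts (off s Y) W₁
              (≤-trans (*-monoˡ-≤ τ (^-monoʳ-≤ L zeros≤))
                (*-cancelˡ-≤ (L ^ suc k) {{m^n≢0 L (suc k)}} (≤-trans W-large cut-X)))
              (none-true {is = allFin m} {bad = badRest} (proj₂ (∧-true {pairGood Y} goodL)) (∈-allFin u))

          rest-trans : ∀ u → transM L m * τ ≤ card (rest X Y (mask u))
          rest-trans u = *-cancelˡ-≤ (κ * N ^ ℓ)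
            {{m*n≢0 κ _ {{m*n≢0 c₄ _ {{nz₄}} {{m*n≢0 (L ^ suc k) _ {{m^n≢0 L (suc k)}} {{m^n≢0 L (suc b)}}}}}} {{m^n≢0 N ℓ}}}} (begin
            κ * N ^ ℓ * (transM L m * τ)   ≡⟨ perm κ (N ^ ℓ) (transM L m) τ ⟩
            κ * transM L m * τ * N ^ ℓ     ≤⟨ *-monoˡ-≤ (N ^ ℓ) (*-monoˡ-≤ τ M-rest) ⟩
            M * τ * N ^ ℓ                  ≤⟨ rich ℓ (ones≤d u) ⟩
            D ^ ℓ * n                      ≤⟨ rest-large u ⟩
            κ * (N ^ ℓ * card (rest X Y (mask u))) ≡⟨ *-assoc κ _ _ ⟨
            κ * N ^ ℓ * card (rest X Y (mask u)) ∎)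
            where
            open ≤-Reasoning
            ℓ = ones (mask u)
            perm : ∀ a b c d → a * b * (c * d) ≡ a * c * d * b
            perm = solve-∀

          ∏rest : ∀ {j} (ss : Vec (Vec Bool (suc b)) j) →
            (∀ u → D ^ ones (lookup ss u) * n ≤ κ * (N ^ ones (lookup ss u) * card (rest X Y (lookup ss u)))) →
            D ^ ∑ᵛ ones ss * n ^ j ≤ κ ^ j * (N ^ ∑ᵛ ones ss * ∏card (Vec.map (rest X Y) ss))
          ∏rest []       h = ≤-refl
          ∏rest {suc j} (s ∷ ss) h = begin
            D ^ (ones s + ∑ᵛ ones ss) * (n * n ^ j)
              ≡⟨ cong (_* (n * n ^ j)) (^-distribˡ-+-* D (ones s) (∑ᵛ ones ss)) ⟩
            D ^ ones s * D ^ ∑ᵛ ones ss * (n * n ^ j)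
              ≡⟨ perm₁ (D ^ ones s) (D ^ ∑ᵛ ones ss) n (n ^ j) ⟩
            D ^ ones s * n * (D ^ ∑ᵛ ones ss * n ^ j)
              ≤⟨ *-mono-≤ (h zero) (∏rest ss λ u → h (suc u)) ⟩
            κ * (N ^ ones s * card (rest X Y s)) * (κ ^ j * (N ^ ∑ᵛ ones ss * ∏card (Vec.map (rest X Y) ss)))
              ≡⟨ perm₂ κ (N ^ ones s) (card (rest X Y s)) (κ ^ j) (N ^ ∑ᵛ ones ss) _ ⟩
            κ * κ ^ j * (N ^ ones s * N ^ ∑ᵛ ones ss * (card (rest X Y s) * ∏card (Vec.map (rest X Y) ss)))
              ≡⟨ cong (λ e → κ * κ ^ j * (e * (card (rest X Y s) * ∏card (Vec.map (rest X Y) ss)))) (^-distribˡ-+-* N (ones s) (∑ᵛ ones ss)) ⟨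
            κ ^ suc j * (N ^ (ones s + ∑ᵛ ones ss) * (card (rest X Y s) * ∏card (Vec.map (rest X Y) ss))) ∎
            where
            open ≤-Reasoning
            perm₁ : ∀ a b c d → a * b * (c * d) ≡ a * c * (b * d)
            perm₁ = solve-∀
            perm₂ : ∀ a b c d e f → a * (b * c) * (d * (e * f)) ≡ a * d * (b * e * (c * f))
            perm₂ = solve-∀

          many-rests : D ^ ∑ᵛ ones masks * n ^ m ≤ κ ^ m * transK L m * (N ^ ∑ᵛ ones masks * #transversals (rests X Y))
          many-rests = begin
            D ^ ∑ᵛ ones masks * n ^ m
              ≤⟨ ∏rest masks rest-large ⟩
            κ ^ m * (N ^ ∑ᵛ ones masks * ∏card (rests X Y))
              ≤⟨ *-monoʳ-≤ (κ ^ m) (*-monoʳ-≤ (N ^ ∑ᵛ ones masks) (many-transversals (rests X Y) λ u →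
                   subst (λ W → transM L m * τ ≤ card W) (sym (lookup-map u (rest X Y) masks)) (rest-trans u))) ⟩
            κ ^ m * (N ^ ∑ᵛ ones masks * (transK L m * #transversals (rests X Y)))
              ≡⟨ perm (κ ^ m) (N ^ ∑ᵛ ones masks) (transK L m) _ ⟩
            κ ^ m * transK L m * (N ^ ∑ᵛ ones masks * #transversals (rests X Y)) ∎
            where
            open ≤-Reasoning
            perm : ∀ a b c d → a * (b * (c * d)) ≡ a * c * (b * d)
            perm = solve-∀

      -- One factor `D ^ suc k * n` is spent on the total weight (`first`). The other `b` bound the
      -- same number of factors f(X) from below by `F-large`; the last factor of f(X)ᵇ⁺¹ is the
      -- weight, recovered by `goodX-weight` (`second`).
      many-configurations-cleared :
        (D ^ suc k * n) ^ suc b * n ^ suc k * (D ^ ∑ᵛ ones masks * n ^ m) ≤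
        2 ^ suc k * (2 * (2 * (2 * transK L (suc k))) * (c₂ ^ b * (2 * (2 * transK L (suc b)) *
          ((c₄ * (L ^ suc k * L ^ suc b)) ^ m * transK L m)))) *
        ((N ^ suc k) ^ suc b * (N ^ ∑ᵛ ones masks * #configurations))
      many-configurations-cleared = begin
        E * E ^ b * n ^ suc k * R
          ≡⟨ perm₁ E (E ^ b) (n ^ suc k) R ⟩
        E ^ b * R * (E * n ^ suc k)
          ≤⟨ *-monoʳ-≤ (E ^ b * R) first ⟩
        E ^ b * R * (2 ^ suc k * (Nk * T (suc k)))
          ≡⟨ perm₂ (E ^ b * R) (2 ^ suc k) Nk (T (suc k)) ⟩
        2 ^ suc k * (Nk * (E ^ b * R * T (suc k)))
          ≤⟨ *-monoʳ-≤ (2 ^ suc k) (*-monoʳ-≤ Nk second) ⟩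
        2 ^ suc k * (Nk * (K₃ * ((c₂ * Nk) ^ b * (K₂ * (κ * (N ^ σ * #configurations))))))
          ≡⟨ cong (λ e → 2 ^ suc k * (Nk * (K₃ * (e * (K₂ * (κ * (N ^ σ * #configurations))))))) (^-distribʳ-* b c₂ Nk) ⟩
        2 ^ suc k * (Nk * (K₃ * (c₂ ^ b * Nk ^ b * (K₂ * (κ * (N ^ σ * #configurations))))))
          ≡⟨ perm₃ (2 ^ suc k) Nk K₃ (c₂ ^ b) (Nk ^ b) K₂ κ (N ^ σ * #configurations) ⟩
        2 ^ suc k * (K₃ * (c₂ ^ b * (K₂ * κ))) * (Nk * Nk ^ b * (N ^ σ * #configurations)) ∎
        where
        open ≤-Reasoning
        σ = ∑ᵛ ones masks
        E = D ^ suc k * n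
        R = D ^ σ * n ^ m
        Nk = N ^ suc k
        K₃ = 2 * (2 * (2 * transK L (suc k)))
        K₂ = 2 * (2 * transK L (suc b))
        κ = (c₄ * (L ^ suc k * L ^ suc b)) ^ m * transK L m
        perm₁ : ∀ a b c d → a * b * c * d ≡ b * d * (a * c)
        perm₁ = solve-∀
        perm₂ : ∀ a b c d → a * (b * (c * d)) ≡ b * (c * (a * d))
        perm₂ = solve-∀
        perm₃ : ∀ a b c d e f g h → a * (b * (c * (d * e * (f * (g * h))))) ≡ a * (c * (d * (f * g))) * (b * e * h)
        perm₃ = solve-∀
        first : E * n ^ suc k ≤ 2 ^ suc k * (Nk * T (suc k))
        first = begin
          D ^ suc k * n * n ^ suc k  ≤⟨ *-monoˡ-≤ (n ^ suc k) (*-monoˡ-≤ n (T-lower k)) ⟩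
          2 ^ suc k * (n ^ k * T (suc k)) * n * n ^ suc k
            ≡⟨ perm (2 ^ suc k) (n ^ k) (T (suc k)) n ⟩
          2 ^ suc k * (n ^ suc k * n ^ suc k * T (suc k))
            ≡⟨ cong (λ e → 2 ^ suc k * (e * T (suc k))) (^-distribʳ-* (suc k) n n) ⟨
          2 ^ suc k * (Nk * T (suc k)) ∎
          where
          perm : ∀ a b c d → a * (b * c) * d * (d * b) ≡ a * (d * b * (d * b) * c)
          perm = solve-∀
        leaves : ∀ X → goodX X ≡ true →
          f X ^ suc b * R ≤ K₂ * (κ * (N ^ σ * ∑[ Y ∈ tuples (suc b) ] ([ core X Y ] * #transversals (rests X Y))))
        leaves X good = begin
          f X ^ suc b * R
            ≤⟨ *-monoˡ-≤ R many-goodY ⟩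
          K₂ * ∑[ Y ∈ tuples (suc b) ] ([ goodY Y ] * [ every (nbhd X) Y ]) * R
            ≡⟨ trans (*-assoc K₂ _ R) (cong (K₂ *_) (sym (∑-*ʳ R (tuples (suc b)) _))) ⟩
          K₂ * ∑[ Y ∈ tuples (suc b) ] ([ goodY Y ] * [ every (nbhd X) Y ] * R)
            ≤⟨ *-monoʳ-≤ K₂ (∑-mono (tuples (suc b)) pointwise) ⟩
          K₂ * ∑[ Y ∈ tuples (suc b) ] (κ * N ^ σ * ([ core X Y ] * #transversals (rests X Y)))
            ≡⟨ cong (K₂ *_) (trans (∑-*ˡ (κ * N ^ σ) (tuples (suc b)) _) (*-assoc κ (N ^ σ) _)) ⟩
          K₂ * (κ * (N ^ σ * ∑[ Y ∈ tuples (suc b) ] ([ core X Y ] * #transversals (rests X Y)))) ∎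
          where
          open GoodCentres X good
          pointwise : ∀ Y → [ goodY Y ] * [ every (nbhd X) Y ] * R ≤ κ * N ^ σ * ([ core X Y ] * #transversals (rests X Y))
          pointwise Y = ≤-trans (≤-reflexive (*-assoc [ goodY Y ] _ R)) ([]*≤ (goodY Y) λ goodL → []*≤ (every (nbhd X) Y) λ Y⊆ →
            ≤-trans (GoodLeaves.many-rests Y goodL) (≤-reflexive (trans (sym (*-assoc κ (N ^ σ) _))
              (cong (κ * N ^ σ *_) (trans (sym (+-identityʳ _)) (cong (λ e → [ e ] * #transversals (rests X Y))
                (sym (cong₂ _∧_ X-independent (cong₂ _∧_ (GoodLeaves.Y-independent Y goodL)
                  (every-mono (λ v h → proj₂ (∧-true {highDegree v} h)) Y Y⊆))))))))))
        second : E ^ b * R * T (suc k) ≤ K₃ * ((c₂ * Nk) ^ b * (K₂ * (κ * (N ^ σ * #configurations))))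
        second = begin
          E ^ b * R * T (suc k)
            ≤⟨ *-monoʳ-≤ (E ^ b * R) goodX-weight ⟩
          E ^ b * R * (K₃ * ∑[ X ∈ tuples (suc k) ] ([ goodX X ] * f X))
            ≡⟨ swap (E ^ b * R) K₃ _ ⟩
          K₃ * (E ^ b * R * ∑[ X ∈ tuples (suc k) ] ([ goodX X ] * f X))
            ≡⟨ cong (K₃ *_) (∑-*ˡ (E ^ b * R) (tuples (suc k)) _) ⟨
          K₃ * ∑[ X ∈ tuples (suc k) ] (E ^ b * R * ([ goodX X ] * f X))
            ≤⟨ *-monoʳ-≤ K₃ (∑-mono (tuples (suc k)) pointwise) ⟩
          K₃ * ∑[ X ∈ tuples (suc k) ] ((c₂ * Nk) ^ b * (K₂ * (κ * (N ^ σ * s X))))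
            ≡⟨ cong (K₃ *_) (trans (∑-*ˡ ((c₂ * Nk) ^ b) (tuples (suc k)) _) (cong ((c₂ * Nk) ^ b *_)
                 (trans (∑-*ˡ K₂ (tuples (suc k)) _) (cong (K₂ *_) (trans (∑-*ˡ κ (tuples (suc k)) _)
                   (cong (κ *_) (∑-*ˡ (N ^ σ) (tuples (suc k)) s))))))) ⟩
          K₃ * ((c₂ * Nk) ^ b * (K₂ * (κ * (N ^ σ * #configurations)))) ∎
          where
          s : Vec A (suc k) → ℕ
          s X = ∑[ Y ∈ tuples (suc b) ] ([ core X Y ] * #transversals (rests X Y))
          swap : ∀ a b c → a * (b * c) ≡ b * (a * c)
          swap = solve-∀
          pointwise : ∀ X → E ^ b * R * ([ goodX X ] * f X) ≤ (c₂ * Nk) ^ b * (K₂ * (κ * (N ^ σ * s X)))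
          pointwise X = ≤-trans (≤-reflexive (swap (E ^ b * R) [ goodX X ] (f X))) ([]*≤ (goodX X) λ good → begin
            E ^ b * R * f X
              ≤⟨ *-monoˡ-≤ (f X) (*-monoˡ-≤ R (^-monoˡ-≤ b (GoodCentres.F-large X good))) ⟩
            (c₂ * (Nk * f X)) ^ b * R * f X
              ≡⟨ cong (λ e → e * R * f X) (trans (cong (_^ b) (sym (*-assoc c₂ Nk (f X)))) (^-distribʳ-* b (c₂ * Nk) (f X))) ⟩
            (c₂ * Nk) ^ b * f X ^ b * R * f X
              ≡⟨ perm ((c₂ * Nk) ^ b) (f X ^ b) R (f X) ⟩
            (c₂ * Nk) ^ b * (f X ^ suc b * R)
              ≤⟨ *-monoʳ-≤ ((c₂ * Nk) ^ b) (leaves X good) ⟩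
            (c₂ * Nk) ^ b * (K₂ * (κ * (N ^ σ * s X))) ∎)
            where
            perm : ∀ a b c d → a * b * c * d ≡ a * (d * b * c)
            perm = solve-∀

  -- The configuration bound with uniform constants.

  D≤N : ∀ {A : Set} (V : List A) g → Weights.D V g ≤ Weights.N V g
  D≤N V g = ∑-≤-const V λ v → ≤-trans (∑-≤-const V λ x → []≤1 (g x v)) (≤-reflexive (*-identityʳ _))

  -- As q ≤ 1, lowering the exponent only increases qʲn.
  rich-below : ∀ {A : Set} (V : List A) .{{_ : NonZero (length V)}} g d C → let open Weights V g in
    C * N ^ d ≤ D ^ d * n → ∀ j → j ≤ d → C * N ^ j ≤ D ^ j * n
  rich-below V g d C rich j j≤d = *-cancelʳ-≤ _ _ (N ^ (d ∸ j)) {{m^n≢0 N (d ∸ j) {{m*n≢0 n n}}}} (begin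
    C * N ^ j * N ^ (d ∸ j)      ≡⟨ trans (*-assoc C _ _) (cong (C *_) (split N)) ⟩
    C * N ^ d                    ≤⟨ rich ⟩
    D ^ d * n                    ≡⟨ cong (_* n) (split D) ⟨
    D ^ j * D ^ (d ∸ j) * n      ≤⟨ *-monoˡ-≤ n (*-monoʳ-≤ (D ^ j) (^-monoˡ-≤ (d ∸ j) (D≤N V g))) ⟩
    D ^ j * N ^ (d ∸ j) * n      ≡⟨ perm (D ^ j) (N ^ (d ∸ j)) n ⟩
    D ^ j * n * N ^ (d ∸ j) ∎)
    where
    open ≤-Reasoning
    open Weights V g
    split : ∀ x → x ^ j * x ^ (d ∸ j) ≡ x ^ d
    split x = trans (sym (^-distribˡ-+-* x j (d ∸ j))) (cong (x ^_) (m+[n∸m]≡n j≤d))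
    perm : ∀ a b c → a * b * c ≡ a * c * b
    perm = solve-∀

  -- The host and the masks are quantified inside, so that `K` and `M` cannot depend on them.
  ConfigurationBound : (L d k b m : ℕ) .{{_ : NonZero L}} (K M : ℕ) → Set₁
  ConfigurationBound L d k b m K M = ∀ {A : Set} (V : List A) .{{_ : NonZero (length V)}} (g r : A → A → Bool)
    (masks : Vec (Vec Bool b) m) τ .{{_ : NonZero τ}} →
    (∀ W → Tuples.card V (Cutting.bad V r L τ W) ≤ τ) →
    (∀ u → ones (lookup masks u) ≤ d) →
    let open Weights V g
        open Configurations V g r {k} masks L τ in
    M * τ * N ^ d ≤ D ^ d * n →
    D ^ (k * b + ∑ᵛ ones masks) * n ^ (k + b + m)
      ≤ K * (N ^ (k * b + ∑ᵛ ones masks) * #configurations)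

  many-configurations : ∀ L .{{_ : NonZero L}} d k b m → 1 ≤ k → k ≤ d → (b ≡ 0 → m ≡ 0) →
    ∃₂ (ConfigurationBound L d k b m)
  -- With B empty no power of f(X) is left to act as weight; the pattern is then an edgeless graph
  -- on `suc k` vertices, and independent tuples suffice.
  many-configurations L d (suc k) zero m _ k<d m≡0 with refl ← m≡0 refl = transK L (suc k) , transM L (suc k) , main
    where
    main : ConfigurationBound L d (suc k) 0 0 (transK L (suc k)) (transM L (suc k))
    main V g r [] τ few-bad _ rich = begin
      D ^ (suc k * 0 + 0) * n ^ (suc k + 0 + 0)
        ≡⟨ cong₂ (λ i j → D ^ i * n ^ j) no-edges (trans (+-identityʳ (suc k + 0)) (+-identityʳ (suc k))) ⟩
      1 * n ^ suc k      ≡⟨ *-identityˡ (n ^ suc k) ⟩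
      n ^ suc k          ≡⟨ cong (_^ suc k) card-all ⟨
      card (λ _ → true) ^ suc k
        ≤⟨ independent-tuples (suc k) (λ _ → true) large ⟩
      transK L (suc k) * ∑[ X ∈ tuples (suc k) ] ([ independent X ] * [ every (λ _ → true) X ])
        ≤⟨ *-monoʳ-≤ (transK L (suc k)) (∑-mono (tuples (suc k)) pointwise) ⟩
      transK L (suc k) * #configurations
        ≡⟨ cong (transK L (suc k) *_) (trans (cong (λ i → N ^ i * #configurations) no-edges) (+-identityʳ #configurations)) ⟨
      transK L (suc k) * (N ^ (suc k * 0 + 0) * #configurations) ∎
      where
      open ≤-Reasoning
      open Weights V g
      open Transversals V r L τ
      open Many few-bad
      open Configurations V g r {suc k} {0} [] L τ
      no-edges : suc k * 0 + 0 ≡ 0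
      no-edges = trans (+-identityʳ _) (*-zeroʳ (suc k))
      card-all : card (λ _ → true) ≡ n
      card-all = trans (∑-const V 1) (*-identityʳ n)
      large : transM L (suc k) * τ ≤ card (λ _ → true)
      large = begin
        transM L (suc k) * τ         ≡⟨ *-identityʳ _ ⟨
        transM L (suc k) * τ * 1     ≤⟨ rich-below V g d (transM L (suc k) * τ) rich 0 z≤n ⟩
        1 * n                        ≡⟨ *-identityˡ n ⟩
        n                            ≡⟨ card-all ⟨
        card (λ _ → true) ∎
      pointwise : ∀ X → [ independent X ] * [ every (λ _ → true) X ] ≤
        ∑[ Y ∈ tuples 0 ] ([ core X Y ] * #transversals (rests X Y))
      pointwise X with independent X
      ... | false = z≤n
      ... | true  = ≤-trans (≤-reflexive (+-identityʳ _)) ([]≤1 (every (λ _ → true) X))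
  many-configurations L d (suc k) (suc b) m _ k<d _ = K , M , main
    where
    C : Constants L d (suc k) (suc b) m
    C = constants L d (suc k) (suc b) m
    open Constants C using (c₂; c₄; c₄≢0; M; M-cut)
    K = 2 ^ suc k * (2 * (2 * (2 * transK L (suc k))) * (c₂ ^ b * (2 * (2 * transK L (suc b)) *
          ((c₄ * (L ^ suc k * L ^ suc b)) ^ m * transK L m))))
    main : ConfigurationBound L d (suc k) (suc b) m K M
    main V g r masks τ few-bad ones≤d rich = begin
      D ^ (suc k * suc b + σ) * n ^ (suc k + suc b + m)
        ≡⟨ cong₂ _*_ (^-distribˡ-+-* D (suc k * suc b) σ) (trans (^-distribˡ-+-* n (suc k + suc b) m)
             (cong (_* n ^ m) (^-distribˡ-+-* n (suc k) (suc b)))) ⟩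
      D ^ (suc k * suc b) * D ^ σ * (n ^ suc k * n ^ suc b * n ^ m)
        ≡⟨ cong (λ e → e * D ^ σ * (n ^ suc k * n ^ suc b * n ^ m)) (^-*-assoc D (suc k) (suc b)) ⟨
      (D ^ suc k) ^ suc b * D ^ σ * (n ^ suc k * n ^ suc b * n ^ m)
        ≡⟨ perm ((D ^ suc k) ^ suc b) (D ^ σ) (n ^ suc k) (n ^ suc b) (n ^ m) ⟩
      (D ^ suc k) ^ suc b * n ^ suc b * n ^ suc k * (D ^ σ * n ^ m)
        ≡⟨ cong (λ e → e * n ^ suc k * (D ^ σ * n ^ m)) (^-distribʳ-* (suc b) (D ^ suc k) n) ⟨
      (D ^ suc k * n) ^ suc b * n ^ suc k * (D ^ σ * n ^ m)
        ≤⟨ Counting.many-configurations-cleared V g r k b m d masks L τ {{D≢0 = D≢0}} C few-bad k<d ones≤d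
             (rich-below V g d (M * τ) rich) ⟩
      K * ((N ^ suc k) ^ suc b * (N ^ σ * #configurations))
        ≡⟨ cong (K *_) (trans (sym (*-assoc ((N ^ suc k) ^ suc b) (N ^ σ) _)) (cong (λ e → e * N ^ σ * #configurations) (^-*-assoc N (suc k) (suc b)))) ⟩
      K * (N ^ (suc k * suc b) * N ^ σ * #configurations)
        ≡⟨ cong (λ e → K * (e * #configurations)) (^-distribˡ-+-* N (suc k * suc b) σ) ⟨
      K * (N ^ (suc k * suc b + σ) * #configurations) ∎
      where
      open ≤-Reasoning
      open Weights V g
      open Configurations V g r {suc k} masks L τ
      σ = ∑ᵛ ones masks
      perm : ∀ a b c d e → a * b * (c * d * e) ≡ a * d * c * (b * e)
      perm = solve-∀
      -- With `M` nonzero, the richness hypothesis fails for an edgeless host.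
      D≢0 : NonZero D
      D≢0 = ≢-nonZero λ D≡0 → contradiction (begin-strict
        0                  <⟨ >-nonZero⁻¹ (M * τ * N ^ 1) {{m*n≢0 (M * τ) (N ^ 1) {{m*n≢0 M τ {{M≢0}}}} {{m^n≢0 N 1 {{m*n≢0 n n}}}}}} ⟩
        M * τ * N ^ 1      ≤⟨ rich-below V g d (M * τ) rich 1 (≤-trans (s≤s z≤n) k<d) ⟩
        D * 1 * n          ≡⟨ cong (λ e → e * 1 * n) D≡0 ⟩
        0 ∎) (<-irrefl refl)
        where
        M≢0 : NonZero M
        M≢0 = >-nonZero (≤-trans (>-nonZero⁻¹ c₄ {{c₄≢0}}) M-cut)

-- From rational inequalities to natural ones and back.

module Fractions where

  open import Defs
  open import Data.Integer as ℤ using (+_; +[1+_]; -[1+_])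
  import Data.Integer.Properties as ℤₚ
  open import Data.Nat as ℕ using (zero; suc; NonZero)
  import Data.Nat.Coprimality as Coprime
  import Data.Nat.Properties as ℕₚ
  open import Data.Product using (∃₂; _,_)
  open import Data.Rational as ℚ using (mkℚ; 0ℚ; 1ℚ; _/_; *≤*; *<*; toℚᵘ; ↥_; ↧ₙ_)
  import Data.Rational.Properties as ℚₚ
  open import Data.Rational.Solver using (module +-*-Solver)
  open import Data.Rational.Unnormalised as ℚᵘ using (mkℚᵘ; *≡*)
  import Data.Rational.Unnormalised.Properties as ℚᵘₚ
  open import Relation.Binary.PropositionalEquality using (_≡_; refl; sym; trans; cong; cong₂; subst₂)

  /1-normal : ∀ m → m /1 ≡ mkℚ (+ m) 0 (Coprime.sym (Coprime.1-coprimeTo m))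
  /1-normal m = ℚₚ.normalize-coprime (Coprime.sym (Coprime.1-coprimeTo m))

  /1-+ : ∀ m n → (m ℕ.+ n) /1 ≡ m /1 ℚ.+ n /1
  /1-+ m n rewrite /1-normal m | /1-normal n =
    cong (_/ 1) (sym (cong₂ ℤ._+_ (ℤₚ.*-identityʳ (+ m)) (ℤₚ.*-identityʳ (+ n))))

  /1-* : ∀ m n → (m ℕ.* n) /1 ≡ m /1 ℚ.* n /1
  /1-* m n rewrite /1-normal m | /1-normal n = cong (_/ 1) (ℤₚ.pos-* m n)

  /1-^ : ∀ m k → (m ℕ.^ k) /1 ≡ m /1 ^ℚ k
  /1-^ m zero    = refl
  /1-^ m (suc k) = trans (/1-* m (m ℕ.^ k)) (cong (m /1 ℚ.*_) (/1-^ m k))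

  /1-mono-≤ : ∀ {m n} → m ℕ.≤ n → m /1 ℚ.≤ n /1
  /1-mono-≤ {m} {n} m≤n rewrite /1-normal m | /1-normal n =
    *≤* (subst₂ ℤ._≤_ (sym (ℤₚ.*-identityʳ (+ m))) (sym (ℤₚ.*-identityʳ (+ n))) (ℤ.+≤+ m≤n))

  /1-cancel-≤ : ∀ {m n} → m /1 ℚ.≤ n /1 → m ℕ.≤ n
  /1-cancel-≤ {m} {n} m≤n rewrite /1-normal m | /1-normal n =
    ℤₚ.drop‿+≤+ (subst₂ ℤ._≤_ (ℤₚ.*-identityʳ (+ m)) (ℤₚ.*-identityʳ (+ n)) (ℚₚ.drop-*≤* m≤n))

  /1-nonNegative : ∀ m → ℚ.NonNegative (m /1)
  /1-nonNegative m rewrite /1-normal m = _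

  /1-positive : ∀ m .{{_ : NonZero m}} → ℚ.Positive (m /1)
  /1-positive (suc m) rewrite /1-normal (suc m) = _

  /-*-cancel : ∀ i b .{{_ : NonZero b}} → (i / b) ℚ.* b /1 ≡ i / 1
  /-*-cancel i b@(suc b-1) = ℚₚ.toℚᵘ-injective (begin
    toℚᵘ ((i / b) ℚ.* b /1)             ≈⟨ ℚₚ.toℚᵘ-homo-* (i / b) (b /1) ⟩
    toℚᵘ (i / b) ℚᵘ.* toℚᵘ (b /1)       ≈⟨ ℚᵘₚ.*-cong (ℚₚ.toℚᵘ-fromℚᵘ (mkℚᵘ i b-1)) (ℚₚ.toℚᵘ-fromℚᵘ (mkℚᵘ (+ b) 0)) ⟩
    mkℚᵘ i b-1 ℚᵘ.* mkℚᵘ (+ b) 0        ≈⟨ *≡* (trans (ℤₚ.*-identityʳ (i ℤ.* + b)) (cong (λ s → i ℤ.* + s) (sym (ℕₚ.*-identityʳ b)))) ⟩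
    mkℚᵘ i 0                            ≈⟨ ℚₚ.toℚᵘ-fromℚᵘ (mkℚᵘ i 0) ⟨
    toℚᵘ (i / 1) ∎)
    where open ℚᵘₚ.≃-Reasoning

  *-denominator : ∀ p → p ℚ.* (↧ₙ p) /1 ≡ ↥ p / 1
  *-denominator p = trans (cong (ℚ._* (↧ₙ p) /1) (sym (ℚₚ.↥p/↧p≡p p))) (/-*-cancel (↥ p) (↧ₙ p))

  positive-fraction : ∀ p → 0ℚ ℚ.< p →
    ∃₂ λ a b → p ℚ.* suc b /1 ≡ suc a /1
  positive-fraction p@(mkℚ +[1+ a ] b _) _ = a , b , *-denominator p
  positive-fraction (mkℚ (+ 0) b _) (*<* (ℤ.+<+ ()))
  positive-fraction (mkℚ -[1+ a ] b _) (*<* ())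

  scale-≤ : ∀ {x y} d .{{_ : NonZero d}} → x ℚ.* d /1 ℚ.≤ y ℚ.* d /1 → x ℚ.≤ y
  scale-≤ d = ℚₚ.*-cancelʳ-≤-pos (d /1) {{/1-positive d}}

  -- The rational `c` is weakened to 2 / `L`: twice the proportion 1 / `L` of non-neighbours that
  -- defines `bad`, which leaves room for a contradiction.
  sparse-cleared : ∀ {c e x L} → 2 /1 ℚ.≤ c ℚ.* L /1 → e /1 ℚ.≤ (1ℚ ℚ.- c) ℚ.* x /1 →
    L ℕ.* e ℕ.+ 2 ℕ.* x ℕ.≤ L ℕ.* x
  sparse-cleared {c} {e} {x} {L} 2≤cL e≤ = /1-cancel-≤ (begin
    (L ℕ.* e ℕ.+ 2 ℕ.* x) /1
      ≡⟨ trans (/1-+ (L ℕ.* e) (2 ℕ.* x)) (cong₂ ℚ._+_ (/1-* L e) (/1-* 2 x)) ⟩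
    L /1 ℚ.* e /1 ℚ.+ 2 /1 ℚ.* x /1
      ≤⟨ ℚₚ.+-mono-≤ (ℚₚ.*-monoˡ-≤-nonNeg (L /1) {{/1-nonNegative L}} e≤)
                     (ℚₚ.*-monoʳ-≤-nonNeg (x /1) {{/1-nonNegative x}} 2≤cL) ⟩
    L /1 ℚ.* ((1ℚ ℚ.- c) ℚ.* x /1) ℚ.+ c ℚ.* L /1 ℚ.* x /1
      ≡⟨ solve 3 (λ l c x → l :* ((con 1ℚ :- c) :* x) :+ c :* l :* x := l :* x) refl (L /1) c (x /1) ⟩
    L /1 ℚ.* x /1
      ≡⟨ /1-* L x ⟨
    (L ℕ.* x) /1 ∎)
    where
    open ℚₚ.≤-Reasoning
    open +-*-Solver

  ^ℚ-distrib-* : ∀ p q k → (p ℚ.* q) ^ℚ k ≡ (p ^ℚ k) ℚ.* (q ^ℚ k)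
  ^ℚ-distrib-* p q zero    = refl
  ^ℚ-distrib-* p q (suc k) = trans (cong (p ℚ.* q ℚ.*_) (^ℚ-distrib-* p q k))
    (solve 4 (λ p q a b → p :* q :* (a :* b) := p :* a :* (q :* b)) refl p q (p ^ℚ k) (q ^ℚ k))
    where open +-*-Solver

  -- Multiplication by `suc K * N ^ e` clears both fractions, that of α and that of q.
  count-bound : ∀ D N n h e l K .{{_ : NonZero N}} → D ℕ.^ e ℕ.* n ℕ.^ h ℕ.≤ suc K ℕ.* (N ℕ.^ e ℕ.* l) →
    (+ 1 / suc K) ℚ.* ((+ D / N) ^ℚ e) ℚ.* (n /1 ^ℚ h) ℚ.≤ l /1
  count-bound D N n h e l K le =
    scale-≤ (suc K ℕ.* N ℕ.^ e) {{ℕₚ.m*n≢0 (suc K) (N ℕ.^ e) {{_}} {{ℕₚ.m^n≢0 N e}}}} (begin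
      α ℚ.* (q ^ℚ e) ℚ.* (n /1 ^ℚ h) ℚ.* (suc K ℕ.* N ℕ.^ e) /1
        ≡⟨ cong (α ℚ.* (q ^ℚ e) ℚ.* (n /1 ^ℚ h) ℚ.*_) (trans (/1-* (suc K) (N ℕ.^ e)) (cong (suc K /1 ℚ.*_) (/1-^ N e))) ⟩
      α ℚ.* (q ^ℚ e) ℚ.* (n /1 ^ℚ h) ℚ.* (suc K /1 ℚ.* (N /1 ^ℚ e))
        ≡⟨ solve 5 (λ a b c d e → a :* b :* c :* (d :* e) := a :* d :* (b :* e) :* c) refl
             α (q ^ℚ e) (n /1 ^ℚ h) (suc K /1) (N /1 ^ℚ e) ⟩
      α ℚ.* suc K /1 ℚ.* ((q ^ℚ e) ℚ.* (N /1 ^ℚ e)) ℚ.* (n /1 ^ℚ h)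
        ≡⟨ cong₂ (λ x y → x ℚ.* y ℚ.* (n /1 ^ℚ h)) (/-*-cancel (+ 1) (suc K))
             (trans (sym (^ℚ-distrib-* q (N /1) e)) (cong (_^ℚ e) (/-*-cancel (+ D) N))) ⟩
      1ℚ ℚ.* (D /1 ^ℚ e) ℚ.* (n /1 ^ℚ h)
        ≡⟨ cong₂ ℚ._*_ (ℚₚ.*-identityˡ (D /1 ^ℚ e)) refl ⟩
      (D /1 ^ℚ e) ℚ.* (n /1 ^ℚ h)
        ≡⟨ trans (/1-* (D ℕ.^ e) (n ℕ.^ h)) (cong₂ ℚ._*_ (/1-^ D e) (/1-^ n h)) ⟨
      (D ℕ.^ e ℕ.* n ℕ.^ h) /1
        ≤⟨ /1-mono-≤ le ⟩
      (suc K ℕ.* (N ℕ.^ e ℕ.* l)) /1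
        ≡⟨ cong _/1 (trans (sym (ℕₚ.*-assoc (suc K) (N ℕ.^ e) l)) (ℕₚ.*-comm (suc K ℕ.* N ℕ.^ e) l)) ⟩
      (l ℕ.* (suc K ℕ.* N ℕ.^ e)) /1
        ≡⟨ /1-* l (suc K ℕ.* N ℕ.^ e) ⟩
      l /1 ℚ.* (suc K ℕ.* N ℕ.^ e) /1 ∎)
    where
    open ℚₚ.≤-Reasoning
    open +-*-Solver
    α = + 1 / suc K
    q = + D / N

  many-edges-cleared : ∀ {n d} C t a b (G : Graph n) → t ℚ.* suc b /1 ≡ suc a /1 →
    ManyEdges d (C /1) t G →
    C ℕ.^ d ℕ.* suc a ℕ.* n ℕ.^ (2 ℕ.* d ℕ.∸ 1) ℕ.≤ Graph.size G ℕ.^ d ℕ.* suc b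
  many-edges-cleared {n} {d} C t a b G t≡ many = /1-cancel-≤ (begin
    (C ℕ.^ d ℕ.* suc a ℕ.* n ℕ.^ j) /1
      ≡⟨ trans (/1-* (C ℕ.^ d ℕ.* suc a) (n ℕ.^ j)) (cong₂ ℚ._*_ (trans (/1-* (C ℕ.^ d) (suc a))
           (cong₂ ℚ._*_ (/1-^ C d) (sym t≡))) (/1-^ n j)) ⟩
    (C /1 ^ℚ d) ℚ.* (t ℚ.* suc b /1) ℚ.* (n /1 ^ℚ j)
      ≡⟨ solve 4 (λ c t b m → c :* (t :* b) :* m := c :* t :* m :* b) refl (C /1 ^ℚ d) t (suc b /1) (n /1 ^ℚ j) ⟩
    (C /1 ^ℚ d) ℚ.* t ℚ.* (n /1 ^ℚ j) ℚ.* suc b /1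
      ≤⟨ ℚₚ.*-monoʳ-≤-nonNeg (suc b /1) {{/1-nonNegative (suc b)}} many ⟩
    (Graph.size G /1 ^ℚ d) ℚ.* suc b /1
      ≡⟨ trans (/1-* (Graph.size G ℕ.^ d) (suc b)) (cong (ℚ._* suc b /1) (/1-^ (Graph.size G) d)) ⟨
    (Graph.size G ℕ.^ d ℕ.* suc b) /1 ∎)
    where
    open ℚₚ.≤-Reasoning
    open +-*-Solver
    j = 2 ℕ.* d ℕ.∸ 1

module Copies where

  open Combinatorics
  open Fractions
  open import Defs
  open import Data.Bool using (Bool; true; false; _∧_; _∨_; not)
  open import Data.Empty using (⊥)
  open import Data.Fin using (Fin; zero; suc; _<?_)
  import Data.Fin.Properties as Finₚ
  open import Data.Fin.Subset as Subset using (Subset; ∣_∣; ⁅_⁆)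
  open import Data.Fin.Subset.Properties using (_∈?_; ∣⁅x⁆∣≡1; x∈⁅x⁆)
  import Data.Integer as ℤ
  open import Data.List using (List; []; _∷_; length; map; allFin; cartesianProduct; filter)
  open import Data.List.Membership.Propositional using (_∈_)
  open import Data.List.Membership.Propositional.Properties using (∈-allFin; ∈-length; ∈-filter⁺; ∈-cartesianProduct⁺)
  import Data.List.Properties as Listₚ
  open import Data.List.Relation.Unary.All using (All; []; _∷_)
  open import Data.List.Relation.Unary.AllPairs using (AllPairs; []; _∷_)
  open import Data.List.Relation.Unary.Any using (here; there)
  open import Data.Nat
    using (ℕ; zero; suc; _+_; _*_; _^_; _∸_; _/_; _≤_; _<_; z≤n; s≤s; _≤ᵇ_; NonZero; ≢-nonZero; ≢-nonZero⁻¹; >-nonZero; >-nonZero⁻¹)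
  import Data.Nat.DivMod as DivMod
  open import Data.Nat.Properties hiding (_<?_)
  open import Data.Nat.Tactic.RingSolver using (solve-∀)
  open import Data.Product using (∃; _×_; _,_; proj₁; proj₂)
  open import Data.Rational as ℚ using (ℚ)
  import Data.Rational.Properties as ℚₚ
  open import Data.Vec as Vec using (Vec; []; _∷_; lookup; tabulate)
  open import Data.Vec.Properties using (lookup∘tabulate; lookup⇒[]=; []=⇒lookup; lookup-map; lookup-allFin)
  open import Function using (Equivalence; mk⇔)
  open import Function.Definitions using (Injective)
  open import Relation.Binary.Definitions using (tri<; tri≈; tri>)
  open import Relation.Binary.PropositionalEquality using (_≡_; _≢_; refl; sym; trans; cong; cong₂; subst; subst₂)
  open import Relation.Nullary using (Dec; does; yes; no; contradiction; _×-dec_; _→-dec_; ¬_)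
  open import Relation.Nullary.Decidable using (dec-true; dec-false)

  -- Graph parameters as sums of indicators.

  ∑-filter : ∀ {A : Set} {P : A → Set} (P? : ∀ x → Dec (P x)) xs →
    length (filter P? xs) ≡ ∑[ x ∈ xs ] [ does (P? x) ]
  ∑-filter P? []       = refl
  ∑-filter P? (x ∷ xs) with does (P? x)
  ... | false = ∑-filter P? xs
  ... | true  = cong suc (∑-filter P? xs)

  ∑-cartesianProduct : ∀ {A B : Set} (xs : List A) (ys : List B) f →
    ∑ (cartesianProduct xs ys) f ≡ ∑[ x ∈ xs ] ∑[ y ∈ ys ] f (x , y)
  ∑-cartesianProduct []       ys f = refl
  ∑-cartesianProduct (x ∷ xs) ys f =
    trans (∑-++ (map (x ,_) ys) _ f) (cong₂ _+_ (∑-map (x ,_) ys f) (∑-cartesianProduct xs ys f))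

  ∑-allFin-suc : ∀ n (f : Fin (suc n) → ℕ) →
    ∑ (allFin (suc n)) f ≡ f zero + ∑[ i ∈ allFin n ] f (suc i)
  ∑-allFin-suc n f = cong (f zero +_)
    (trans (cong (λ xs → ∑ xs f) (sym (Listₚ.map-tabulate (λ i → i) suc))) (∑-map suc (allFin n) f))

  ∑-at-most-one : ∀ {n} (x : Fin n) → ∑[ y ∈ allFin n ] [ does (x Finₚ.≟ y) ] ≤ 1
  ∑-at-most-one {suc n} zero = ≤-reflexive (trans (∑-allFin-suc n (λ y → [ does (zero Finₚ.≟ y) ]))
    (cong suc (∑-0 (allFin n))))
  ∑-at-most-one {suc n} (suc x) = ≤-trans (≤-reflexive (∑-allFin-suc n (λ y → [ does (suc x Finₚ.≟ y) ]))) (∑-at-most-one x)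

  ∣tabulate∣ : ∀ {n} (W : Fin n → Bool) → ∣ tabulate W ∣ ≡ ∑[ x ∈ allFin n ] [ W x ]
  ∣tabulate∣ {zero}  W = refl
  ∣tabulate∣ {suc n} W rewrite ∑-allFin-suc n (λ x → [ W x ]) | sym (∣tabulate∣ (λ x → W (suc x))) with W zero
  ... | true  = refl
  ... | false = refl

  does-true : ∀ {P : Set} (P? : Dec P) → does P? ≡ true → P
  does-true (yes p) _ = p

  does-false : ∀ {P : Set} (P? : Dec P) → does P? ≡ false → ¬ P
  does-false (no ¬p) _ = ¬p

  module Adjacency {n : ℕ} (G : Graph n) where
    open Graph G hiding (sym)

    adj : Fin n → Fin n → Bool
    adj x y = does (x ~? y)

    adj-sym : ∀ x y → adj x y ≡ adj y x
    adj-sym x y with x ~? y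
    ... | yes x~y = sym (dec-true (y ~? x) (Graph.sym G x~y))
    ... | no  x≁y = sym (dec-false (y ~? x) (λ y~x → x≁y (Graph.sym G y~x)))

    adj-or-eq : Fin n → Fin n → Bool
    adj-or-eq x y = adj x y ∨ does (x Finₚ.≟ y)

    adj-or-eq-sym : ∀ x y → adj-or-eq x y ≡ adj-or-eq y x
    adj-or-eq-sym x y = cong₂ _∨_ (adj-sym x y) eq-sym
      where
      eq-sym : does (x Finₚ.≟ y) ≡ does (y Finₚ.≟ x)
      eq-sym with x Finₚ.≟ y
      ... | yes x≡y = sym (dec-true (y Finₚ.≟ x) (sym x≡y))
      ... | no  x≢y = sym (dec-false (y Finₚ.≟ x) (λ y≡x → x≢y (sym y≡x)))

    size-∑ : size ≡ ∑[ u ∈ allFin n ] ∑[ v ∈ allFin n ] [ does (u <? v) ∧ adj u v ]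
    size-∑ = trans (∑-filter _ (cartesianProduct (allFin n) (allFin n))) (∑-cartesianProduct (allFin n) (allFin n) _)

    -- There are no loops, so exactly one orientation of each edge is increasing. Constant `w` gives
    -- twice the number of edges; for the pattern, `w` selects the orientation from A to B.
    oriented : ∀ (w : Fin n → Fin n → ℕ) →
      ∑[ u ∈ allFin n ] ∑[ v ∈ allFin n ] ([ adj u v ] * w u v) ≡
      ∑[ u ∈ allFin n ] ∑[ v ∈ allFin n ] ([ does (u <? v) ∧ adj u v ] * (w u v + w v u))
    oriented w = begin-equality
      ∑[ u ∈ V ] ∑[ v ∈ V ] ([ adj u v ] * w u v)
        ≡⟨ ∑-cong V (λ u → trans (∑-cong V λ v → pointwise u v)
             (∑-+ V (λ v → s u v * w u v) (λ v → s v u * w u v))) ⟩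
      ∑[ u ∈ V ] (∑[ v ∈ V ] (s u v * w u v) + ∑[ v ∈ V ] (s v u * w u v))
        ≡⟨ ∑-+ V (λ u → ∑[ v ∈ V ] (s u v * w u v)) (λ u → ∑[ v ∈ V ] (s v u * w u v)) ⟩
      ∑[ u ∈ V ] ∑[ v ∈ V ] (s u v * w u v) + ∑[ u ∈ V ] ∑[ v ∈ V ] (s v u * w u v)
        ≡⟨ cong (∑[ u ∈ V ] ∑[ v ∈ V ] (s u v * w u v) +_) (∑-swap V V (λ u v → s v u * w u v)) ⟩
      ∑[ u ∈ V ] ∑[ v ∈ V ] (s u v * w u v) + ∑[ u ∈ V ] ∑[ v ∈ V ] (s u v * w v u)
        ≡⟨ ∑-+ V (λ u → ∑[ v ∈ V ] (s u v * w u v)) (λ u → ∑[ v ∈ V ] (s u v * w v u)) ⟨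
      ∑[ u ∈ V ] (∑[ v ∈ V ] (s u v * w u v) + ∑[ v ∈ V ] (s u v * w v u))
        ≡⟨ ∑-cong V (λ u → trans (∑-cong V λ v → *-distribˡ-+ (s u v) (w u v) (w v u))
             (∑-+ V (λ v → s u v * w u v) (λ v → s u v * w v u))) ⟨
      ∑[ u ∈ V ] ∑[ v ∈ V ] (s u v * (w u v + w v u)) ∎
      where
      open ≤-Reasoning
      V = allFin n
      s : Fin n → Fin n → ℕ
      s u v = [ does (u <? v) ∧ adj u v ]
      pointwise : ∀ u v → [ adj u v ] * w u v ≡
        [ does (u <? v) ∧ adj u v ] * w u v + [ does (v <? u) ∧ adj v u ] * w u v
      pointwise u v rewrite adj-sym v u with adj u v in e | Finₚ.<-cmp u v
      ... | false | tri< u<v _ v≮u rewrite dec-true (u <? v) u<v | dec-false (v <? u) v≮u = refl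
      ... | false | tri≈ u≮v _ v≮u rewrite dec-false (u <? v) u≮v | dec-false (v <? u) v≮u = refl
      ... | false | tri> u≮v _ v<u rewrite dec-false (u <? v) u≮v | dec-true (v <? u) v<u = refl
      ... | true  | tri< u<v _ v≮u rewrite dec-true (u <? v) u<v | dec-false (v <? u) v≮u = sym (+-identityʳ _)
      ... | true  | tri> u≮v _ v<u rewrite dec-false (u <? v) u≮v | dec-true (v <? u) v<u = refl
      ... | true  | tri≈ _ u≡v _ = contradiction (does-true (u ~? v) e) (irrefl u≡v)

    2*size : 2 * size ≡ Weights.D (allFin n) adj
    2*size = begin-equality
      2 * size
        ≡⟨ trans (cong (2 *_) size-∑) (trans (sym (∑-*ˡ 2 V _)) (∑-cong V λ u → trans (sym (∑-*ˡ 2 V _))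
             (∑-cong V λ v → *-comm 2 [ does (u <? v) ∧ adj u v ]))) ⟩
      ∑[ u ∈ V ] ∑[ v ∈ V ] ([ does (u <? v) ∧ adj u v ] * 2)
        ≡⟨ oriented (λ _ _ → 1) ⟨
      ∑[ u ∈ V ] ∑[ v ∈ V ] ([ adj u v ] * 1)
        ≡⟨ ∑-cong V (λ u → ∑-cong V λ v → trans (*-identityʳ _) (cong [_] (adj-sym u v))) ⟩
      Weights.D V adj ∎
      where
      open ≤-Reasoning
      V = allFin n

  -- Sparseness bounds the number of bad vertices.

  module FewBad {n : ℕ} (Γ : Graph n) (L τ : ℕ) (L<τ : L < τ) (t : ℚ) (t≤τ : t ℚ.≤ τ /1)
    (sparse : ∀ A B → t ℚ.≤ ∣ A ∣ /1 → t ℚ.≤ ∣ B ∣ /1 →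
      L * Graph.e Γ A B + 2 * (∣ A ∣ * ∣ B ∣) ≤ L * (∣ A ∣ * ∣ B ∣)) where
    open Graph Γ hiding (sym)
    open Adjacency Γ
    open Cutting (allFin n) adj-or-eq L τ

    private
      V = allFin n

    ∑-adj≤e : ∀ (P W : Fin n → Bool) →
      ∑[ x ∈ V ] ([ P x ] * ∑[ a ∈ V ] ([ W a ] * [ adj x a ])) ≤ e (tabulate P) (tabulate W)
    ∑-adj≤e P W = ≤-trans
      (∑-mono V λ x → ≤-trans (≤-reflexive (sym (∑-*ˡ [ P x ] V _))) (∑-mono V λ a → pointwise x a))
      (≤-reflexive (sym (trans (∑-filter _ (cartesianProduct V V)) (∑-cartesianProduct V V _))))
      where
      member : ∀ (U : Fin n → Bool) x → U x ≡ true → does (x ∈? tabulate U) ≡ true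
      member U x h = dec-true (x ∈? tabulate U) (lookup⇒[]= x (tabulate U) (trans (lookup∘tabulate U x) h))
      bools : ∀ p w d {p′ w′} → (p ≡ true → p′ ≡ true) → (w ≡ true → w′ ≡ true) →
        [ p ] * ([ w ] * [ d ]) ≤ [ p′ ∧ w′ ∧ d ]
      bools false _     _     _ _ = z≤n
      bools true  false _     _ _ = z≤n
      bools true  true  false _ _ = z≤n
      bools true  true  true  p w rewrite p refl | w refl = ≤-refl
      pointwise : ∀ x a → [ P x ] * ([ W a ] * [ adj x a ]) ≤
        [ does (x ∈? tabulate P) ∧ does (a ∈? tabulate W) ∧ adj x a ]
      pointwise x a = bools (P x) (W a) (adj x a) (member P x) (member W a)

    -- The `1` is for `x` itself, which `cut` removes although it is no neighbour of itself.
    card-split : ∀ W x → card W ≤ card (cut x W) + ∑[ a ∈ V ] ([ W a ] * [ adj x a ]) + 1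
    card-split W x = ≤-trans (∑-mono V λ a → bools (W a) (adj x a) (does (x Finₚ.≟ a)))
      (≤-trans (≤-reflexive (trans (∑-+ V (λ a → [ cut x W a ] + [ W a ] * [ adj x a ]) (λ a → [ does (x Finₚ.≟ a) ]))
          (cong (_+ ∑[ a ∈ V ] [ does (x Finₚ.≟ a) ]) (∑-+ V (λ a → [ cut x W a ]) (λ a → [ W a ] * [ adj x a ])))))
        (+-monoʳ-≤ (card (cut x W) + ∑[ a ∈ V ] ([ W a ] * [ adj x a ])) (∑-at-most-one x)))
      where
      bools : ∀ w d q → [ w ] ≤ [ w ∧ not (d ∨ q) ] + [ w ] * [ d ] + [ q ]
      bools false _     _     = z≤n
      bools true  true  _     = s≤s z≤n
      bools true  false true  = ≤-refl
      bools true  false false = ≤-refl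

    -- Each vertex of P has at least w - w/L - 1 neighbours in W, where w is the order of W, so the
    -- density between P and W is at least 1 - 1/L - 1/w. Sparseness allows only 1 - 2/L. This
    -- forces w ≤ L, which is excluded by L < τ ≤ w.
    no-large-bad-set : ∀ W (P : Fin n → Bool) → (∀ x → P x ≡ true → L * card (cut x W) < card W) →
      τ ≤ card W → τ ≤ card P → ⊥
    no-large-bad-set W P P-bad τ≤w τ≤B = <⇒≱ (<-≤-trans L<τ τ≤w) w≤L
      where
      open ≤-Reasoning
      w B E : ℕ
      w = card W
      B = card P
      s : Fin n → ℕ
      s x = ∑[ a ∈ V ] ([ W a ] * [ adj x a ])
      E = ∑[ x ∈ V ] ([ P x ] * s x)
      expand : ∀ l a b → l * (a + b + 1) ≡ l * a + (l * b + l)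
      expand = solve-∀
      distrib : ∀ p w l s → p * (w + (l * s + l)) ≡ (p * w + l * (p * s)) + p * l
      distrib = solve-∀
      perm₁ : ∀ a b → a + b + a ≡ b + 2 * a
      perm₁ = solve-∀
      perm₂ : ∀ a b c → a * (b * c) ≡ b * (a * c)
      perm₂ = solve-∀
      weighted : B * (L * w) ≤ B * w + L * E + B * L
      weighted = begin
        B * (L * w)  ≡⟨ ∑-*ʳ (L * w) V (λ x → [ P x ]) ⟨
        ∑[ x ∈ V ] ([ P x ] * (L * w))
          ≤⟨ ∑-mono V (λ x → []*-mono (P x) (λ h → begin
               L * w                                    ≤⟨ *-monoʳ-≤ L (card-split W x) ⟩
               L * (card (cut x W) + s x + 1)           ≡⟨ expand L (card (cut x W)) (s x) ⟩
               L * card (cut x W) + (L * s x + L)       ≤⟨ +-monoˡ-≤ (L * s x + L) (<⇒≤ (P-bad x h)) ⟩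
               w + (L * s x + L) ∎)) ⟩
        ∑[ x ∈ V ] ([ P x ] * (w + (L * s x + L)))
          ≡⟨ ∑-cong V (λ x → distrib [ P x ] w L (s x)) ⟩
        ∑[ x ∈ V ] (([ P x ] * w + L * ([ P x ] * s x)) + [ P x ] * L)
          ≡⟨ ∑-+ V (λ x → [ P x ] * w + L * ([ P x ] * s x)) (λ x → [ P x ] * L) ⟩
        ∑[ x ∈ V ] ([ P x ] * w + L * ([ P x ] * s x)) + ∑[ x ∈ V ] ([ P x ] * L)
          ≡⟨ cong₂ _+_ (trans (∑-+ V (λ x → [ P x ] * w) (λ x → L * ([ P x ] * s x)))
               (cong₂ _+_ (∑-*ʳ w V (λ x → [ P x ])) (∑-*ˡ L V (λ x → [ P x ] * s x)))) (∑-*ʳ L V (λ x → [ P x ])) ⟩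
        B * w + L * E + B * L ∎
      large : ∀ (U : Fin n → Bool) → τ ≤ card U → t ℚ.≤ ∣ tabulate U ∣ /1
      large U τ≤ = ℚₚ.≤-trans t≤τ (/1-mono-≤ (≤-trans τ≤ (≤-reflexive (sym (∣tabulate∣ U)))))
      cards : ∣ tabulate P ∣ * ∣ tabulate W ∣ ≡ B * w
      cards = cong₂ _*_ (∣tabulate∣ P) (∣tabulate∣ W)
      sparse′ : L * E + 2 * (B * w) ≤ L * (B * w)
      sparse′ = ≤-trans (+-monoˡ-≤ (2 * (B * w)) (*-monoʳ-≤ L (∑-adj≤e P W)))
        (subst (λ y → L * e (tabulate P) (tabulate W) + 2 * y ≤ L * y) cards
          (sparse (tabulate P) (tabulate W) (large P τ≤B) (large W τ≤w)))
      w≤L : w ≤ L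
      w≤L = *-cancelˡ-≤ B {{>-nonZero (≤-trans (≤-<-trans z≤n L<τ) τ≤B)}} (+-cancelˡ-≤ (B * w + L * E) _ _ (begin
        B * w + L * E + B * w   ≡⟨ perm₁ (B * w) (L * E) ⟩
        L * E + 2 * (B * w)     ≤⟨ sparse′ ⟩
        L * (B * w)             ≡⟨ perm₂ L B w ⟩
        B * (L * w)             ≤⟨ weighted ⟩
        B * w + L * E + B * L ∎))

    few-bad : ∀ W → card (bad W) ≤ τ
    few-bad W with τ ≤? card W
    ... | yes τ≤w = ≮⇒≥ λ τ<B → no-large-bad-set W (bad W)
            (λ x h → <ᵇ-true (L * card (cut x W)) (card W) (proj₂ (∧-true {τ ≤ᵇ card W} h))) τ≤w (<⇒≤ τ<B)
    ... | no  τ≰w = ≤-trans (∑-mono V λ x → []-mono (bad W x) false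
            (λ h → contradiction (≤ᵇ-true τ (card W) (proj₁ (∧-true h))) τ≰w)) (≤-trans (≤-reflexive (∑-0 V)) z≤n)

  -- Matching coordinates of a tuple with those of its two parts.

  -- The correspondence is uniform in the element type, so one index serves for embedded vertices,
  -- for rows of the adjacency matrix and for the vector of all indices.
  on-back : ∀ {h} (s : Vec Bool h) (i : Fin (ones s)) →
    ∃ λ u → lookup s u ≡ true × (∀ {B : Set} (xs : Vec B h) → lookup (on s xs) i ≡ lookup xs u)
  on-back (true ∷ s) zero = zero , refl , λ { (x ∷ xs) → refl }
  on-back (true ∷ s) (suc i) with u , e , nat ← on-back s i = suc u , e , λ { (x ∷ xs) → nat xs }
  on-back (false ∷ s) i with u , e , nat ← on-back s i = suc u , e , λ { (x ∷ xs) → nat xs }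

  off-back : ∀ {h} (s : Vec Bool h) (i : Fin (zeros s)) →
    ∃ λ u → lookup s u ≡ false × (∀ {B : Set} (xs : Vec B h) → lookup (off s xs) i ≡ lookup xs u)
  off-back (false ∷ s) zero = zero , refl , λ { (x ∷ xs) → refl }
  off-back (false ∷ s) (suc i) with u , e , nat ← off-back s i = suc u , e , λ { (x ∷ xs) → nat xs }
  off-back (true ∷ s) i with u , e , nat ← off-back s i = suc u , e , λ { (x ∷ xs) → nat xs }

  on-forth : ∀ {h} (s : Vec Bool h) u → lookup s u ≡ true →
    ∃ λ i → ∀ {B : Set} (xs : Vec B h) → lookup (on s xs) i ≡ lookup xs u
  on-forth (true ∷ s) zero e = zero , λ { (x ∷ xs) → refl }
  on-forth (true ∷ s) (suc u) e with i , nat ← on-forth s u e = suc i , λ { (x ∷ xs) → nat xs }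
  on-forth (false ∷ s) (suc u) e with i , nat ← on-forth s u e = i , λ { (x ∷ xs) → nat xs }

  off-forth : ∀ {h} (s : Vec Bool h) u → lookup s u ≡ false →
    ∃ λ i → ∀ {B : Set} (xs : Vec B h) → lookup (off s xs) i ≡ lookup xs u
  off-forth (false ∷ s) zero e = zero , λ { (x ∷ xs) → refl }
  off-forth (false ∷ s) (suc u) e with i , nat ← off-forth s u e = suc i , λ { (x ∷ xs) → nat xs }
  off-forth (true ∷ s) (suc u) e with i , nat ← off-forth s u e = i , λ { (x ∷ xs) → nat xs }

  module _ {B : Set} (F : B → ℕ) where

    ∑ᵛ-off-on : ∀ {h} (s c : Vec Bool h) (xs : Vec B h) →
      ∑ᵛ F (off (on s c) (on s xs)) ≡
      ∑[ u ∈ allFin h ] ([ lookup s u ] * ([ not (lookup c u) ] * F (lookup xs u)))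
    ∑ᵛ-off-on [] [] [] = refl
    ∑ᵛ-off-on {suc h} (x ∷ s) (z ∷ c) (y ∷ xs)
      rewrite ∑-allFin-suc h (λ u → [ lookup (x ∷ s) u ] * ([ not (lookup (z ∷ c) u) ] * F (lookup (y ∷ xs) u))) with x | z
    ... | false | _     = ∑ᵛ-off-on s c xs
    ... | true  | true  = ∑ᵛ-off-on s c xs
    ... | true  | false = cong₂ _+_ (sym (trans (+-identityʳ _) (+-identityʳ (F y)))) (∑ᵛ-off-on s c xs)

  ones-∑ : ∀ {h} (s : Vec Bool h) → ones s ≡ ∑[ u ∈ allFin h ] [ lookup s u ]
  ones-∑ [] = refl
  ones-∑ {suc h} (x ∷ s) rewrite ∑-allFin-suc h (λ u → [ lookup (x ∷ s) u ]) with x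
  ... | true  = cong suc (ones-∑ s)
  ... | false = ones-∑ s

  ones-on : ∀ {h} (s c : Vec Bool h) → ones (on s c) ≡ ∑[ u ∈ allFin h ] ([ lookup s u ] * [ lookup c u ])
  ones-on [] [] = refl
  ones-on {suc h} (x ∷ s) (z ∷ c) rewrite ∑-allFin-suc h (λ u → [ lookup (x ∷ s) u ] * [ lookup (z ∷ c) u ]) with x | z
  ... | false | _     = ones-on s c
  ... | true  | false = ones-on s c
  ... | true  | true  = cong suc (ones-on s c)

  ones-off : ∀ {h} (s c : Vec Bool h) → ones (off s c) ≡ ∑[ u ∈ allFin h ] ([ not (lookup s u) ] * [ lookup c u ])
  ones-off [] [] = refl
  ones-off {suc h} (x ∷ s) (z ∷ c) rewrite ∑-allFin-suc h (λ u → [ not (lookup (x ∷ s) u) ] * [ lookup (z ∷ c) u ]) with x | z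
  ... | true  | _     = ones-off s c
  ... | false | false = ones-off s c
  ... | false | true  = cong suc (ones-off s c)

  zeros-∑ : ∀ {h} (s : Vec Bool h) → zeros s ≡ ∑[ u ∈ allFin h ] [ not (lookup s u) ]
  zeros-∑ [] = refl
  zeros-∑ {suc h} (x ∷ s) rewrite ∑-allFin-suc h (λ u → [ not (lookup (x ∷ s) u) ]) with x
  ... | true  = zeros-∑ s
  ... | false = cong suc (zeros-∑ s)

  does-∈? : ∀ {n} (u : Fin n) (s : Subset n) → does (u ∈? s) ≡ lookup s u
  does-∈? u s with lookup s u in e
  ... | true  = dec-true (u ∈? s) (lookup⇒[]= u s e)
  ... | false = dec-false (u ∈? s) (λ u∈ → contradiction (trans (sym e) ([]=⇒lookup u∈)) λ ())

  -- The bipartite pattern in terms of masks.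

  -- The mask A splits off B; on A, the mask c marks the vertices complete to B, and the row of
  -- u ∈ A is its neighbourhood in B.
  module Pattern {h : ℕ} (H : BipartiteGraph h) where
    open BipartiteGraph H hiding (sym)
    open Adjacency graph

    complete? : ∀ u → Dec (CompleteToB u)
    complete? u = Finₚ.all? (λ v → (v ∈? B) →-dec (u ~? v))

    c : Vec Bool h
    c = tabulate (λ u → does (complete? u))

    cA : Vec Bool (ones A)
    cA = on A c

    row : Fin h → Vec Bool (zeros A)
    row u = off A (tabulate (adj u))

    k b m : ℕ
    k = ones cA
    b = zeros A
    m = zeros cA

    masks : Vec (Vec Bool b) m
    masks = off cA (on A (tabulate row))

    c-true : ∀ u → lookup c u ≡ true → CompleteToB u
    c-true u e = does-true (complete? u) (trans (sym (lookup∘tabulate (λ u → does (complete? u)) u)) e)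

    c-false : ∀ u → lookup c u ≡ false → ¬ CompleteToB u
    c-false u e = does-false (complete? u) (trans (sym (lookup∘tabulate (λ u → does (complete? u)) u)) e)

    ∈A : ∀ u → lookup A u ≡ true → u Subset.∈ A
    ∈A u e = lookup⇒[]= u A e

    ∈B : ∀ u → lookup A u ≡ false → u Subset.∈ B
    ∈B u e = lookup⇒[]= u B (trans (lookup-map u not A) (cong not e))

    A∌B : ∀ u → u Subset.∈ B → lookup A u ≡ false
    A∌B u u∈B = not-true (trans (sym (lookup-map u not A)) ([]=⇒lookup u∈B))

    k≡ : k ≡ numCompleteToB
    k≡ = trans (ones-on A c) (trans (∑-cong (allFin h) λ u → trans
        (cong₂ (λ p q → [ p ] * [ q ]) (sym (does-∈? u A)) (lookup∘tabulate (λ u → does (complete? u)) u))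
        (sym ([∧] (does (u ∈? A)) (does (complete? u)))))
      (sym (∑-filter (λ u → (u ∈? A) ×-dec complete? u) (allFin h))))

    rest-vertex : ∀ (i : Fin m) → ∃ λ u → lookup A u ≡ true × lookup c u ≡ false × lookup masks i ≡ row u
    rest-vertex i with j , cj , nat ← off-back cA i with u , Au , nat′ ← on-back A j =
      u , Au , trans (sym (nat′ c)) cj ,
      trans (nat (on A (tabulate row))) (trans (nat′ (tabulate row)) (lookup∘tabulate row u))

    -- Every vertex is vacuously complete to an empty B.
    b≡0⇒m≡0 : b ≡ 0 → m ≡ 0
    b≡0⇒m≡0 b≡0 with m in m≡
    ... | zero  = refl
    ... | suc _ with u , _ , cu , _ ← rest-vertex (subst Fin (sym m≡) zero) =
      contradiction (λ v v∈B → contradiction (subst Fin b≡0 (proj₁ (off-forth A v (A∌B v v∈B)))) λ ()) (c-false u cu)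

    degree-∑ : ∀ u → degree u ≡ ∑[ v ∈ allFin h ] [ adj u v ]
    degree-∑ u = ∑-filter (u ~?_) (allFin h)

    ones-row : ∀ u → ones (row u) ≡ ∑[ v ∈ allFin h ] ([ not (lookup A v) ] * [ adj u v ])
    ones-row u = trans (ones-off A (tabulate (adj u)))
      (∑-cong (allFin h) λ v → cong (λ p → [ not (lookup A v) ] * [ p ]) (lookup∘tabulate (adj u) v))

    ones≤degree : ∀ u → ones (row u) ≤ degree u
    ones≤degree u = ≤-trans (≤-reflexive (ones-row u))
      (≤-trans (∑-mono (allFin h) λ v → []*≤ (not (lookup A v)) λ _ → ≤-refl) (≤-reflexive (sym (degree-∑ u))))

    ones≤d : ∀ {d} → Bounded d H → ∀ i → ones (lookup masks i) ≤ d
    ones≤d bounded i with u , Au , cu , eq ← rest-vertex i rewrite eq =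
      ≤-trans (ones≤degree u) (Bounded.degree≤d bounded u (∈A u Au) (c-false u cu))

    -- Edges are counted from their ends in A, and a vertex complete to B has a row of `b` ones. An
    -- inequality is enough: `enough-copies` fills up the exponent with factors q ≤ 1.
    edges≤size : k * b + ∑ᵛ ones masks ≤ size
    edges≤size = begin
      k * b + ∑ᵛ ones masks
        ≡⟨ cong₂ _+_ (trans (cong (_* b) (ones-on A c)) (sym (∑-*ʳ b V _))) (∑ᵛ-off-on ones A c (tabulate row)) ⟩
      ∑[ u ∈ V ] ([ lookup A u ] * [ lookup c u ] * b) + ∑[ u ∈ V ] ([ lookup A u ] * ([ not (lookup c u) ] * ones (lookup (tabulate row) u)))
        ≡⟨ ∑-+ V (λ u → [ lookup A u ] * [ lookup c u ] * b) _ ⟨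
      ∑[ u ∈ V ] ([ lookup A u ] * [ lookup c u ] * b + [ lookup A u ] * ([ not (lookup c u) ] * ones (lookup (tabulate row) u)))
        ≤⟨ ∑-mono V (λ u → ≤-trans (≤-reflexive (cong (λ s → [ lookup A u ] * [ lookup c u ] * b + [ lookup A u ] * ([ not (lookup c u) ] * ones s)) (lookup∘tabulate row u)))
             (bools (lookup A u) (lookup c u) (b≤row u))) ⟩
      ∑[ u ∈ V ] ([ lookup A u ] * ones (row u))
        ≡⟨ ∑-cong V (λ u → trans (cong ([ lookup A u ] *_) (ones-row u)) (trans (sym (∑-*ˡ [ lookup A u ] V _))
             (∑-cong V λ v → perm [ lookup A u ] [ not (lookup A v) ] [ adj u v ]))) ⟩
      ∑[ u ∈ V ] ∑[ v ∈ V ] ([ adj u v ] * w u v)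
        ≡⟨ oriented w ⟩
      ∑[ u ∈ V ] ∑[ v ∈ V ] ([ does (u <? v) ∧ adj u v ] * (w u v + w v u))
        ≤⟨ ∑-mono V (λ u → ∑-mono V λ v → ≤-trans (*-monoʳ-≤ [ does (u <? v) ∧ adj u v ] (crossing (lookup A u) (lookup A v)))
             (≤-reflexive (*-identityʳ _))) ⟩
      ∑[ u ∈ V ] ∑[ v ∈ V ] [ does (u <? v) ∧ adj u v ]
        ≡⟨ size-∑ ⟨
      size ∎
      where
      open ≤-Reasoning
      V = allFin h
      w : Fin h → Fin h → ℕ
      w u v = [ lookup A u ] * [ not (lookup A v) ]
      perm : ∀ a b c → a * (b * c) ≡ c * (a * b)
      perm = solve-∀
      crossing : ∀ p q → [ p ] * [ not q ] + [ q ] * [ not p ] ≤ 1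
      crossing false false = z≤n
      crossing false true  = ≤-refl
      crossing true  false = ≤-refl
      crossing true  true  = z≤n
      b≤row : ∀ u → lookup c u ≡ true → b ≤ ones (row u)
      b≤row u cu = ≤-trans (≤-reflexive (zeros-∑ A)) (≤-trans (∑-mono V λ v → pointwise v) (≤-reflexive (sym (ones-row u))))
        where
        pointwise : ∀ v → [ not (lookup A v) ] ≤ [ not (lookup A v) ] * [ adj u v ]
        pointwise v with lookup A v in Av
        ... | true  = z≤n
        ... | false rewrite dec-true (u ~? v) (c-true u cu v (∈B v Av)) = ≤-refl
      bools : ∀ p q {x y} → (q ≡ true → x ≤ y) → [ p ] * [ q ] * x + [ p ] * ([ not q ] * y) ≤ [ p ] * y
      bools false q     _   = z≤n
      bools true  true  x≤y = ≤-trans (≤-reflexive (+-identityʳ _)) (*-monoʳ-≤ 1 (x≤y refl))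
      bools true  false _   = ≤-reflexive (+-identityʳ _)

    vertices : k + b + m ≡ h
    vertices = trans (perm k b m) (trans (cong (_+ b) (ones+zeros cA)) (ones+zeros A))
      where
      perm : ∀ a b c → a + b + c ≡ a + c + b
      perm = solve-∀

  -- Configurations are induced copies.

  module Embedding {h n : ℕ} (H : BipartiteGraph h) (G Γ : Graph n) (G⊆Γ : G ⊆ᴳ Γ)
    (L τ : ℕ) .{{_ : NonZero L}} where
    open Pattern H
    open BipartiteGraph H using (graph; A; A-independent; B-independent) renaming (_~_ to _~ᴴ_; _~?_ to _~ᴴ?_)

    private
      V = allFin n
      g = Adjacency.adj G
      r = Adjacency.adj-or-eq Γ
      module G = Graph G
      module Γ = Graph Γ

    open Transversals V r L τ
    open Configurations V g r {k} masks L τ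

    valid : Vec (Fin n) h → Bool
    valid φ = core (on cA (on A φ)) (off A φ) ∧
      transversal (rests (on cA (on A φ)) (off A φ)) (off cA (on A φ))

    #configurations≡ : #configurations ≡ ∑[ φ ∈ tuples h ] [ valid φ ]
    #configurations≡ = sym (begin-equality
      ∑[ φ ∈ tuples h ] [ valid φ ]
        ≡⟨ ∑-on-off A (λ Z Y → F (on cA Z) (off cA Z) Y) ⟩
      ∑[ Z ∈ tuples (ones A) ] ∑[ Y ∈ tuples b ] F (on cA Z) (off cA Z) Y
        ≡⟨ ∑-swap (tuples (ones A)) (tuples b) (λ Z Y → F (on cA Z) (off cA Z) Y) ⟩
      ∑[ Y ∈ tuples b ] ∑[ Z ∈ tuples (ones A) ] F (on cA Z) (off cA Z) Y
        ≡⟨ ∑-cong (tuples b) (λ Y → ∑-on-off cA (λ X R → F X R Y)) ⟩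
      ∑[ Y ∈ tuples b ] ∑[ X ∈ tuples k ] ∑[ R ∈ tuples m ] F X R Y
        ≡⟨ ∑-swap (tuples b) (tuples k) (λ Y X → ∑[ R ∈ tuples m ] F X R Y) ⟩
      ∑[ X ∈ tuples k ] ∑[ Y ∈ tuples b ] ∑[ R ∈ tuples m ] F X R Y
        ≡⟨ ∑-cong (tuples k) (λ X → ∑-cong (tuples b) λ Y → trans
             (∑-cong (tuples m) λ R → [∧] (core X Y) (transversal (rests X Y) R)) (∑-*ˡ [ core X Y ] (tuples m) _)) ⟩
      #configurations ∎)
      where
      open ≤-Reasoning
      F : Vec (Fin n) k → Vec (Fin n) m → Vec (Fin n) b → ℕ
      F X R Y = [ core X Y ∧ transversal (rests X Y) R ]

    module Valid (φ : Vec (Fin n) h) (ok : valid φ ≡ true) where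

      private
        X = on cA (on A φ)
        Y = off A φ
        R = off cA (on A φ)
        core-ok = proj₁ (∧-true {core X Y} ok)
        X-ok = proj₁ (∧-true {independent X} core-ok)
        Y-ok = proj₁ (∧-true {independent Y} (proj₂ (∧-true {independent X} core-ok)))
        XY-ok = proj₂ (∧-true {independent Y} (proj₂ (∧-true {independent X} core-ok)))
        R-ok = proj₂ (∧-true {core X Y} ok)
        r-sym = Adjacency.adj-or-eq-sym Γ

      embed : Fin h → Fin n
      embed = lookup φ

      -- Edges are demanded in G, non-edges in Γ and together with distinctness: this yields a copy
      -- in G that is induced in Γ.
      Faithful : Fin h → Fin h → Set
      Faithful u v = (u ~ᴴ v → g (embed u) (embed v) ≡ true) × (¬ u ~ᴴ v → r (embed u) (embed v) ≡ false)

      flip : ∀ {u v} → Faithful u v → Faithful v u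
      flip {u} {v} (edge , nonedge) =
        (λ v~u → trans (Adjacency.adj-sym G _ _) (edge (Graph.sym graph v~u))) ,
        (λ v≁u → trans (r-sym _ _) (nonedge (λ u~v → v≁u (Graph.sym graph u~v))))

      Position : ∀ {j} → (∀ {B : Set} → Vec B h → Vec B j) → Fin h → Set₁
      Position {j} select u = ∃ λ (i : Fin j) → ∀ {B : Set} (xs : Vec B h) → lookup (select xs) i ≡ lookup xs u

      X-position : ∀ u → lookup A u ≡ true → lookup c u ≡ true → Position (λ xs → on cA (on A xs)) u
      X-position u Au cu with j , nat ← on-forth A u Au with i , nat′ ← on-forth cA j (trans (nat c) cu) =
        i , λ xs → trans (nat′ (on A xs)) (nat xs)

      R-position : ∀ u → lookup A u ≡ true → lookup c u ≡ false → Position (λ xs → off cA (on A xs)) u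
      R-position u Au cu with j , nat ← on-forth A u Au with i , nat′ ← off-forth cA j (trans (nat c) cu) =
        i , λ xs → trans (nat′ (on A xs)) (nat xs)

      apart : ∀ {j u v} (select : ∀ {B : Set} → Vec B h → Vec B j) → independent (select φ) ≡ true →
        u ≢ v → Position select u → Position select v → r (embed u) (embed v) ≡ false
      apart select ind u≢v (i , nat) (i′ , nat′) = subst₂ (λ x y → r x y ≡ false) (nat φ) (nat′ φ)
        -- If the two positions agreed, evaluating them on the vector of all indices would identify
        -- `u` and `v`.
        (independent-lookup r-sym (select φ) ind i i′ λ { refl →
          u≢v (trans (sym (trans (nat (Vec.allFin h)) (lookup-allFin _))) (trans (nat′ (Vec.allFin h)) (lookup-allFin _))) })

      rest-at : ∀ {u} (p : Position (λ xs → off cA (on A xs)) u) → rest X Y (row u) (embed u) ≡ true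
      rest-at {u} (i , nat) = subst₂ (λ W x → W x ≡ true)
        (trans (lookup-map i (rest X Y) masks) (cong (rest X Y) (trans (nat (tabulate row)) (lookup∘tabulate row u)))) (nat φ)
        (transversal-∈ (rests X Y) R R-ok i)

      faithful-XY : ∀ u v → lookup A u ≡ true → lookup c u ≡ true → lookup A v ≡ false → Faithful u v
      faithful-XY u v Au cu Av with i , nat ← X-position u Au cu with j , nat′ ← off-forth A v Av =
        (λ _ → subst₂ (λ x y → g x y ≡ true) (nat φ) (nat′ φ) (every-lookup X (every-lookup Y XY-ok j) i)) ,
        (λ u≁v → contradiction (c-true u cu v (∈B v Av)) u≁v)

      faithful-XR : ∀ u v → lookup A u ≡ true → lookup c u ≡ true → lookup A v ≡ true → lookup c v ≡ false → Faithful u v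
      faithful-XR u v Au cu Av cv with i , nat ← X-position u Au cu =
        (λ u~v → contradiction u~v (A-independent (∈A u Au) (∈A v Av))) ,
        (λ _ → subst (λ x → r x (embed v) ≡ false) (nat φ) (cuts-lookup X _ (embed v)
          (cuts-⊆ (off (row v) Y) _ (embed v) (rest-at (R-position v Av cv))) i))

      -- The row of `u` decides: on it, membership in `common` gives the edge of G; off it, the
      -- second round of cuts gives the non-edge of Γ.
      faithful-YR : ∀ v u → lookup A v ≡ false → lookup A u ≡ true → lookup c u ≡ false → Faithful u v
      faithful-YR v u Av Au cu with j , nat ← off-forth A v Av =
        (λ u~v → let i , nat′ = on-forth (row u) j (trans row≡ (dec-true (u ~ᴴ? v) u~v)) in
          subst (λ y → g (embed u) y ≡ true) (trans (nat′ Y) (nat φ))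
            (every-lookup (on (row u) Y) (cuts-⊆ X _ (embed u) (cuts-⊆ (off (row u) Y) _ (embed u) in-rest)) i)) ,
        (λ u≁v → let i , nat′ = off-forth (row u) j (trans row≡ (dec-false (u ~ᴴ? v) u≁v)) in
          trans (r-sym (embed u) (embed v)) (subst (λ y → r y (embed u) ≡ false) (trans (nat′ Y) (nat φ))
            (cuts-lookup (off (row u) Y) _ (embed u) in-rest i)))
        where
        in-rest = rest-at (R-position u Au cu)
        row≡ : lookup (row u) j ≡ Adjacency.adj graph u v
        row≡ = trans (nat (tabulate (Adjacency.adj graph u))) (lookup∘tabulate (Adjacency.adj graph u) v)

      faithful : ∀ u v → u ≢ v → Faithful u v
      faithful u v u≢v with lookup A u in Au | lookup A v in Av
      ... | false | false =
        (λ u~v → contradiction u~v (B-independent (∈B u Au) (∈B v Av))) ,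
        (λ _ → apart (off A) Y-ok u≢v (off-forth A u Au) (off-forth A v Av))
      ... | true | false with lookup c u in cu
      ... | true  = faithful-XY u v Au cu Av
      ... | false = faithful-YR v u Av Au cu
      faithful u v u≢v | false | true with lookup c v in cv
      ... | true  = flip (faithful-XY v u Av cv Au)
      ... | false = flip (faithful-YR u v Au Av cv)
      faithful u v u≢v | true | true with lookup c u in cu | lookup c v in cv
      ... | true  | false = faithful-XR u v Au cu Av cv
      ... | false | true  = flip (faithful-XR v u Av cv Au cu)
      ... | true  | true  =
        (λ u~v → contradiction u~v (A-independent (∈A u Au) (∈A v Av))) ,
        (λ _ → apart (λ xs → on cA (on A xs)) X-ok u≢v (X-position u Au cu) (X-position v Av cv))
      ... | false | false =
        (λ u~v → contradiction u~v (A-independent (∈A u Au) (∈A v Av))) ,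
        (λ _ → apart (λ xs → off cA (on A xs)) (transversal⇒independent (rests X Y) R R-ok)
          u≢v (R-position u Au cu) (R-position v Av cv))

      embed-edges : ∀ {u v} → u ~ᴴ v → G._~_ (embed u) (embed v)
      embed-edges {u} {v} u~v = does-true (G._~?_ _ _)
        (proj₁ (faithful u v (λ u≡v → Graph.irrefl graph u≡v u~v)) u~v)

      embed-nonedges : ∀ {u v} → u ≢ v → ¬ u ~ᴴ v → ¬ Γ._~_ (embed u) (embed v) × embed u ≢ embed v
      embed-nonedges {u} {v} u≢v u≁v with na , ne ← ∨-false (proj₂ (faithful u v u≢v) u≁v) =
        does-false (Γ._~?_ _ _) na , does-false (_ Finₚ.≟ _) ne

      -- Adjacent vertices have distinct images since G has no loops, non-adjacent ones since `r`
      -- includes equality.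
      embed-injective : Injective _≡_ _≡_ embed
      embed-injective {u} {v} eq with u Finₚ.≟ v
      ... | yes u≡v = u≡v
      ... | no  u≢v with u ~ᴴ? v
      ... | yes u~v = contradiction (embed-edges u~v) (G.irrefl eq)
      ... | no  u≁v = contradiction eq (proj₂ (embed-nonedges u≢v u≁v))

      copy : Copy graph G
      copy = record { embed = embed ; injective = embed-injective ; edges = embed-edges }

      copy-induced : InducedIn Γ copy
      copy-induced x y (u , refl) (v , refl) = mk⇔
        (λ { (u′ , v′ , u~v , e , e′) → subst₂ Γ._~_ e e′ (G⊆Γ _ _ (embed-edges u~v)) })
        (λ x~y → u , v , edge x~y , refl , refl)
        where
        edge : Γ._~_ (embed u) (embed v) → u ~ᴴ v
        edge x~y with u ~ᴴ? v
        ... | yes u~v = u~v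
        ... | no  u≁v = contradiction x~y (proj₁ (embed-nonedges (λ { refl → Γ.irrefl refl x~y }) u≁v))

    -- From embeddings to pairwise distinct copies.

    covers : Copy graph G → Vec (Fin n) h → Bool
    covers K = every (λ x → does (Finₚ.any? (λ u → Copy.embed K u Finₚ.≟ x)))

    -- All `h` entries of a covered tuple lie among the at most `h` vertices of K.
    covers-few : ∀ K → ∑[ φ ∈ tuples h ] [ covers K φ ] ≤ h ^ h
    covers-few K = ≤-trans (≤-reflexive (∑-every (λ x → does (Finₚ.any? (λ u → Copy.embed K u Finₚ.≟ x))) h))
      (^-monoˡ-≤ h (begin
        card (λ x → does (Finₚ.any? (λ u → Copy.embed K u Finₚ.≟ x)))  ≤⟨ ∑-mono V pointwise ⟩
        ∑[ x ∈ V ] ∑[ u ∈ allFin h ] [ does (Copy.embed K u Finₚ.≟ x) ]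
          ≡⟨ ∑-swap V (allFin h) (λ x u → [ does (Copy.embed K u Finₚ.≟ x) ]) ⟩
        ∑[ u ∈ allFin h ] ∑[ x ∈ V ] [ does (Copy.embed K u Finₚ.≟ x) ]
          ≤⟨ ∑-≤-const (allFin h) (λ u → ∑-at-most-one (Copy.embed K u)) ⟩
        length (allFin h) * 1                  ≡⟨ trans (*-identityʳ _) (Listₚ.length-tabulate {n = h} (λ i → i)) ⟩
        h ∎))
      where
      open ≤-Reasoning
      pointwise : ∀ x → [ does (Finₚ.any? (λ u → Copy.embed K u Finₚ.≟ x)) ] ≤
        ∑[ u ∈ allFin h ] [ does (Copy.embed K u Finₚ.≟ x) ]
      pointwise x with Finₚ.any? (λ u → Copy.embed K u Finₚ.≟ x)
      ... | no  _ = z≤n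
      ... | yes (u , e) = ≤-trans (≤-reflexive (cong [_] (sym (dec-true (Copy.embed K u Finₚ.≟ x) e))))
                            (term≤∑ (allFin h) (∈-allFin u))
        where
        term≤∑ : ∀ (us : List (Fin h)) {u} → u ∈ us → [ does (Copy.embed K u Finₚ.≟ x) ] ≤
          ∑[ u ∈ us ] [ does (Copy.embed K u Finₚ.≟ x) ]
        term≤∑ (u ∷ us) (here refl) = m≤m+n _ _
        term≤∑ (u ∷ us) (there u∈)  = ≤-trans (term≤∑ us u∈) (m≤n+m _ _)

    -- Equivalent copies have the same vertices. Hence a tuple covered by no kept copy yields one
    -- that differs from all of them.
    ≈⇒covers : ∀ φ ok K → Valid.copy φ ok ≈ᶜ K → covers K φ ≡ true
    ≈⇒covers φ ok K (vertices , _) = every-true φ λ i →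
      dec-true (Finₚ.any? (λ u → Copy.embed K u Finₚ.≟ lookup φ i)) (Equivalence.to (vertices (lookup φ i)) (i , refl))

    -- Greedily keep a valid tuple only if its vertices are not among those of a copy already kept.
    select : ∀ (φs : List (Vec (Fin n) h)) → ∃ λ (Ks : List (Copy graph G)) →
      AllPairs (λ K L → ¬ (K ≈ᶜ L)) Ks × All (InducedIn Γ) Ks ×
      ∑[ φ ∈ φs ] [ valid φ ] ≤ ∑[ φ ∈ φs ] ∑[ K ∈ Ks ] [ covers K φ ]
    select [] = [] , [] , [] , z≤n
    select (φ ∷ φs) with Ks , distinct , induced , count ← select φs with valid φ in ok
    ... | false = Ks , distinct , induced , ≤-trans count (m≤n+m _ _)
    ... | true with ∑[ K ∈ Ks ] [ covers K φ ] in covered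
    ... | suc j = Ks , distinct , induced ,
      ≤-trans (s≤s count) (+-monoˡ-≤ _ (≤-trans (s≤s z≤n) (≤-reflexive (sym covered))))
    ... | zero = Valid.copy φ ok ∷ Ks , new Ks covered ∷ distinct , Valid.copy-induced φ ok ∷ induced ,
      +-mono-≤ (≤-trans (≤-reflexive (cong [_] (sym self))) (m≤m+n _ _))
        (≤-trans count (∑-mono φs λ ψ → m≤n+m _ _))
      where
      self : covers (Valid.copy φ ok) φ ≡ true
      self = ≈⇒covers φ ok (Valid.copy φ ok)
        ((λ x → mk⇔ (λ p → p) (λ p → p)) , (λ x y → mk⇔ (λ p → p) (λ p → p)))
      new : ∀ Ls → ∑[ K ∈ Ls ] [ covers K φ ] ≡ 0 → All (λ K → ¬ (Valid.copy φ ok ≈ᶜ K)) Ls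
      new []       _ = []
      new (K ∷ Ls) e with covers K φ in cov
      ... | false = (λ eq → contradiction (trans (sym (≈⇒covers φ ok K eq)) cov) λ ()) ∷ new Ls e

    many-copies : ∃ λ (Ks : List (Copy graph G)) →
      AllPairs (λ K L → ¬ (K ≈ᶜ L)) Ks × All (InducedIn Γ) Ks ×
      #configurations ≤ length Ks * h ^ h
    many-copies with Ks , distinct , induced , count ← select (tuples h) = Ks , distinct , induced , (begin
      #configurations                                      ≡⟨ #configurations≡ ⟩
      ∑[ φ ∈ tuples h ] [ valid φ ]                        ≤⟨ count ⟩
      ∑[ φ ∈ tuples h ] ∑[ K ∈ Ks ] [ covers K φ ]         ≡⟨ ∑-swap (tuples h) Ks (λ φ K → [ covers K φ ]) ⟩
      ∑[ K ∈ Ks ] ∑[ φ ∈ tuples h ] [ covers K φ ]         ≤⟨ ∑-≤-const Ks covers-few ⟩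
      length Ks * h ^ h ∎)
      where open ≤-Reasoning

  scaled-≥2 : ∀ c a b → c ℚ.* suc b /1 ≡ suc a /1 → 2 /1 ℚ.≤ c ℚ.* (2 * suc b) /1
  scaled-≥2 c a b c≡ = begin
    2 /1                             ≤⟨ /1-mono-≤ {2} {suc a * 2} (*-monoˡ-≤ 2 (s≤s (z≤n {a}))) ⟩
    (suc a * 2) /1                   ≡⟨ /1-* (suc a) 2 ⟩
    suc a /1 ℚ.* 2 /1                ≡⟨ cong (ℚ._* 2 /1) c≡ ⟨
    c ℚ.* suc b /1 ℚ.* 2 /1          ≡⟨ ℚₚ.*-assoc c (suc b /1) (2 /1) ⟩
    c ℚ.* (suc b /1 ℚ.* 2 /1)        ≡⟨ cong (c ℚ.*_) (trans (cong _/1 (*-comm 2 (suc b))) (/1-* (suc b) 2)) ⟨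
    c ℚ.* (2 * suc b) /1 ∎
    where open ℚₚ.≤-Reasoning

  -- The threshold τ and the bound on the number of edges of G.

  module Host {n : ℕ} .{{_ : NonZero n}} (Γ G : Graph n) (G⊆Γ : G ⊆ᴳ Γ) (L : ℕ) .{{_ : NonZero L}} (t : ℚ) (p q : ℕ)
    (t≡ : t ℚ.* suc q /1 ≡ suc p /1)
    (sparse : ∀ A B → t ℚ.≤ ∣ A ∣ /1 → t ℚ.≤ ∣ B ∣ /1 →
      L * Graph.e Γ A B + 2 * (∣ A ∣ * ∣ B ∣) ≤ L * (∣ A ∣ * ∣ B ∣))
    (d : ℕ) .{{_ : NonZero d}} (C : ℕ) .{{_ : NonZero C}}
    (edges : C ^ d * suc p * n ^ (2 * d ∸ 1) ≤ Graph.size G ^ d * suc q) where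

    private
      V = allFin n
      D = Weights.D V (Adjacency.adj G)

    t≤ : ∀ j → suc p ≤ j * suc q → t ℚ.≤ j /1
    t≤ j h = scale-≤ (suc q) (ℚₚ.≤-trans (ℚₚ.≤-reflexive t≡)
      (ℚₚ.≤-trans (/1-mono-≤ {suc p} {j * suc q} h) (ℚₚ.≤-reflexive (/1-* j (suc q)))))

    -- For t ≤ 1 sparseness applies to two singletons, and an edge between them would have density
    -- 1.
    small-t⇒edgeless : suc p ≤ suc q → ∀ u v → ¬ Graph._~_ Γ u v
    small-t⇒edgeless p≤q u v u~v = contradiction (sparse ⁅ u ⁆ ⁅ v ⁆ (t≤1 u) (t≤1 v)) (<⇒≱ (begin-strict
      L * (∣ ⁅ u ⁆ ∣ * ∣ ⁅ v ⁆ ∣)   ≡⟨ cong (L *_) ones≡ ⟩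
      L * 1                         ≤⟨ *-monoʳ-≤ L one≤e ⟩
      L * Graph.e Γ ⁅ u ⁆ ⁅ v ⁆     <⟨ m<m+n _ (s≤s z≤n) ⟩
      L * Graph.e Γ ⁅ u ⁆ ⁅ v ⁆ + 2 ≡⟨ cong (λ s → L * Graph.e Γ ⁅ u ⁆ ⁅ v ⁆ + 2 * s) ones≡ ⟨
      L * Graph.e Γ ⁅ u ⁆ ⁅ v ⁆ + 2 * (∣ ⁅ u ⁆ ∣ * ∣ ⁅ v ⁆ ∣) ∎))
      where
      open ≤-Reasoning
      ones≡ : ∣ ⁅ u ⁆ ∣ * ∣ ⁅ v ⁆ ∣ ≡ 1
      ones≡ = cong₂ _*_ (∣⁅x⁆∣≡1 u) (∣⁅x⁆∣≡1 v)
      t≤1 : ∀ u → t ℚ.≤ ∣ ⁅ u ⁆ ∣ /1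
      t≤1 u = subst (λ j → t ℚ.≤ j /1) (sym (∣⁅x⁆∣≡1 u))
        (t≤ 1 (≤-trans p≤q (≤-reflexive (sym (*-identityˡ (suc q))))))
      one≤e : 1 ≤ Graph.e Γ ⁅ u ⁆ ⁅ v ⁆
      one≤e = ∈-length (∈-filter⁺ _ (∈-cartesianProduct⁺ (∈-allFin u) (∈-allFin v)) (x∈⁅x⁆ u , x∈⁅x⁆ v , u~v))

    -- This says t > 1: otherwise G would be edgeless, although `edges` bounds its size below by a
    -- positive quantity. It makes rounding t up cost at most a factor 2.
    q<p : suc q < suc p
    q<p = ≰⇒> λ p≤q → contradiction edges (<⇒≱ (begin-strict
      Graph.size G ^ d * suc q       ≡⟨ cong (λ s → s ^ d * suc q) (size≡0 (small-t⇒edgeless p≤q)) ⟩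
      0 ^ d * suc q                  ≡⟨ cong (_* suc q) (zero-power d) ⟩
      0                              <⟨ >-nonZero⁻¹ _ {{m*n≢0 (C ^ d * suc p) _ {{m*n≢0 (C ^ d) (suc p) {{m^n≢0 C d}}}} {{m^n≢0 n (2 * d ∸ 1)}}}} ⟩
      C ^ d * suc p * n ^ (2 * d ∸ 1) ∎))
      where
      open ≤-Reasoning
      zero-power : ∀ j → .{{_ : NonZero j}} → 0 ^ j ≡ 0
      zero-power (suc j) = refl
      size≡0 : (∀ u v → ¬ Graph._~_ Γ u v) → Graph.size G ≡ 0
      size≡0 edgeless = trans (Adjacency.size-∑ G) (trans (∑-cong V λ u → trans (∑-cong V λ v → zero-term u v) (∑-0 V)) (∑-0 V))
        where
        zero-term : ∀ u v → [ does (u <? v) ∧ Adjacency.adj G u v ] ≡ 0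
        zero-term u v = trans ([∧] (does (u <? v)) _) (trans (cong (λ p → [ does (u <? v) ] * [ p ])
          (dec-false (Graph._~?_ G u v) (λ u~v → edgeless u v (G⊆Γ u v u~v)))) (*-zeroʳ [ does (u <? v) ]))

    -- `⌈t⌉` is the integer part of t plus one; the factor `suc L` ensures `L < τ`.
    ⌈t⌉ τ : ℕ
    ⌈t⌉ = suc (suc p / suc q)
    τ = suc L * ⌈t⌉

    t≤⌈t⌉ : suc p ≤ ⌈t⌉ * suc q
    t≤⌈t⌉ = ≤-trans (≤-reflexive (DivMod.m≡m%n+[m/n]*n (suc p) (suc q)))
      (+-monoˡ-≤ (suc p / suc q * suc q) (<⇒≤ (DivMod.m%n<n (suc p) (suc q))))

    ⌈t⌉≤2t : ⌈t⌉ * suc q ≤ 2 * suc p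
    ⌈t⌉≤2t = ≤-trans (+-mono-≤ (<⇒≤ q<p) (DivMod.m/n*n≤m (suc p) (suc q))) (≤-reflexive (cong (suc p +_) (sym (+-identityʳ _))))

    t≤τ : t ℚ.≤ τ /1
    t≤τ = t≤ τ (≤-trans t≤⌈t⌉ (*-monoˡ-≤ (suc q) (m≤n*m ⌈t⌉ (suc L))))

    open FewBad Γ L τ (m≤m*n (suc L) ⌈t⌉) t t≤τ sparse public using (few-bad)

    -- This is the edge hypothesis times `n`. The constant `C`, at most `C ^ d`, absorbs `M`, the
    -- factor `suc L` of `τ` and the 2 lost in rounding t.
    rich : ∀ M → 2 * (M * suc L) ≤ C → M * τ * (n * n) ^ d ≤ D ^ d * n
    rich M M≤C = *-cancelʳ-≤ _ _ (suc q) (begin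
      M * (suc L * ⌈t⌉) * (n * n) ^ d * suc q         ≡⟨ perm₁ M (suc L) ⌈t⌉ ((n * n) ^ d) (suc q) ⟩
      M * suc L * (n * n) ^ d * (⌈t⌉ * suc q)         ≤⟨ *-monoʳ-≤ (M * suc L * (n * n) ^ d) ⌈t⌉≤2t ⟩
      M * suc L * (n * n) ^ d * (2 * suc p)           ≡⟨ perm₂ (M * suc L) ((n * n) ^ d) (suc p) ⟩
      2 * (M * suc L) * suc p * (n * n) ^ d           ≤⟨ *-monoˡ-≤ ((n * n) ^ d) (*-monoˡ-≤ (suc p) (≤-trans M≤C C≤C^d)) ⟩
      C ^ d * suc p * (n * n) ^ d                     ≡⟨ cong (C ^ d * suc p *_) power ⟩
      C ^ d * suc p * (n ^ (2 * d ∸ 1) * n)           ≡⟨ *-assoc (C ^ d * suc p) (n ^ (2 * d ∸ 1)) n ⟨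
      C ^ d * suc p * n ^ (2 * d ∸ 1) * n             ≤⟨ *-monoˡ-≤ n edges ⟩
      Graph.size G ^ d * suc q * n                    ≤⟨ *-monoˡ-≤ n (*-monoˡ-≤ (suc q) (^-monoˡ-≤ d size≤D)) ⟩
      D ^ d * suc q * n                               ≡⟨ perm₃ (D ^ d) (suc q) n ⟩
      D ^ d * n * suc q ∎)
      where
      open ≤-Reasoning
      perm₁ : ∀ a b c d e → a * (b * c) * d * e ≡ a * b * d * (c * e)
      perm₁ = solve-∀
      perm₂ : ∀ a b c → a * b * (2 * c) ≡ 2 * a * c * b
      perm₂ = solve-∀
      perm₃ : ∀ a b c → a * b * c ≡ a * c * b
      perm₃ = solve-∀
      1≤d : 1 ≤ d
      1≤d = >-nonZero⁻¹ d
      C≤C^d : C ≤ C ^ d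
      C≤C^d = ≤-trans (≤-reflexive (sym (*-identityʳ C))) (^-monoʳ-≤ C 1≤d)
      power : (n * n) ^ d ≡ n ^ (2 * d ∸ 1) * n
      power = trans (cong (_^ d) (cong (n *_) (sym (*-identityʳ n)))) (trans (^-*-assoc n 2 d)
        (trans (cong (n ^_) (sym (m∸n+n≡m {2 * d} (≤-trans 1≤d (m≤m+n d _)))))
          (trans (^-distribˡ-+-* n (2 * d ∸ 1) 1) (cong (n ^ (2 * d ∸ 1) *_) (*-identityʳ n)))))
      size≤D : Graph.size G ≤ D
      size≤D = ≤-trans (m≤n*m (Graph.size G) 2) (≤-reflexive (Adjacency.2*size G))

    module _ {h : ℕ} (H : BipartiteGraph h) where
      open Pattern H
      open BipartiteGraph H using () renaming (size to size-H)

      private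
        N ε : ℕ
        N = n * n
        ε = k * b + ∑ᵛ ones masks

      #conf : ℕ
      #conf = Configurations.#configurations V (Adjacency.adj G) (Adjacency.adj-or-eq Γ) {k} masks L τ

      module _ (bounded : Bounded d H) (K M : ℕ) (M≤C : 2 * (M * suc L) ≤ C) (bound : ConfigurationBound L d k b m K M) where

        length≡n : length V ≡ n
        length≡n = Listₚ.length-tabulate {n = n} (λ i → i)

        configurations : D ^ ε * n ^ (k + b + m) ≤ K * (N ^ ε * #conf)
        configurations = subst (λ j → D ^ ε * j ^ (k + b + m) ≤ K * ((j * j) ^ ε * #conf)) length≡n
          (bound V {{≢-nonZero (λ l≡0 → ≢-nonZero⁻¹ n (trans (sym length≡n) l≡0))}}
            (Adjacency.adj G) (Adjacency.adj-or-eq Γ) masks τ few-bad (ones≤d bounded)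
            (subst (λ j → M * τ * (j * j) ^ d ≤ D ^ d * j) (sym length≡n) (rich M M≤C)))

        -- The exponent of q is raised from `ε` to the number of edges of the pattern by `D ≤ N`.
        -- The factor `h ^ h` is the number of tuples one copy may account for.
        enough-copies : ∀ l → #conf ≤ l * h ^ h →
          (2 * Graph.size G) ^ size-H * n ^ h ≤ suc (K * h ^ h) * (N ^ size-H * l)
        enough-copies l enough = begin
          (2 * Graph.size G) ^ size-H * n ^ h
            ≡⟨ cong (λ s → s ^ size-H * n ^ h) (Adjacency.2*size G) ⟩
          D ^ size-H * n ^ h
            ≡⟨ cong (_* n ^ h) (split D) ⟩
          D ^ ε * D ^ (size-H ∸ ε) * n ^ h
            ≤⟨ *-monoˡ-≤ (n ^ h) (*-monoʳ-≤ (D ^ ε) (^-monoˡ-≤ (size-H ∸ ε) D≤n²)) ⟩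
          D ^ ε * N ^ (size-H ∸ ε) * n ^ h
            ≡⟨ perm₁ (D ^ ε) (N ^ (size-H ∸ ε)) (n ^ h) ⟩
          N ^ (size-H ∸ ε) * (D ^ ε * n ^ h)
            ≡⟨ cong (λ j → N ^ (size-H ∸ ε) * (D ^ ε * n ^ j)) vertices ⟨
          N ^ (size-H ∸ ε) * (D ^ ε * n ^ (k + b + m))
            ≤⟨ *-monoʳ-≤ (N ^ (size-H ∸ ε)) (≤-trans configurations (*-monoʳ-≤ K (*-monoʳ-≤ (N ^ ε) enough))) ⟩
          N ^ (size-H ∸ ε) * (K * (N ^ ε * (l * h ^ h)))
            ≡⟨ perm₂ (N ^ (size-H ∸ ε)) K (N ^ ε) l (h ^ h) ⟩
          K * h ^ h * (N ^ ε * N ^ (size-H ∸ ε) * l)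
            ≡⟨ cong (λ s → K * h ^ h * (s * l)) (split N) ⟨
          K * h ^ h * (N ^ size-H * l)
            ≤⟨ *-monoˡ-≤ (N ^ size-H * l) (n≤1+n (K * h ^ h)) ⟩
          suc (K * h ^ h) * (N ^ size-H * l) ∎
          where
          open ≤-Reasoning
          split : ∀ x → x ^ size-H ≡ x ^ ε * x ^ (size-H ∸ ε)
          split x = trans (cong (x ^_) (sym (m+[n∸m]≡n edges≤size))) (^-distribˡ-+-* x ε (size-H ∸ ε))
          perm₁ : ∀ a b c → a * b * c ≡ b * (a * c)
          perm₁ = solve-∀
          perm₂ : ∀ a b c d e → a * (b * (c * (d * e))) ≡ b * e * (c * a * d)
          perm₂ = solve-∀
          D≤n² : D ≤ N
          D≤n² = subst (λ j → D ≤ j * j) length≡n (D≤N V (Adjacency.adj G))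

        induced-copies : AtLeastInducedCopies
          ((ℤ.+ 1) ℚ./ suc (K * h ^ h) ℚ.* (density G ^ℚ size-H) ℚ.* (n /1 ^ℚ h)) (BipartiteGraph.graph H) G Γ
        induced-copies = let Ks , distinct , induced , enough = Embedding.many-copies H G Γ G⊆Γ L τ in
          Ks , distinct , induced ,
          count-bound (2 * Graph.size G) N n h size-H (length Ks) (K * h ^ h) {{m*n≢0 n n}} (enough-copies (length Ks) enough)

-- Choice of the constants and conclusion.

open Combinatorics using (many-configurations)
open Fractions
open Copies using (module Pattern; module Host; scaled-≥2)
open import Defs
open import Data.Fin.Subset using (∣_∣)
import Data.Integer as ℤ
import Data.Nat as ℕ
import Data.Nat.Properties as ℕₚ
open import Data.Nat using (ℕ; NonZero)
open import Data.Product using (∃₂; _×_; _,_)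
open import Data.Rational using (ℚ; 0ℚ; 1ℚ; _-_; _*_; _<_; _≤_; _/_)
import Data.Rational.Properties as ℚₚ
open import Relation.Binary.PropositionalEquality using (sym; subst)

theorem1p2 : (d : ℕ) → .{{NonZero d}} →
    (h : ℕ) (H : BipartiteGraph h) → Bounded d H →
    (c : ℚ) → 0ℚ < c →
    ∃₂ λ (C α : ℚ) → (0ℚ < C) × (0ℚ < α) ×
    ((n : ℕ) → .{{_ : NonZero n}} →
    (Γ : Graph n) (t : ℚ) → 0ℚ < t → Sparse c t Γ →
    (G : Graph n) → G ⊆ᴳ Γ → ManyEdges d C t G →
    AtLeastInducedCopies
    (α * (density G ^ℚ BipartiteGraph.size H) * (n /1 ^ℚ h))
    (BipartiteGraph.graph H) G Γ)
theorem1p2 d h H bounded c 0<c =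
  let a , b , c≡ = positive-fraction c 0<c
      -- As c = (a + 1) / (b + 1), this gives 2 ≤ c `L`.
      L = 2 ℕ.* ℕ.suc b
      K , M , bound = many-configurations L d (Pattern.k H) (Pattern.b H) (Pattern.m H)
        (ℕₚ.≤-trans (Bounded.1≤numCompleteToB bounded) (ℕₚ.≤-reflexive (sym (Pattern.k≡ H))))
        (ℕₚ.≤-trans (ℕₚ.≤-reflexive (Pattern.k≡ H)) (Bounded.numCompleteToB≤d bounded))
        (Pattern.b≡0⇒m≡0 H)
      -- The bound that `Host.rich` asks for; `suc` makes it positive.
      C = ℕ.suc (2 ℕ.* (M ℕ.* ℕ.suc L))
      -- `K` is lost in counting configurations and `h ^ h` in passing to distinct copies.
      α = ℤ.+ 1 / ℕ.suc (K ℕ.* h ℕ.^ h)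
  in C /1 , α , ℚₚ.positive⁻¹ (C /1) {{/1-positive C}} ,
    ℚₚ.positive⁻¹ α {{ℚₚ.normalize-pos 1 (ℕ.suc (K ℕ.* h ℕ.^ h))}} ,
    λ n Γ t 0<t sparse G G⊆Γ many → let p , q , t≡ = positive-fraction t 0<t in
      Host.induced-copies Γ G G⊆Γ L t p q t≡
        (λ A B t≤A t≤B → sparse-cleared {c} {Graph.e Γ A B} {∣ A ∣ ℕ.* ∣ B ∣} {L} (scaled-≥2 c a b c≡)
          (subst (λ x → Graph.e Γ A B /1 ≤ (1ℚ - c) * x) (sym (/1-* ∣ A ∣ ∣ B ∣)) (sparse A B t≤A t≤B)))
        d C (many-edges-cleared {d = d} C t p q G t≡ many) H bounded K M (ℕₚ.n≤1+n _) bound
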